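{- For all integers $r \ge 2$ and every real $\beta > 0$, there exist an integer $D_{r,\beta}\ge 0$ and a real $\alpha > 0$ such that the following holds for all $D\ge D_{r,\beta}$. Let $G=(A,B)$ be a bipartite $r$-bounded multi-hypergraph such that (G1) every vertex in $A$ has degree at least $(1+D^{ -\alpha})D$ and every vertex in $B$ has degree at most $D$, and (G2) every pair of vertices of $G$ has codegree at most $D^{1-\beta}$. Then there exists an $A$-perfect matching of $G$, and indeed even a set of $D$ pairwise edge-disjoint $A$-perfect matchings of $G$.
   Context: A multi-hypergraph has a vertex set and a multiset of subsets (edges); $r$-bounded means all edges have size at most $r$. Degrees and codegrees (number of edges containing both of two vertices) count multiplicity. $G=(A,B)$ is bipartite with parts $A,B$ if $V(G)=A\cup B$ (disjoint) and every edge contains exactly one vertex of $A$. A matching is $A$-perfect if every vertex of $A$ lies in one of its edges. -}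

module Defs where

open import Data.Nat using (ℕ; _≤_; _*_; _^_; _∸_)
open import Data.Bool using (Bool; true; false; _∧_)
open import Data.Fin using (Fin)
open import Data.Fin.Subset using (Subset; _∈_; _∩_; ∣_∣; Empty)
open import Data.Vec using (lookup; tabulate)
open import Data.Product using (Σ; _×_; ∃)
open import Relation.Binary.PropositionalEquality using (_≡_; _≢_)

-- A finite multi-hypergraph on vertex set Fin n with m edges (edge multiset
-- indexed by Fin m, so repeated edges are allowed).
record Hypergraph (n m : ℕ) : Set where
  field
    edge : Fin m → Subset n

open Hypergraph public

RBounded : ∀ {n m} → ℕ → Hypergraph n m → Set
RBounded r G = ∀ i → ∣ edge G i ∣ ≤ r

degree : ∀ {n m} → Hypergraph n m → Fin n → ℕ
degree G v = ∣ tabulate (λ i → lookup (edge G i) v) ∣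

codegree : ∀ {n m} → Hypergraph n m → Fin n → Fin n → ℕ
codegree G u v = ∣ tabulate (λ i → lookup (edge G i) u ∧ lookup (edge G i) v) ∣

-- Bipartite with parts A and B = complement of A: every edge contains
-- exactly one vertex of A.
Bipartite : ∀ {n m} → Hypergraph n m → Subset n → Set
Bipartite G A = ∀ i → ∣ edge G i ∩ A ∣ ≡ 1

IsMatching : ∀ {n m} → Hypergraph n m → Subset m → Set
IsMatching G M = ∀ i j → i ≢ j → i ∈ M → j ∈ M → Empty (edge G i ∩ edge G j)

APerfect : ∀ {n m} → Hypergraph n m → Subset n → Subset m → Set
APerfect G A M = ∀ v → v ∈ A → Σ (Fin _) λ i → i ∈ M × v ∈ edge G i

IsAPerfectMatching : ∀ {n m} → Hypergraph n m → Subset n → Subset m → Set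
IsAPerfectMatching G A M = IsMatching G M × APerfect G A M

-- (G1) with α = p/q : deg(a) ≥ (1 + D^{-p/q}) D for a ∈ A, deg(b) ≤ D for b ∉ A.
-- For D ≥ 1: deg ≥ D + D^{1-p/q}  ⇔  deg ≥ D ∧ (deg ∸ D)^q * D^p ≥ D^q.
DegLower : ℕ → ℕ → ℕ → ℕ → Set
DegLower D p q d = D ≤ d × D ^ q ≤ (d ∸ D) ^ q * D ^ p

-- (G2) with β = a/b : codeg ≤ D^{1-a/b}  ⇔  codeg^b * D^a ≤ D^b  (D ≥ 1).
CodegUpper : ℕ → ℕ → ℕ → ℕ → Set
CodegUpper D a b c = c ^ b * D ^ a ≤ D ^ b

-- The nibble. Let s be the number of B-vertices of an edge. A state consists of a set of A-vertices still to be matched, each on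
-- exactly a live edges, while every B-vertex is on at most b live edges and codegrees are at most c. If a ≥ 16 s b, independent
-- uniform choices of edges can be made disjoint by the Local Lemma. Otherwise activate each live edge with probability 1/(b X),
-- match along the isolated active edges, and drop the matched A-vertices and every edge with a hit B-vertex. The loss of degree
-- at a vertex is a linear form in the activations, up to a quadratic form of second order (Bonferroni) that only matters in B.
-- Linear forms concentrate by a centred 2k-th moment bound, quadratic forms have small size-biased moments, and the Local Lemma
-- yields an outcome that is good at all vertices at once. With δ = a − b, a step multiplies δ/b by at least 1 + 1/(2X) and a by
-- at least 1 − 2s/X, so a (δ/b)^(8s) never decreases: b stays far above c until the end, however many steps that takes.
-- A family of D disjoint matchings is a single matching in an auxiliary hypergraph made of D copies of G.

module Submission where

open import Defs
open import Data.Bool using (Bool; true; false; _∧_; _∨_; not)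
open import Data.Empty using (⊥; ⊥-elim)
open import Data.Fin using (Fin; zero; suc; splitAt; join; remQuot; combine; toℕ; _↑ˡ_; _↑ʳ_)
open import Data.Fin.Subset using (Subset; _∈_; _∉_; _∩_; Empty)
open import Data.Fin.Subset.Properties using (x∈p∩q⁻)
open import Data.List using (List; []; _∷_; _++_; length; tabulate)
open import Data.Nat
open import Data.Nat.DivMod using (_/_; _%_; m/n*n≤m; m≡m%n+[m/n]*n; m%n<n; m<n*o⇒m/o<n; m*n/n≡m; /-monoˡ-≤)
open import Data.Nat.Properties
open import Data.Nat.Tactic.RingSolver using (solve; solve-∀)
open import Data.Product using (Σ; ∃; _×_; _,_; proj₁; proj₂)
open import Data.Sum using (_⊎_; inj₁; inj₂; map₁; map₂)
open import Data.Vec.Properties using (lookup-zipWith; lookup∘tabulate; lookup⇒[]=; []=⇒lookup)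
open import Function using (_∘_; id)
open import Relation.Nullary using (¬_; Dec; does; yes; no)
open import Relation.Nullary.Decidable using (dec-true; dec-false; ¬?; _×-dec_; _→-dec_)
open import Relation.Binary.PropositionalEquality using (_≡_; _≢_; refl; sym; trans; cong; cong₂; subst; subst₂)
import Data.Bool.Properties as Bool
import Data.Fin.Properties as Fin
import Data.Fin.Subset as Subset
import Data.Integer as ℤ
import Data.Integer.Properties as ℤ
import Data.Integer.Tactic.RingSolver as ℤ
import Data.Vec as Vec

-- Arithmetic of one step

-- The surplus `δ` grows relative to `b` because the two sides lose edges at different rates. An
-- edge at a surviving A-vertex is lost only through its `s` B-vertices, each meeting `b`
-- coordinates; an edge at a B-vertex is lost through `s - 1` other B-vertices and an A-vertex
-- meeting `a = b + δ` coordinates. The extra `δ` in the second rate is the whole gain, so every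
-- error has to stay below it. All scales are powers of one `Y`, and `δ/b` never drops below `1/Y`.
-- With `X = Y^4` the gain per step is of order `δ/X`, so at least about `b/Y^5`; the second-order
-- loss has mean of order `b/X^2 = b/Y^8`; the deviation `t`, about `b/Y^6`, fits between the two
-- with room for Markov's inequality. Since `D` is at most a fixed power of `Y`, so are the
-- dependency degrees, and failure probabilities `Y^-k` with `k` fixed suffice for the Local Lemma:
-- moments of fixed order replace exponential tails. Probabilities are kept as counts of words, so
-- that nothing leaves the integers.

^-distrib-* : ∀ a b k → (a * b) ^ k ≡ a ^ k * b ^ k
^-distrib-* a b zero    = refl
^-distrib-* a b (suc k) = trans (cong (a * b *_) (^-distrib-* a b k)) (lem a b (a ^ k) (b ^ k))
  where
  lem : ∀ a b c d → a * b * (c * d) ≡ a * c * (b * d)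
  lem = solve-∀

private
  -- A certificate for polynomial inequalities: `A ≤ B` is a nonnegative combination of known
  -- inequalities, assembled with `⊕` and `⊗`, `r` is the leftover slack, and the ring solver checks
  -- the identity.
  lin : ∀ {A B g₁ g₂} r → A ≤ B → B + g₁ + r ≡ A + g₂ → g₁ ≤ g₂
  lin {A} {B} {g₁} {g₂} r h e = +-cancelˡ-≤ A g₁ g₂ (begin
    A + g₁ ≤⟨ +-monoˡ-≤ g₁ h ⟩
    B + g₁ ≤⟨ m≤m+n (B + g₁) r ⟩
    B + g₁ + r ≡⟨ e ⟩
    A + g₂ ∎)
    where open ≤-Reasoning

  infixl 6 _⊕_
  infixl 7 _⊗_
  _⊕_ : ∀ {a b c d} → a ≤ b → c ≤ d → a + c ≤ b + d
  _⊕_ = +-mono-≤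
  _⊗_ : ∀ {a b} n → a ≤ b → n * a ≤ n * b
  n ⊗ p = *-monoʳ-≤ n p

-- `μ` and `ν` stand for the rounded mean losses at an A-vertex and at a B-vertex of full degree
-- `b`, and `t` for the tolerated deviation. `a₂` pays `t` once, for the linear form; `b₂` pays it
-- twice, for the linear and the quadratic form. `W` in names abbreviates `X * t`.
module Decrement (s X t b δ μ ν : ℕ) (1≤s : 1 ≤ s) (17s≤X : 17 * s ≤ X) (1≤t : 1 ≤ t) (16W : 16 * (X * t) ≤ δ) (18W : 18 * (X * t) ≤ b)
  (narrow : b + δ ≤ 16 * s * b) (hμ : X * μ ≤ (b + δ) * s) (hν : X * ν ≤ s * b + δ) (hν′ : s * b + δ ≤ X * (1 + ν)) where

  private
    X≤W : X ≤ X * t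
    X≤W = ≤-trans (≤-reflexive (sym (*-identityʳ X))) (*-monoʳ-≤ X 1≤t)

    1≤X : 1 ≤ X
    1≤X = ≤-trans (≤-trans (s≤s z≤n) (*-monoʳ-≤ 17 1≤s)) 17s≤X

    s+1≤X : s + 1 ≤ X
    s+1≤X = lin {A = 17 * s + 1} {B = X + s} (15 * s) (17s≤X ⊕ 1≤s) (solve (s ∷ X ∷ []))

    X≢0 : NonZero X
    X≢0 = >-nonZero 1≤X

    ν≤b : ν ≤ b
    ν≤b = *-cancelˡ-≤ X ⦃ X≢0 ⦄ (lin b (hν ⊕ narrow ⊕ b ⊗ 17s≤X) (solve (s ∷ X ∷ b ∷ δ ∷ ν ∷ [])))

    2t<ν : 1 + 2 * t ≤ ν
    2t<ν = *-cancelˡ-≤ X ⦃ X≢0 ⦄ (lin (12 * X * t + 2 * X + δ) (hν′ ⊕ b ⊗ 1≤s ⊕ 18W ⊕ 4 ⊗ X≤W) (solve (s ∷ X ∷ b ∷ δ ∷ ν ∷ t ∷ [])))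

    room : μ + 3 * t ≤ δ + ν
    room = *-cancelˡ-≤ X ⦃ X≢0 ⦄ (lin (12 * X * t + δ) (hμ ⊕ hν′ ⊕ X≤W ⊕ δ ⊗ s+1≤X ⊕ 16W) (solve (s ∷ X ∷ b ∷ δ ∷ μ ∷ ν ∷ t ∷ [])))

  b₂ a₂ δ₂ : ℕ
  b₂ = b + 2 * t ∸ ν
  a₂ = b + δ ∸ (μ + t)
  δ₂ = a₂ ∸ b₂

  b₂+ν : b₂ + ν ≡ b + 2 * t
  b₂+ν = m∸n+n≡m (≤-trans ν≤b (m≤m+n b (2 * t)))

  private
    fits : b₂ + (μ + t) ≤ b + δ
    fits = +-cancelʳ-≤ ν _ _ (begin
      b₂ + (μ + t) + ν ≡⟨ l₁ b₂ (μ + t) ν ⟩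
      b₂ + ν + (μ + t) ≡⟨ cong (_+ (μ + t)) b₂+ν ⟩
      b + 2 * t + (μ + t) ≡⟨ l₂ b t μ ⟩
      b + (μ + 3 * t) ≤⟨ +-monoʳ-≤ b room ⟩
      b + (δ + ν) ≡⟨ sym (+-assoc b δ ν) ⟩
      b + δ + ν ∎)
      where
      open ≤-Reasoning
      l₁ : ∀ a b c → a + b + c ≡ a + c + b
      l₁ = solve-∀
      l₂ : ∀ b t μ → b + 2 * t + (μ + t) ≡ b + (μ + 3 * t)
      l₂ = solve-∀

  a₂+ : a₂ + (μ + t) ≡ b + δ
  a₂+ = m∸n+n≡m (≤-trans (m≤n+m (μ + t) b₂) fits)

  b₂+δ₂ : b₂ + δ₂ ≡ a₂
  b₂+δ₂ = m+[n∸m]≡n (m+n≤o⇒m≤o∸n b₂ fits)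

  b₂<b : b₂ < b
  b₂<b = +-cancelʳ-≤ (2 * t) _ _ (begin
    suc b₂ + 2 * t ≡⟨ l b₂ t ⟩
    b₂ + (1 + 2 * t) ≤⟨ +-monoʳ-≤ b₂ 2t<ν ⟩
    b₂ + ν ≡⟨ b₂+ν ⟩
    b + 2 * t ∎)
    where
    open ≤-Reasoning
    l : ∀ b t → suc b + 2 * t ≡ b + (1 + 2 * t)
    l = solve-∀

  1≤b₂ : 1 ≤ b₂
  1≤b₂ = +-cancelʳ-≤ ν _ _ (begin
    1 + ν ≤⟨ +-mono-≤ 1≤t ν≤b ⟩
    t + b ≡⟨ +-comm t b ⟩
    b + t ≤⟨ +-monoʳ-≤ b (m≤m+n t (t + 0)) ⟩
    b + 2 * t ≡⟨ sym b₂+ν ⟩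
    b₂ + ν ∎)
    where open ≤-Reasoning

  loss : X * (b + δ) ≤ X * a₂ + 2 * s * (b + δ)
  loss = lin (s * δ + 17 * X * t) (X ⊗ ≤-reflexive (sym a₂+) ⊕ hμ ⊕ 18W ⊕ b ⊗ 1≤s) (go a₂)
    where
    go : ∀ a₂ → X * (a₂ + (μ + t)) + (b + δ) * s + b + b * s + X * (b + δ) + (s * δ + 17 * X * t) ≡ X * (b + δ) + X * μ + 18 * (X * t) + b * 1 + (X * a₂ + 2 * s * (b + δ))
    go a₂ = solve (s ∷ X ∷ b ∷ δ ∷ μ ∷ t ∷ a₂ ∷ [])

  -- Up to errors, `δ` is multiplied by `1 + (1 - s)/X` and `b` by `1 - (s + δ/b)/X`; these are `E₁`
  -- and `E₂`. In the quotient `s/X` cancels and at least `1/X` is left; half of it covers the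
  -- rounding and the terms in `t`, by `16W` and `18W`.
  ratio : (2 * X + 1) * (δ * b₂) ≤ 2 * X * (b * δ₂)
  ratio = *-cancelˡ-≤ (2 * X) ⦃ m*n≢0 2 X ⦃ _ ⦄ ⦃ X≢0 ⦄ ⦄ (go b₂ δ₂ E₁ E₂)
    where
    E₁ : X * δ + δ ≤ X * δ₂ + (s * δ + X + 3 * (X * t))
    E₁ = pf b₂ δ₂ (≤-trans (≤-reflexive (sym a₂+)) (≤-reflexive (cong (_+ (μ + t)) (sym b₂+δ₂)))) (≤-reflexive b₂+ν)
      where
      pf : ∀ b₂ δ₂ → b + δ ≤ b₂ + δ₂ + (μ + t) → b₂ + ν ≤ b + 2 * t → X * δ + δ ≤ X * δ₂ + (s * δ + X + 3 * (X * t))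
      pf b₂ δ₂ h₁ h₂ = lin 0 (X ⊗ h₁ ⊕ X ⊗ h₂ ⊕ hμ ⊕ hν′) (solve (s ∷ X ∷ b ∷ δ ∷ μ ∷ ν ∷ t ∷ b₂ ∷ δ₂ ∷ []))
    E₂ : X * b₂ + (s * b + δ) ≤ X * b + 2 * (X * t) + X
    E₂ = pf b₂ (≤-reflexive b₂+ν)
      where
      pf : ∀ b₂ → b₂ + ν ≤ b + 2 * t → X * b₂ + (s * b + δ) ≤ X * b + 2 * (X * t) + X
      pf b₂ h₂ = lin 0 (X ⊗ h₂ ⊕ hν′) (solve (s ∷ X ∷ b ∷ δ ∷ ν ∷ t ∷ b₂ ∷ []))
    go : ∀ b₂ δ₂ → X * δ + δ ≤ X * δ₂ + (s * δ + X + 3 * (X * t)) → X * b₂ + (s * b + δ) ≤ X * b + 2 * (X * t) + X →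
      2 * X * ((2 * X + 1) * (δ * b₂)) ≤ 2 * X * (2 * X * (b * δ₂))
    go b₂ δ₂ E₁ E₂ = lin (4 * X * δ * δ + 2 * b * s * δ + 2 * δ * δ)
      ((2 * (2 * X + 1) * δ) ⊗ E₂ ⊕ (4 * X * b) ⊗ E₁ ⊕ (2 * ((2 * X + 1) * δ + 2 * X * b)) ⊗ X≤W ⊕ (6 * (X * t) * δ) ⊗ 1≤X ⊕ (X * b) ⊗ 16W ⊕ (X * δ) ⊗ 18W)
      (solve (s ∷ X ∷ b ∷ δ ∷ t ∷ b₂ ∷ δ₂ ∷ []))

bernoulli : ∀ y m → y ^ m * (y + m) ≤ y * (y + 1) ^ m
bernoulli y zero    = ≤-reflexive (trans (+-identityʳ _) (trans (+-identityʳ y) (sym (*-identityʳ y))))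
bernoulli y (suc m) = begin
  y * y ^ m * (y + suc m) ≡⟨ l₁ y (y ^ m) m ⟩
  y * (y ^ m * (y + m)) + y * y ^ m ≤⟨ +-mono-≤ (*-monoʳ-≤ y (bernoulli y m)) (*-monoʳ-≤ y (^-monoˡ-≤ m (m≤m+n y 1))) ⟩
  y * (y * (y + 1) ^ m) + y * (y + 1) ^ m ≡⟨ l₂ y ((y + 1) ^ m) ⟩
  y * ((y + 1) * (y + 1) ^ m) ∎
  where
  open ≤-Reasoning
  l₁ : ∀ y p m → y * p * (y + suc m) ≡ y * (p * (y + m)) + y * p
  l₁ = solve-∀
  l₂ : ∀ y q → y * (y * q) + y * q ≡ y * ((y + 1) * q)
  l₂ = solve-∀

-- a (δ/b)^{8s} does not decrease in a step: the relative growth of δ/b outweighs the relative loss of a.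
potential : ∀ s X a a₂ δ δ₂ b b₂ → 1 ≤ X → 4 * s ≤ X → X * a ≤ X * a₂ + 2 * s * a → (2 * X + 1) * (δ * b₂) ≤ 2 * X * (b * δ₂) →
  a * (δ * b₂) ^ (8 * s) ≤ a₂ * (b * δ₂) ^ (8 * s)
potential s X a a₂ δ δ₂ b b₂ 1≤X 4s≤X loss ratio =
  *-cancelˡ-≤ (2 * X * X * K) ⦃ m*n≢0 (2 * X * X) K ⦃ m*n≢0 (2 * X) X ⦃ 2X≢0 ⦄ ⦃ X≢0 ⦄ ⦄ ⦃ m^n≢0 (2 * X) m ⦃ 2X≢0 ⦄ ⦄ ⦄ (begin
    2 * X * X * K * (a * u ^ m) ≡⟨ l₁ X K a (u ^ m) ⟩
    (2 * X * X) * (K * (a * u ^ m)) ≤⟨ *-monoˡ-≤ (K * (a * u ^ m)) num ⟩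
    (g * (2 * X + m)) * (K * (a * u ^ m)) ≡⟨ l₂ g X m K a (u ^ m) ⟩
    g * a * u ^ m * (K * (2 * X + m)) ≤⟨ *-monoʳ-≤ (g * a * u ^ m) (bernoulli (2 * X) m) ⟩
    g * a * u ^ m * (2 * X * (2 * X + 1) ^ m) ≡⟨ l₃ g a (u ^ m) (2 * X) ((2 * X + 1) ^ m) ⟩
    2 * X * (g * a) * ((2 * X + 1) ^ m * u ^ m) ≡⟨ cong (2 * X * (g * a) *_) (sym (^-distrib-* (2 * X + 1) u m)) ⟩
    2 * X * (g * a) * ((2 * X + 1) * u) ^ m ≤⟨ *-mono-≤ (*-monoʳ-≤ (2 * X) ga) (^-monoˡ-≤ m ratio) ⟩
    2 * X * (X * a₂) * (2 * X * v) ^ m ≡⟨ cong (2 * X * (X * a₂) *_) (^-distrib-* (2 * X) v m) ⟩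
    2 * X * (X * a₂) * (K * v ^ m) ≡⟨ l₄ X a₂ K (v ^ m) ⟩
    2 * X * X * K * (a₂ * v ^ m) ∎)
  where
  open ≤-Reasoning
  m K u v g : ℕ
  m = 8 * s
  K = (2 * X) ^ m
  u = δ * b₂
  v = b * δ₂
  g = X ∸ 2 * s
  X≢0 : NonZero X
  X≢0 = >-nonZero 1≤X
  2X≢0 : NonZero (2 * X)
  2X≢0 = m*n≢0 2 X ⦃ _ ⦄ ⦃ X≢0 ⦄
  X≡ : 2 * s + g ≡ X
  X≡ = m+[n∸m]≡n (≤-trans (*-monoˡ-≤ s {2} {4} (s≤s (s≤s z≤n))) 4s≤X)
  2s≤g : 2 * s ≤ g
  2s≤g = +-cancelˡ-≤ (2 * s) _ _ (≤-trans (≤-reflexive (l s)) (≤-trans 4s≤X (≤-reflexive (sym X≡))))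
    where
    l : ∀ s → 2 * s + 2 * s ≡ 4 * s
    l = solve-∀
  -- This fixes the exponent `8 * s`: the growth factor `1 + 1/(2X)` raised to it is at least
  -- `1 + 4s/X`, and `(1 - 2s/X)(1 + 4s/X) ≥ 1` as soon as `4s ≤ X`.
  num : 2 * X * X ≤ g * (2 * X + m)
  num = subst (λ X → 2 * X * X ≤ g * (2 * X + m)) X≡ (pf g 2s≤g)
    where
    pf : ∀ g → 2 * s ≤ g → 2 * (2 * s + g) * (2 * s + g) ≤ g * (2 * (2 * s + g) + 8 * s)
    pf g h = lin 0 ((4 * s) ⊗ h) (solve (s ∷ g ∷ []))
  ga : g * a ≤ X * a₂
  ga = +-cancelʳ-≤ (2 * s * a) _ _ (≤-trans (≤-reflexive (trans (+-comm (g * a) _) (trans (sym (*-distribʳ-+ a (2 * s) g)) (cong (_* a) X≡)))) loss)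
  l₁ : ∀ X K a p → 2 * X * X * K * (a * p) ≡ 2 * X * X * (K * (a * p))
  l₁ = solve-∀
  l₂ : ∀ g X m K a p → g * (2 * X + m) * (K * (a * p)) ≡ g * a * p * (K * (2 * X + m))
  l₂ = solve-∀
  l₃ : ∀ g a p x q → g * a * p * (x * q) ≡ x * (g * a) * (q * p)
  l₃ = solve-∀
  l₄ : ∀ X a K p → 2 * X * (X * a) * (K * p) ≡ 2 * X * X * K * (a * p)
  l₄ = solve-∀

-- While `a` and `δ` are at most `16 s b ≤ Y b`, the potential inequality gives
-- `D ≤ Y b (Y^2)^(8s)`. So `b` stays within a fixed power of `Y` of `D`, and a codegree that starts
-- below `D` by that power times `Z` remains below `b` by the factor `Z`.
codegree-small : ∀ s Y D a b δ c Z → 1 ≤ b → 1 ≤ Y → 16 * s ≤ Y → a ≤ 16 * s * b → δ ≤ 16 * s * b → D * b ^ (8 * s) ≤ a * (δ * Y) ^ (8 * s) →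
  c * (Z * (Y * (Y * Y) ^ (8 * s))) ≤ D → c * Z ≤ b
codegree-small s Y D a b δ c Z 1≤b 1≤Y 16s≤Y a≤ δ≤ inv hc =
  *-cancelˡ-≤ (Y * (Y * Y) ^ m) ⦃ m*n≢0 Y ((Y * Y) ^ m) ⦃ Y≢0 ⦄ ⦃ m^n≢0 (Y * Y) m ⦃ m*n≢0 Y Y ⦃ Y≢0 ⦄ ⦃ Y≢0 ⦄ ⦄ ⦄ ⦄ (begin
    Y * (Y * Y) ^ m * (c * Z) ≡⟨ l₁ Y ((Y * Y) ^ m) c Z ⟩
    c * (Z * (Y * (Y * Y) ^ m)) ≤⟨ hc ⟩
    D ≤⟨ D≤ ⟩
    Y * b * (Y * Y) ^ m ≡⟨ l₂ Y b ((Y * Y) ^ m) ⟩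
    Y * (Y * Y) ^ m * b ∎)
  where
  open ≤-Reasoning
  m = 8 * s
  Y≢0 : NonZero Y
  Y≢0 = >-nonZero 1≤Y
  l₁ : ∀ y p c z → y * p * (c * z) ≡ c * (z * (y * p))
  l₁ = solve-∀
  l₂ : ∀ y b p → y * b * p ≡ y * p * b
  l₂ = solve-∀
  l₃ : ∀ y b → y * b * y ≡ b * (y * y)
  l₃ = solve-∀
  l₄ : ∀ x p q → x * (p * q) ≡ p * (x * q)
  l₄ = solve-∀
  D≤ : D ≤ Y * b * (Y * Y) ^ m
  D≤ = *-cancelˡ-≤ (b ^ m) ⦃ m^n≢0 b m ⦃ >-nonZero 1≤b ⦄ ⦄ (begin
    b ^ m * D ≡⟨ *-comm (b ^ m) D ⟩
    D * b ^ m ≤⟨ inv ⟩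
    a * (δ * Y) ^ m ≤⟨ *-mono-≤ (≤-trans a≤ (*-monoˡ-≤ b 16s≤Y)) (^-monoˡ-≤ m (*-monoˡ-≤ Y (≤-trans δ≤ (*-monoˡ-≤ b 16s≤Y)))) ⟩
    Y * b * (Y * b * Y) ^ m ≡⟨ cong (λ z → Y * b * z) (trans (cong (_^ m) (l₃ Y b)) (^-distrib-* b (Y * Y) m)) ⟩
    Y * b * (b ^ m * (Y * Y) ^ m) ≡⟨ l₄ (Y * b) (b ^ m) ((Y * Y) ^ m) ⟩
    b ^ m * (Y * b * (Y * Y) ^ m) ∎)

-- The left side is `12` times `Nibble.degeneracy` written out, with `r` for `suc s`. Its two
-- factors are at most `5 r^2 A^3` and `5 r^3 A^2`, whence `312 = 12 (1 + 25)`.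
degeneracy-small : ∀ r a A → a ≤ A → 1 ≤ r → 1 ≤ A →
  12 * suc ((a * (r * a) + (2 * (a * (r * a) * (r * a)) + 2 * (a * (r * a) * (r * a)))) * (r * (r * a) + (2 * (r * (r * a) * (r * a)) + (r * (r * a) * (r * a) + r * (r * a) * (r * a)))))
    ≤ 312 * (r ^ 5 * A ^ 5)
degeneracy-small r a A a≤A 1≤r 1≤A = begin
  12 * suc ((a * (r * a) + (2 * (a * (r * a) * (r * a)) + 2 * (a * (r * a) * (r * a)))) * (r * (r * a) + (2 * (r * (r * a) * (r * a)) + (r * (r * a) * (r * a) + r * (r * a) * (r * a))))) ≤⟨ *-monoʳ-≤ 12 (+-mono-≤ positive (*-mono-≤ f₁≤ f₂≤)) ⟩
  12 * (r ^ 5 * A ^ 5 + 5 * (r * r * A * A * A) * (5 * (r * r * r * A * A))) ≡⟨ final r A ⟩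
  312 * (r ^ 5 * A ^ 5) ∎
  where
  open ≤-Reasoning
  1≤rA : 1 ≤ r * A
  1≤rA = *-mono-≤ 1≤r 1≤A
  positive : 1 ≤ r ^ 5 * A ^ 5
  positive = *-mono-≤ (^-monoˡ-≤ 5 1≤r) (^-monoˡ-≤ 5 1≤A)
  f₁≤ : a * (r * a) + (2 * (a * (r * a) * (r * a)) + 2 * (a * (r * a) * (r * a))) ≤ 5 * (r * r * A * A * A)
  f₁≤ = lin 0 (r ⊗ *-mono-≤ a≤A a≤A ⊕ (4 * r * r) ⊗ *-mono-≤ (*-mono-≤ a≤A a≤A) a≤A ⊕ (r * A * A) ⊗ 1≤rA) (solve (r ∷ a ∷ A ∷ []))
  f₂≤ : r * (r * a) + (2 * (r * (r * a) * (r * a)) + (r * (r * a) * (r * a) + r * (r * a) * (r * a))) ≤ 5 * (r * r * r * A * A)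
  f₂≤ = lin 0 ((r * r) ⊗ a≤A ⊕ (4 * r * r * r) ⊗ *-mono-≤ a≤A a≤A ⊕ (r * r * A) ⊗ 1≤rA) (solve (r ∷ a ∷ A ∷ []))
  final : ∀ r A → 12 * (r * (r * (r * (r * (r * 1)))) * (A * (A * (A * (A * (A * 1))))) + 5 * (r * r * A * A * A) * (5 * (r * r * r * A * A)))
    ≡ 312 * (r * (r * (r * (r * (r * 1)))) * (A * (A * (A * (A * (A * 1))))))
  final = solve-∀

-- These make the hypotheses `n₁` to `n₅` of the nibble hold: `κ₀` scales the budget
-- `Λ = κ₀ c b T^2` of the linear forms, `κ₁` the budget `B = κ₁ b^3` of the quadratic ones, `κ₂`
-- the dependency degree. `κ₀` and `κ₁` add up what the separate terms need. They are opaque so that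
-- these polynomials do not unfold elsewhere.
module Constants (s r k κk : ℕ) where
  opaque
    κ₀ κ₁ κ₂ : ℕ
    κ₀ = 3 * (r * r) + 512 * (κk * (r * r * (s * s)))
    κ₁ = 8192 * (r * r * (s * s * s)) + 16 * (s * (r * r)) + 128 * (k * (s * (r * r))) + 2 * ((2 * k + 2 * k * (2 * k)) * (r * r)) + 1
    κ₂ = 312 * (r ^ 5 * (16 * s) ^ 5)

    κ₀>0 : 1 ≤ r → 1 ≤ κ₀
    κ₀>0 1≤r = ≤-trans (*-mono-≤ {1} {3} (s≤s z≤n) (*-mono-≤ 1≤r 1≤r)) (m≤m+n (3 * (r * r)) _)

    κ₁>0 : 1 ≤ κ₁
    κ₁>0 = m≤n+m 1 _

  module _ (a b c : ℕ) (narrow : a ≤ 16 * s * b) where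
    opaque
      unfolding κ₀ κ₁ κ₂

      linear₁ : ∀ T → c ≤ b → 3 * ((c * r * T) * (c * r * T)) ≤ κ₀ * (c * b) * (T * T)
      linear₁ = pf
        where
        pf : ∀ T → c ≤ b → 3 * ((c * r * T) * (c * r * T)) ≤ (3 * (r * r) + 512 * (κk * (r * r * (s * s)))) * (c * b) * (T * T)
        pf T c≤b = lin (512 * T * T * b * c * r * r * s * s * κk) ((3 * r * r * c * T * T) ⊗ c≤b) (solve (s ∷ r ∷ κk ∷ b ∷ c ∷ T ∷ []))

      linear₂ : ∀ T → b ≤ T → 2 * (κk * (c * r * (a * (r * a))) * T) ≤ κ₀ * (c * b) * (T * T)
      linear₂ = pf
        where
        pf : ∀ T → b ≤ T → 2 * (κk * (c * r * (a * (r * a))) * T) ≤ (3 * (r * r) + 512 * (κk * (r * r * (s * s)))) * (c * b) * (T * T)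
        pf T b≤T = lin (3 * T * T * b * c * r * r) ((2 * κk * c * r * r * T) ⊗ (*-mono-≤ narrow narrow) ⊕ (512 * κk * c * r * r * s * s * b * T) ⊗ b≤T)
          (solve (s ∷ r ∷ κk ∷ a ∷ b ∷ c ∷ T ∷ []))

      -- `t^2` is at least `b^2/(4 Z^2)`, while `c b` is at most `b^2/(Z^2 Y^2)`. Of the two spare
      -- factors `Y`, one is the Markov gain per moment and the other absorbs `4 * κ₀`.
      linear₃ : ∀ Y Z t T → 1 ≤ Y → 1 ≤ Z → c * (Z * Z * Y * Y) ≤ b → b ≤ 2 * t * Z → 4 * κ₀ ≤ Y → κ₀ * (c * b) * (T * T) * Y ≤ T * t * (T * t)
      linear₃ Y Z t T 1≤Y 1≤Z hc hb hY = ≤-trans (≤-reflexive (l (κ₀ * (c * b)) T Y)) (≤-trans (*-monoʳ-≤ (T * T) (*-cancelʳ-≤ _ _ (Z * Z * Y)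
          ⦃ m*n≢0 (Z * Z) Y ⦃ m*n≢0 Z Z ⦃ >-nonZero 1≤Z ⦄ ⦃ >-nonZero 1≤Z ⦄ ⦄ ⦃ >-nonZero 1≤Y ⦄ ⦄ (main κ₀ hY))) (≤-reflexive (l₂ T t)))
        where
        l : ∀ x T Y → x * (T * T) * Y ≡ T * T * (x * Y)
        l = solve-∀
        l₂ : ∀ T t → T * T * (t * t) ≡ T * t * (T * t)
        l₂ = solve-∀
        main : ∀ κ → 4 * κ ≤ Y → κ * (c * b) * Y * (Z * Z * Y) ≤ t * t * (Z * Z * Y)
        main κ hY = lin 0 ((κ * b) ⊗ hc ⊕ (κ * b) ⊗ hb ⊕ (2 * κ * t * Z) ⊗ hb ⊕ (t * t * Z * Z) ⊗ hY) (solve (κ ∷ b ∷ c ∷ Y ∷ Z ∷ t ∷ []))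

      quadratic₁ : ∀ X → X * c ≤ b → X * X * c ≤ b →
        2 * (a * (r * a) * (r * a)) + b * X * (a * (r * (r * c))) + 2 * (b * X) * (2 * k) * (2 * (c * r * (r * a))) + b * X * (b * X) * (2 * k + 2 * k * (2 * k)) * (2 * (c * r * r)) ≤ κ₁ * (b * b * b)
      quadratic₁ = pf
        where
        pf : ∀ X → X * c ≤ b → X * X * c ≤ b →
          2 * (a * (r * a) * (r * a)) + b * X * (a * (r * (r * c))) + 2 * (b * X) * (2 * k) * (2 * (c * r * (r * a))) + b * X * (b * X) * (2 * k + 2 * k * (2 * k)) * (2 * (c * r * r)) ≤ (8192 * (r * r * (s * s * s)) + 16 * (s * (r * r)) + 128 * (k * (s * (r * r))) + 2 * ((2 * k + 2 * k * (2 * k)) * (r * r)) + 1) * (b * b * b)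
        pf X h₁ h₂ = lin (b * b * b) ((2 * r * r) ⊗ (*-mono-≤ (*-mono-≤ narrow narrow) narrow) ⊕ (b * a * r * r) ⊗ h₁ ⊕ (b * b * r * r) ⊗ narrow
          ⊕ (8 * k * r * r * a * b) ⊗ h₁ ⊕ (8 * k * r * r * b * b) ⊗ narrow ⊕ ((2 * k + 4 * k * k) * 2 * r * r * b * b) ⊗ h₂)
          (solve (s ∷ r ∷ k ∷ a ∷ b ∷ c ∷ X ∷ []))

      -- In the application `Z * Y * Y` is `X * X`, so the right side is `T * T * t`. Bounding one
      -- factor `b` by `2 * t * Z` leaves only `2 κ₁ Y ≤ Y^2`.
      quadratic₂ : ∀ Y Z t → b ≤ 2 * t * Z → 2 * κ₁ ≤ Y → κ₁ * (b * b * b) * Y ≤ b * b * (Z * Y * Y) * t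
      quadratic₂ Y Z t hb hY = main κ₁ hY
        where
        main : ∀ κ → 2 * κ ≤ Y → κ * (b * b * b) * Y ≤ b * b * (Z * Y * Y) * t
        main κ hY = lin 0 ((κ * b * b * Y) ⊗ hb ⊕ (b * b * t * Z * Y) ⊗ hY) (solve (κ ∷ b ∷ Y ∷ Z ∷ t ∷ []))

      degeneracy≤ : 1 ≤ r → 1 ≤ s → 1 ≤ b →
        12 * suc ((a * (r * a) + (2 * (a * (r * a) * (r * a)) + 2 * (a * (r * a) * (r * a)))) * (r * (r * a) + (2 * (r * (r * a) * (r * a)) + (r * (r * a) * (r * a) + r * (r * a) * (r * a))))) ≤ κ₂ * b ^ 5
      degeneracy≤ 1≤r 1≤s 1≤b = begin
        _ ≤⟨ degeneracy-small r a (16 * s * b) narrow 1≤r (*-mono-≤ (*-mono-≤ {1} {16} (s≤s z≤n) 1≤s) 1≤b) ⟩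
        312 * (r ^ 5 * (16 * s * b) ^ 5) ≡⟨ cong (λ z → 312 * (r ^ 5 * z)) (^-distrib-* (16 * s) b 5) ⟩
        312 * (r ^ 5 * ((16 * s) ^ 5 * b ^ 5)) ≡⟨ arr 312 (r ^ 5) ((16 * s) ^ 5) (b ^ 5) ⟩
        κ₂ * b ^ 5 ∎
        where
        open ≤-Reasoning
        arr : ∀ n p q x → n * (p * (q * x)) ≡ n * (p * q) * x
        arr = solve-∀

open import Data.Vec using (Vec; []; _∷_; lookup)
open import Algebra.Properties.Semiring.Sum +-*-semiring using () renaming (sum to ∑; sum-cong-≗ to ∑-cong; ∑-distrib-+ to ∑-+; ∑-comm to ∑-swap; *-distribˡ-sum to ∑-*ˡ′; *-distribʳ-sum to ∑-*ʳ′)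

-- Indicators and finite sums

ι : Bool → ℕ
ι true  = 1
ι false = 0

ι≤1 : ∀ b → ι b ≤ 1
ι≤1 true  = ≤-refl
ι≤1 false = z≤n

ι-∧ : ∀ a b → ι (a ∧ b) ≡ ι a * ι b
ι-∧ true  b = sym (+-identityʳ _)
ι-∧ false b = refl

ι-sq : ∀ a → ι a * ι a ≡ ι a
ι-sq true  = refl
ι-sq false = refl

ι-not : ∀ a → ι a + ι (not a) ≡ 1
ι-not true  = refl
ι-not false = refl

true≢false : ∀ {a} → a ≡ true → a ≡ false → ⊥
true≢false refl ()

∧-intro : ∀ {a b} → a ≡ true → b ≡ true → a ∧ b ≡ true
∧-intro refl refl = refl

∧-fst : ∀ {a b} → a ∧ b ≡ true → a ≡ true
∧-fst {true} _ = refl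

∧-snd : ∀ {a b} → a ∧ b ≡ true → b ≡ true
∧-snd {true} p = p

_==_ : ∀ {n} → Fin n → Fin n → Bool
i == j = does (i Fin.≟ j)

==-true : ∀ {n} {i j : Fin n} → (i == j) ≡ true → i ≡ j
==-true {i = i} {j} e with i Fin.≟ j
... | yes p = p

==-refl : ∀ {n} (i : Fin n) → (i == i) ≡ true
==-refl i = dec-true (i Fin.≟ i) refl

≢-== : ∀ {n} {i j : Fin n} → i ≢ j → (i == j) ≡ false
≢-== {i = i} {j} = dec-false (i Fin.≟ j)

==-sym : ∀ {n} (i j : Fin n) → (i == j) ≡ (j == i)
==-sym i j with i Fin.≟ j
... | yes refl = sym (==-refl i)
... | no  p    = sym (≢-== (p ∘ sym))

∑-*ˡ : ∀ {n} c (f : Fin n → ℕ) → ∑ (λ i → c * f i) ≡ c * ∑ f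
∑-*ˡ c f = sym (∑-*ˡ′ c f)

∑-*ʳ : ∀ {n} c (f : Fin n → ℕ) → ∑ (λ i → f i * c) ≡ ∑ f * c
∑-*ʳ c f = sym (∑-*ʳ′ c f)

∑-mono : ∀ {n} {f g : Fin n → ℕ} → (∀ i → f i ≤ g i) → ∑ f ≤ ∑ g
∑-mono {zero}  h = z≤n
∑-mono {suc n} h = +-mono-≤ (h zero) (∑-mono (h ∘ suc))

∑-const : ∀ n c → ∑ {n} (λ _ → c) ≡ n * c
∑-const zero    c = refl
∑-const (suc n) c = cong (c +_) (∑-const n c)

∑-zero : ∀ {n} {f : Fin n → ℕ} → (∀ i → f i ≡ 0) → ∑ f ≡ 0
∑-zero {n} h = trans (∑-cong h) (trans (∑-const n 0) (*-zeroʳ n))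

≤∑ : ∀ {n} (f : Fin n → ℕ) i → f i ≤ ∑ f
≤∑ f zero    = m≤m+n _ _
≤∑ f (suc i) = ≤-trans (≤∑ (f ∘ suc) i) (m≤n+m _ _)

≤∑₂ : ∀ {n} (f : Fin n → ℕ) {i j} → i ≢ j → f i + f j ≤ ∑ f
≤∑₂ f {zero}  {zero}  i≢j = ⊥-elim (i≢j refl)
≤∑₂ f {zero}  {suc j} i≢j = +-monoʳ-≤ (f zero) (≤∑ (f ∘ suc) j)
≤∑₂ f {suc i} {zero}  i≢j = ≤-trans (≤-reflexive (+-comm (f (suc i)) _)) (+-monoʳ-≤ (f zero) (≤∑ (f ∘ suc) i))
≤∑₂ f {suc i} {suc j} i≢j = ≤-trans (≤∑₂ (f ∘ suc) (i≢j ∘ cong suc)) (m≤n+m _ _)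

∑-pos : ∀ {n} (f : Fin n → ℕ) → 1 ≤ ∑ f → ∃ λ i → 1 ≤ f i
∑-pos {suc n} f p with f zero in eq
... | suc k = zero , subst (1 ≤_) (sym eq) (s≤s z≤n)
... | zero  with ∑-pos (f ∘ suc) p
... | i , q = suc i , q

∑-δ : ∀ {n} (i : Fin n) (f : Fin n → ℕ) → ∑ (λ j → ι (i == j) * f j) ≡ f i
∑-δ zero    f = trans (cong₂ _+_ (+-identityʳ (f zero)) (∑-zero {f = λ j → ι (zero == suc j) * f (suc j)} (λ _ → refl))) (+-identityʳ _)
∑-δ (suc i) f = ∑-δ i (f ∘ suc)

∑-*≤ : ∀ {n} {c} (f g : Fin n → ℕ) → (∀ i → g i ≤ c) → ∑ (λ i → f i * g i) ≤ ∑ f * c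
∑-*≤ {c = c} f g h = ≤-trans (∑-mono λ i → *-monoʳ-≤ (f i) (h i)) (≤-reflexive (∑-*ʳ c f))

∑-⊎ : ∀ m {n} (F : Fin m ⊎ Fin n → ℕ) → ∑ (λ u → F (splitAt m u)) ≡ ∑ (F ∘ inj₁) + ∑ (F ∘ inj₂)
∑-⊎ zero    F = refl
∑-⊎ (suc m) F = trans (cong (F (inj₁ zero) +_) (trans (∑-cong lem) (∑-⊎ m (F ∘ map₁ suc)))) (sym (+-assoc (F (inj₁ zero)) _ _))
  where
  lem : ∀ u → F (splitAt (suc m) (suc u)) ≡ F (map₁ suc (splitAt m u))
  lem u = refl

∑-× : ∀ m n (F : Fin m × Fin n → ℕ) → ∑ (λ u → F (remQuot n u)) ≡ ∑ λ i → ∑ λ j → F (i , j)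
∑-× zero    n F = refl
∑-× (suc m) n F = trans (trans (∑-cong lem) (∑-⊎ n G)) (cong₂ _+_ refl (∑-× m n (λ p → F (suc (proj₁ p) , proj₂ p))))
  where
  G : Fin n ⊎ Fin (m * n) → ℕ
  G (inj₁ j) = F (zero , j)
  G (inj₂ k) = F (suc (proj₁ (remQuot {m} n k)) , proj₂ (remQuot {m} n k))
  lem : ∀ u → F (remQuot {suc m} n u) ≡ G (splitAt n u)
  lem u with splitAt n u
  ... | inj₁ j = refl
  ... | inj₂ k = refl

-- Totals over the product space of all words of length N over Fin T

total : ∀ {T N} → (Vec (Fin T) N → ℕ) → ℕ
total {N = zero}  f = f []
total {N = suc N} f = ∑ λ t → total λ ω → f (t ∷ ω)

total-cong : ∀ {T N} {f g : Vec (Fin T) N → ℕ} → (∀ ω → f ω ≡ g ω) → total f ≡ total g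
total-cong {N = zero}  h = h []
total-cong {N = suc N} h = ∑-cong λ t → total-cong λ ω → h (t ∷ ω)

total-mono : ∀ {T N} {f g : Vec (Fin T) N → ℕ} → (∀ ω → f ω ≤ g ω) → total f ≤ total g
total-mono {N = zero}  h = h []
total-mono {N = suc N} h = ∑-mono λ t → total-mono λ ω → h (t ∷ ω)

total-+ : ∀ {T N} (f g : Vec (Fin T) N → ℕ) → total (λ ω → f ω + g ω) ≡ total f + total g
total-+ {N = zero}  f g = refl
total-+ {T} {suc N} f g = trans (∑-cong λ t → total-+ (λ ω → f (t ∷ ω)) (λ ω → g (t ∷ ω)))
  (∑-+ (λ t → total λ ω → f (t ∷ ω)) (λ t → total λ ω → g (t ∷ ω)))

total-*ˡ : ∀ {T N} c (f : Vec (Fin T) N → ℕ) → total (λ ω → c * f ω) ≡ c * total f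
total-*ˡ {N = zero}  c f = refl
total-*ˡ {N = suc N} c f = trans (∑-cong λ t → total-*ˡ c (λ ω → f (t ∷ ω))) (∑-*ˡ c (λ t → total λ ω → f (t ∷ ω)))

total-const : ∀ {T} N c → total {T} {N} (λ _ → c) ≡ T ^ N * c
total-const     zero    c = sym (+-identityʳ c)
total-const {T} (suc N) c = trans (∑-cong {T} λ t → total-const N c) (trans (∑-const T _) (sym (*-assoc T (T ^ N) c)))

total-zero : ∀ {T N} → total {T} {N} (λ _ → 0) ≡ 0
total-zero {T} {N} = trans (total-const {T} N 0) (*-zeroʳ (T ^ N))

total-∑ : ∀ {T N n} (f : Fin n → Vec (Fin T) N → ℕ) → total (λ ω → ∑ λ i → f i ω) ≡ ∑ λ i → total (f i)
total-∑ {T} {N} {zero}  f = total-zero {T} {N}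
total-∑ {n = suc n} f = trans (total-+ (f zero) (λ ω → ∑ λ i → f (suc i) ω)) (cong (total (f zero) +_) (total-∑ (f ∘ suc)))

total-pos : ∀ {T N} (f : Vec (Fin T) N → ℕ) → 1 ≤ total f → ∃ λ ω → 1 ≤ f ω
total-pos {N = zero}  f p = [] , p
total-pos {N = suc N} f p with ∑-pos (λ t → total λ ω → f (t ∷ ω)) p
... | t , q with total-pos (λ ω → f (t ∷ ω)) q
... | ω , r = t ∷ ω , r

DependsOn : ∀ {T N} {A : Set} → (Fin N → Bool) → (Vec (Fin T) N → A) → Set
DependsOn d f = ∀ ω ω′ → (∀ u → d u ≡ true → lookup ω u ≡ lookup ω′ u) → f ω ≡ f ω′

private
  agree-cons : ∀ {T N} (d : Fin (suc N) → Bool) {t t′ : Fin T} {ω ω′ : Vec (Fin T) N} → (d zero ≡ true → t ≡ t′) →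
    (∀ u → d (suc u) ≡ true → lookup ω u ≡ lookup ω′ u) → ∀ u → d u ≡ true → lookup (t ∷ ω) u ≡ lookup (t′ ∷ ω′) u
  agree-cons d h k zero    = h
  agree-cons d h k (suc u) = k u

  tail-dep : ∀ {T N} {A : Set} (d : Fin (suc N) → Bool) {f : Vec (Fin T) (suc N) → A} → DependsOn d f → ∀ t → DependsOn (d ∘ suc) (λ ω → f (t ∷ ω))
  tail-dep d h t ω ω′ k = h (t ∷ ω) (t ∷ ω′) (agree-cons d (λ _ → refl) k)

  head-indep : ∀ {T N} (d : Fin (suc N) → Bool) {f : Vec (Fin T) (suc N) → ℕ} → d zero ≡ false → DependsOn d f →
    ∀ t t′ → total (λ ω → f (t ∷ ω)) ≡ total (λ ω → f (t′ ∷ ω))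
  head-indep d e h t t′ = total-cong λ ω → h (t ∷ ω) (t′ ∷ ω) (agree-cons d (λ e′ → ⊥-elim (true≢false e′ e)) (λ _ _ → refl))

  assemble : ∀ {n} (a b c : Fin n → ℕ) M → (∀ t t′ → a t ≡ a t′) → (∀ t → M * c t ≡ a t * b t) → n * M * ∑ c ≡ ∑ a * ∑ b
  assemble {zero}  a b c M h k = refl
  assemble {suc n} a b c M h k = begin-equality
    suc n * M * ∑ c ≡⟨ *-assoc (suc n) M (∑ c) ⟩
    suc n * (M * ∑ c) ≡⟨ cong (suc n *_) (sym (∑-*ˡ M c)) ⟩
    suc n * ∑ (λ t → M * c t) ≡⟨ cong (suc n *_) (∑-cong λ t → trans (k t) (cong (_* b t) (h t zero))) ⟩
    suc n * ∑ (λ t → a zero * b t) ≡⟨ cong (suc n *_) (∑-*ˡ (a zero) b) ⟩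
    suc n * (a zero * ∑ b) ≡⟨ sym (*-assoc (suc n) (a zero) (∑ b)) ⟩
    suc n * a zero * ∑ b ≡⟨ cong (_* ∑ b) (sym (trans (∑-cong λ t → h t zero) (∑-const (suc n) (a zero)))) ⟩
    ∑ a * ∑ b ∎
    where open ≤-Reasoning

-- By induction on the coordinates: the head is read by only one of the two functions, so the
-- partial totals of the other are constant in it, and `assemble` pulls them out of the sum.
independence : ∀ {T N} (d : Fin N → Bool) (f g : Vec (Fin T) N → ℕ) → DependsOn d f → DependsOn (not ∘ d) g →
  T ^ N * total (λ ω → f ω * g ω) ≡ total f * total g
independence {N = zero}  d f g hf hg = +-identityʳ _
independence {T} {suc N} d f g hf hg with d zero in e
... | true  = trans (assemble {T} (λ t → total λ ω → g (t ∷ ω)) (λ t → total λ ω → f (t ∷ ω)) _ (T ^ N) (head-indep (not ∘ d) (cong not e) hg)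
                (λ t → trans (independence (d ∘ suc) _ _ (tail-dep d hf t) (tail-dep (not ∘ d) hg t)) (*-comm (total λ ω → f (t ∷ ω)) _)))
                (*-comm (∑ {T} λ t → total λ ω → g (t ∷ ω)) _)
... | false = assemble {T} (λ t → total λ ω → f (t ∷ ω)) (λ t → total λ ω → g (t ∷ ω)) _ (T ^ N) (head-indep d e hf)
                (λ t → independence (d ∘ suc) _ _ (tail-dep d hf t) (tail-dep (not ∘ d) hg t))

-- The symmetric Lovász Local Lemma, by counting

module LLL {T N K : ℕ} (bad : Fin K → Vec (Fin T) N → Bool) (dep : Fin K → Fin N → Bool) (nb : Fin K → Fin K → Bool) (Δ : ℕ)
  (T>0 : 1 ≤ T) (Δ>0 : 1 ≤ Δ)
  (bad-dep : ∀ v → DependsOn (dep v) (bad v))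
  (nb-dep : ∀ v j → nb v j ≡ false → ∀ u → dep v u ≡ true → dep j u ≡ true → ⊥)
  (small : ∀ v → 4 * Δ * total (ι ∘ bad v) ≤ T ^ N)
  (few : ∀ v → ∑ (λ j → ι (nb v j)) ≤ Δ) where

  private
    good : List (Fin K) → Vec (Fin T) N → ℕ
    good []      ω = 1
    good (j ∷ L) ω = ι (not (bad j ω)) * good L ω

    count : Fin K → List (Fin K) → ℕ
    count v []      = 0
    count v (j ∷ L) = ι (nb v j) + count v L

    good-split : ∀ w L ω → ι (bad w ω) * good L ω + good (w ∷ L) ω ≡ good L ω
    good-split w L ω = trans (sym (*-distribʳ-+ (good L ω) (ι (bad w ω)) _)) (trans (cong (_* good L ω) (ι-not (bad w ω))) (+-identityʳ _))

    good-cons≤ : ∀ w L ω → good (w ∷ L) ω ≤ good L ω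
    good-cons≤ w L ω = m+n≤o⇒n≤o _ (≤-reflexive (good-split w L ω))

    good-++≤ : ∀ M L ω → good (M ++ L) ω ≤ good L ω
    good-++≤ []      L ω = ≤-refl
    good-++≤ (w ∷ M) L ω = ≤-trans (good-cons≤ w (M ++ L) ω) (good-++≤ M L ω)

    Far : Fin K → List (Fin K) → Set
    Far v []      = 1 ≤ 1
    Far v (j ∷ L) = nb v j ≡ false × Far v L

    far-dep : ∀ v L → Far v L → DependsOn (not ∘ dep v) (good L)
    far-dep v []      _       ω ω′ h = refl
    far-dep v (j ∷ L) (e , q) ω ω′ h = cong₂ _*_ (cong (ι ∘ not) (bad-dep j ω ω′ λ u du → h u (k u du))) (far-dep v L q ω ω′ h)
      where
      k : ∀ u → dep j u ≡ true → not (dep v u) ≡ true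
      k u du with dep v u in dv
      ... | false = refl
      ... | true  = ⊥-elim (nb-dep v j e u dv du)

    record Split (v : Fin K) (L : List (Fin K)) : Set where
      field
        near far : List (Fin K)
        isFar    : Far v far
        length-≡ : length near + length far ≡ length L
        near-≤   : length near ≤ count v L
        count-≡  : ∀ i → count i near + count i far ≡ count i L
        good-≡   : ∀ ω → good near ω * good far ω ≡ good L ω

    split : ∀ v L → Split v L
    split v [] = record { near = [] ; far = [] ; isFar = ≤-refl ; length-≡ = refl ; near-≤ = z≤n ; count-≡ = λ _ → refl ; good-≡ = λ _ → refl }
    split v (j ∷ L) with nb v j in e
    ... | true  = record { near = j ∷ near ; far = far ; isFar = isFar ; length-≡ = cong suc length-≡ ; near-≤ = p
                         ; count-≡ = λ i → trans (+-assoc (ι (nb i j)) _ _) (cong (ι (nb i j) +_) (count-≡ i))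
                         ; good-≡ = λ ω → trans (*-assoc (ι (not (bad j ω))) _ _) (cong (ι (not (bad j ω)) *_) (good-≡ ω)) }
      where
      open Split (split v L)
      p : suc (length near) ≤ ι (nb v j) + count v L
      p rewrite e = s≤s near-≤
    ... | false = record { near = near ; far = j ∷ far ; isFar = e , isFar ; length-≡ = trans (+-suc _ _) (cong suc length-≡)
                         ; near-≤ = ≤-trans near-≤ (m≤n+m _ _)
                         ; count-≡ = λ i → trans (x+yz (count i near) (ι (nb i j)) _) (cong (ι (nb i j) +_) (count-≡ i))
                         ; good-≡ = λ ω → trans (x*yz (good near ω) (ι (not (bad j ω))) _) (cong (ι (not (bad j ω)) *_) (good-≡ ω)) }
      where
      open Split (split v L)
      x+yz : ∀ x y z → x + (y + z) ≡ y + (x + z)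
      x+yz = solve-∀
      x*yz : ∀ x y z → x * (y * z) ≡ y * (x * z)
      x*yz = solve-∀

    good-++ : ∀ M L ω → good (M ++ L) ω ≡ good M ω * good L ω
    good-++ []      L ω = sym (+-identityʳ _)
    good-++ (j ∷ M) L ω = trans (cong (ι (not (bad j ω)) *_) (good-++ M L ω)) (sym (*-assoc (ι (not (bad j ω))) _ _))

    count-++ : ∀ i M L → count i (M ++ L) ≡ count i M + count i L
    count-++ i []      L = refl
    count-++ i (j ∷ M) L = trans (cong (ι (nb i j) +_) (count-++ i M L)) (sym (+-assoc (ι (nb i j)) _ _))

    length-++′ : ∀ (M L : List (Fin K)) → length (M ++ L) ≡ length M + length L
    length-++′ []      L = refl
    length-++′ (j ∷ M) L = cong suc (length-++′ M L)

    -- Neighbours are counted with multiplicity. This is all that the induction uses about a list,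
    -- and it passes to sublists.
    Sparse : List (Fin K) → Set
    Sparse L = ∀ i → count i L ≤ Δ

    -- `P(bad v | good L) ≤ 1/(2Δ)` with denominators cleared, which avoids conditioning on an event
    -- that might be empty.
    Claim : List (Fin K) → Set
    Claim L = ∀ v → 2 * Δ * total (λ ω → ι (bad v ω) * good L ω) ≤ total (good L)

    -- Adding the events of M to L₂ one at a time removes at most a 1/(2Δ) fraction of the words each time.
    add-near : ∀ L₂ M → (∀ M₁ w M₂ → M ≡ M₁ ++ w ∷ M₂ → Claim (M₂ ++ L₂)) →
      2 * Δ * total (good L₂) ≤ 2 * Δ * total (good (M ++ L₂)) + length M * total (good L₂)
    add-near L₂ []      h = m≤m+n _ _
    add-near L₂ (w ∷ M) h = begin
      2 * Δ * A ≤⟨ add-near L₂ M (λ M₁ w′ M₂ e → h (w ∷ M₁) w′ M₂ (cong (w ∷_) e)) ⟩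
      2 * Δ * B + length M * A ≡⟨ cong (λ z → 2 * Δ * z + length M * A) (sym B≡) ⟩
      2 * Δ * (X + B′) + length M * A ≡⟨ cong (_+ length M * A) (*-distribˡ-+ (2 * Δ) X B′) ⟩
      2 * Δ * X + 2 * Δ * B′ + length M * A ≤⟨ +-monoˡ-≤ (length M * A) (+-monoˡ-≤ (2 * Δ * B′) (≤-trans (h [] w M refl w) B≤A)) ⟩
      A + 2 * Δ * B′ + length M * A ≡⟨ arr A (2 * Δ * B′) (length M * A) ⟩
      2 * Δ * B′ + (A + length M * A) ∎
      where
      open ≤-Reasoning
      A B B′ X : ℕ
      A  = total (good L₂)
      B  = total (good (M ++ L₂))
      B′ = total (good (w ∷ M ++ L₂))
      X  = total (λ ω → ι (bad w ω) * good (M ++ L₂) ω)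
      B≡ : X + B′ ≡ B
      B≡ = trans (sym (total-+ (λ ω → ι (bad w ω) * good (M ++ L₂) ω) (good (w ∷ M ++ L₂)))) (total-cong (good-split w (M ++ L₂)))
      B≤A : B ≤ A
      B≤A = total-mono (good-++≤ M L₂)
      arr : ∀ a b c → a + b + c ≡ b + (a + c)
      arr = solve-∀

    T^N>0 : NonZero (T ^ N)
    T^N>0 = m^n≢0 T N ⦃ >-nonZero T>0 ⦄

    -- Without the near events, `bad v` is independent of the rest, so it takes at most a share
    -- `1/(4Δ)` of `good far`. Putting back the near events, at most `Δ` of them, removes at most
    -- half of `good far`, because each addition is an instance of the claim for a shorter list. The
    -- bound `n` on the length makes the recursion structural.
    claim : ∀ n L → length L ≤ n → Sparse L → Claim L
    claim n L len sp v = *-cancelˡ-≤ 2 (begin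
      2 * (2 * Δ * X) ≡⟨ arr₁ Δ X ⟩
      4 * Δ * X ≤⟨ *-monoʳ-≤ (4 * Δ) X≤X₂ ⟩
      4 * Δ * X₂ ≤⟨ X₂-small ⟩
      A ≤⟨ A≤2B ⟩
      2 * B ∎)
      where
      open ≤-Reasoning
      open Split (split v L)
      A B X X₂ : ℕ
      A  = total (good far)
      B  = total (good L)
      X  = total (λ ω → ι (bad v ω) * good L ω)
      X₂ = total (λ ω → ι (bad v ω) * good far ω)
      L-≡ : ∀ ω → good (near ++ far) ω ≡ good L ω
      L-≡ ω = trans (good-++ near far ω) (good-≡ ω)
      X≤X₂ : X ≤ X₂
      X≤X₂ = total-mono λ ω → *-monoʳ-≤ (ι (bad v ω)) (≤-trans (≤-reflexive (sym (L-≡ ω))) (good-++≤ near far ω))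
      arr₁ : ∀ d x → 2 * (2 * d * x) ≡ 4 * d * x
      arr₁ = solve-∀
      arr₂ : ∀ t d x → t * (4 * d * x) ≡ 4 * d * (t * x)
      arr₂ = solve-∀
      X₂-small : 4 * Δ * X₂ ≤ A
      X₂-small = *-cancelˡ-≤ (T ^ N) ⦃ T^N>0 ⦄ (begin
        T ^ N * (4 * Δ * X₂) ≡⟨ arr₂ (T ^ N) Δ X₂ ⟩
        4 * Δ * (T ^ N * X₂) ≡⟨ cong (4 * Δ *_) (independence (dep v) (ι ∘ bad v) (good far)
                                                    (λ ω ω′ h → cong ι (bad-dep v ω ω′ h)) (far-dep v far isFar)) ⟩
        4 * Δ * (total (ι ∘ bad v) * A) ≡⟨ sym (*-assoc (4 * Δ) _ A) ⟩
        4 * Δ * total (ι ∘ bad v) * A ≤⟨ *-monoˡ-≤ A (small v) ⟩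
        T ^ N * A ∎)
      sub : ∀ n → length L ≤ n → ∀ M₁ w M₂ → near ≡ M₁ ++ w ∷ M₂ → Claim (M₂ ++ far)
      sub zero    len M₁ w M₂ e = ⊥-elim (1+n≰n (≤-trans (≤-trans (s≤s z≤n) (≤-trans (≤-reflexive (trans (sym (+-suc (length M₁) (length M₂)))
        (trans (sym (length-++′ M₁ (w ∷ M₂))) (cong length (sym e))))) (m≤m+n _ (length far)))) (≤-trans (≤-reflexive length-≡) len)))
      sub (suc n) len M₁ w M₂ e = claim n (M₂ ++ far) (s≤s⁻¹ (begin
        suc (length (M₂ ++ far)) ≡⟨ cong suc (length-++′ M₂ far) ⟩
        suc (length M₂) + length far ≤⟨ m≤n+m _ (length M₁) ⟩
        length M₁ + (suc (length M₂) + length far) ≡⟨ sym (+-assoc (length M₁) _ _) ⟩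
        length M₁ + suc (length M₂) + length far ≡⟨ cong (_+ length far) (sym (trans (cong length e) (length-++′ M₁ (w ∷ M₂)))) ⟩
        length near + length far ≡⟨ length-≡ ⟩
        length L ≤⟨ len ⟩
        suc n ∎))
        (λ i → begin
          count i (M₂ ++ far) ≡⟨ count-++ i M₂ far ⟩
          count i M₂ + count i far ≤⟨ +-monoˡ-≤ (count i far) (≤-trans (m≤n+m _ (ι (nb i w))) (m≤n+m _ (count i M₁))) ⟩
          count i M₁ + (count i (w ∷ M₂)) + count i far ≡⟨ cong (_+ count i far) (sym (trans (cong (count i) e) (count-++ i M₁ (w ∷ M₂)))) ⟩
          count i near + count i far ≡⟨ count-≡ i ⟩
          count i L ≤⟨ sp i ⟩
          Δ ∎)
      A≤2B : A ≤ 2 * B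
      A≤2B = *-cancelˡ-≤ Δ ⦃ >-nonZero Δ>0 ⦄ (+-cancelʳ-≤ (Δ * A) _ _ (begin
        Δ * A + Δ * A ≡⟨ arr₃ Δ A ⟩
        2 * Δ * A ≤⟨ add-near far near (sub n len) ⟩
        2 * Δ * total (good (near ++ far)) + length near * A ≤⟨ +-mono-≤ (≤-reflexive (cong (2 * Δ *_) (total-cong L-≡))) (*-monoˡ-≤ A (≤-trans near-≤ (sp v))) ⟩
        2 * Δ * B + Δ * A ≡⟨ cong (_+ Δ * A) (arr₄ Δ B) ⟩
        Δ * (2 * B) + Δ * A ∎))
        where
        arr₃ : ∀ d a → d * a + d * a ≡ 2 * d * a
        arr₃ = solve-∀
        arr₄ : ∀ d b → 2 * d * b ≡ d * (2 * b)
        arr₄ = solve-∀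

    good-total : ∀ L → Sparse L → 1 ≤ total (good L)
    good-total []      sp = ≤-trans (>-nonZero⁻¹ (T ^ N) ⦃ T^N>0 ⦄) (≤-reflexive (sym (trans (total-const {T} N 1) (*-identityʳ _))))
    -- If adding `w` left nothing, `bad w` would fill all of `good L`, against its share of at most
    -- `1/(2Δ)`.
    good-total (w ∷ L) sp = n≢0⇒n>0 λ z → 1+n≰n (begin
      suc X ≤⟨ +-monoˡ-≤ X (subst (1 ≤_) (trans (sym B≡) (trans (cong (X +_) z) (+-identityʳ X))) B>0) ⟩
      X + X ≡⟨ cong (X +_) (sym (+-identityʳ X)) ⟩
      2 * X ≤⟨ *-monoˡ-≤ X (*-monoʳ-≤ 2 Δ>0) ⟩
      2 * Δ * X ≤⟨ claim (length L) L ≤-refl sp′ w ⟩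
      B ≡⟨ trans (sym B≡) (trans (cong (X +_) z) (+-identityʳ X)) ⟩
      X ∎)
      where
      open ≤-Reasoning
      B X : ℕ
      B = total (good L)
      X = total (λ ω → ι (bad w ω) * good L ω)
      B≡ : X + total (good (w ∷ L)) ≡ B
      B≡ = trans (sym (total-+ (λ ω → ι (bad w ω) * good L ω) (good (w ∷ L)))) (total-cong (good-split w L))
      sp′ : Sparse L
      sp′ i = ≤-trans (m≤n+m _ (ι (nb i w))) (sp i)
      B>0 : 1 ≤ B
      B>0 = good-total L sp′

    count-tabulate : ∀ i {n} (f : Fin n → Fin K) → count i (tabulate f) ≡ ∑ (λ j → ι (nb i (f j)))
    count-tabulate i {zero}  f = refl
    count-tabulate i {suc n} f = cong (ι (nb i (f zero)) +_) (count-tabulate i (f ∘ suc))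

    good-tabulate : ∀ {n} (f : Fin n → Fin K) ω → 1 ≤ good (tabulate f) ω → ∀ j → bad (f j) ω ≡ false
    good-tabulate {suc n} f ω p zero with bad (f zero) ω
    ... | false = refl
    good-tabulate {suc n} f ω p (suc j) = good-tabulate (f ∘ suc) ω (≤-trans p (good-cons≤ (f zero) (tabulate (f ∘ suc)) ω)) j

  avoid-all : ∃ λ ω → ∀ v → bad v ω ≡ false
  avoid-all with total-pos (good (tabulate id)) (good-total (tabulate id) λ i → ≤-trans (≤-reflexive (count-tabulate i id)) (few i))
  ... | ω , p = ω , good-tabulate id ω p

-- Moment bound for centred linear forms

-- The letter zero, of probability 1/T, marks an active coordinate.
hit : ∀ {T} → Fin T → ℕ
hit zero    = 1
hit (suc _) = 0

-- The second-order error constant of `bernoulli₂`. One more factor `w′ = w + u` at most doubles the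
-- old error, since `u ≤ w`, and adds the cross term `k u^2`, which is at most `8 k w e`.
κ : ℕ → ℕ
κ zero    = 0
κ (suc k) = 2 * κ k + 8 * k

module IntegerMoments where
  open import Data.Integer using (ℤ; +_; -[1+_]; ∣_∣; 0ℤ; 1ℤ)

  private
    0≤-* : ∀ {a b} → 0ℤ ℤ.≤ a → 0ℤ ℤ.≤ b → 0ℤ ℤ.≤ a ℤ.* b
    0≤-* {a} {b} p q = ℤ.≤-trans (ℤ.≤-reflexive (sym (ℤ.*-zeroʳ a))) (ℤ.*-monoˡ-≤-nonNeg a ⦃ ℤ.nonNegative p ⦄ q)

    0≤-+ : ∀ {a b} → 0ℤ ℤ.≤ a → 0ℤ ℤ.≤ b → 0ℤ ℤ.≤ a ℤ.+ b
    0≤-+ p q = ℤ.+-mono-≤ p q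

    0≤-sq : ∀ a → 0ℤ ℤ.≤ a ℤ.* a
    0≤-sq (+ n)     = 0≤-* {+ n} {+ n} (ℤ.+≤+ z≤n) (ℤ.+≤+ z≤n)
    0≤-sq -[1+ n ]  = ℤ.+≤+ z≤n

    0≤+ : ∀ n → 0ℤ ℤ.≤ + n
    0≤+ n = ℤ.+≤+ z≤n

    by-diff : ∀ {a b d} → 0ℤ ℤ.≤ d → b ℤ.- a ≡ d → a ℤ.≤ b
    by-diff p e = ℤ.0≤i-j⇒j≤i (ℤ.≤-trans p (ℤ.≤-reflexive (sym e)))

    diff : ∀ {a b} → a ℤ.≤ b → 0ℤ ℤ.≤ b ℤ.- a
    diff = ℤ.i≤j⇒0≤j-i

    +sq : ∀ y → + (∣ y ∣ * ∣ y ∣) ≡ y ℤ.* y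
    +sq (+ n)    = ℤ.pos-* n n
    +sq -[1+ n ] = refl

    -- `(1 + u/w)^k` to first order, with a one-sided remainder. The linear term is kept exactly and
    -- `u` may be negative, because the linear terms have to cancel when averaged over a centred
    -- step; hence the integers.
    bernoulli₂ : ∀ (w w′ e : ℕ) (u : ℤ) → + w′ ≡ + w ℤ.+ u → u ℤ.≤ + w → u ℤ.* u ℤ.≤ + 8 ℤ.* (+ w ℤ.* + e) → ∀ k →
      + (w * w′ ^ k) ℤ.≤ + (w ^ k) ℤ.* (+ w ℤ.+ + k ℤ.* u ℤ.+ + κ k ℤ.* + e)
    bernoulli₂ w w′ e u w′≡ u≤w u²≤ zero = ℤ.≤-reflexive (trans (cong +_ (*-identityʳ w)) (lem (+ w) u (+ e)))
      where
      lem : ∀ w u e → w ≡ 1ℤ ℤ.* (w ℤ.+ 0ℤ ℤ.* u ℤ.+ 0ℤ ℤ.* e)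
      lem = ℤ.solve-∀
    bernoulli₂ w w′ e u w′≡ u≤w u²≤ (suc k) = ℤ.≤-trans (ℤ.≤-reflexive (trans (cong +_ (rot w w′ (w′ ^ k))) (ℤ.pos-* (w * w′ ^ k) w′)))
      (ℤ.≤-trans (ℤ.*-monoʳ-≤-nonNeg (+ w′) (bernoulli₂ w w′ e u w′≡ u≤w u²≤ k))
        (subst₂ ℤ._≤_ (cong (+ (w ^ k) ℤ.* (+ w ℤ.+ + k ℤ.* u ℤ.+ + κ k ℤ.* + e) ℤ.*_) (sym w′≡))
          refl
          (by-diff {b = + (w ^ suc k) ℤ.* (+ w ℤ.+ + suc k ℤ.* u ℤ.+ + κ (suc k) ℤ.* + e)} {d = + (w ^ k) ℤ.* (+ k ℤ.* (+ 8 ℤ.* (+ w ℤ.* + e) ℤ.- u ℤ.* u) ℤ.+ + κ k ℤ.* + e ℤ.* (+ w ℤ.- u))}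
            (0≤-* (0≤+ (w ^ k)) (0≤-+ (0≤-* (0≤+ k) (diff u²≤)) (0≤-* (0≤-* (0≤+ (κ k)) (0≤+ e)) (diff u≤w))))
            (trans (cong₂ (λ (a b : ℤ) → a ℤ.* (+ w ℤ.+ + suc k ℤ.* u ℤ.+ b ℤ.* + e) ℤ.- + (w ^ k) ℤ.* (+ w ℤ.+ + k ℤ.* u ℤ.+ + κ k ℤ.* + e) ℤ.* (+ w ℤ.+ u))
                      (ℤ.pos-* w (w ^ k)) (trans (ℤ.pos-+ (2 * κ k) (8 * k)) (cong₂ ℤ._+_ (ℤ.pos-* 2 (κ k)) (ℤ.pos-* 8 k))))
                   (trans (cong (λ a → + w ℤ.* + (w ^ k) ℤ.* (+ w ℤ.+ a ℤ.* u ℤ.+ (+ 2 ℤ.* + κ k ℤ.+ + 8 ℤ.* + k) ℤ.* + e) ℤ.- + (w ^ k) ℤ.* (+ w ℤ.+ + k ℤ.* u ℤ.+ + κ k ℤ.* + e) ℤ.* (+ w ℤ.+ u)) (ℤ.pos-+ 1 k))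
                          (lem (+ w) u (+ e) (+ k) (+ κ k) (+ (w ^ k))))))))
      where
      rot : ∀ a b c → a * (b * c) ≡ a * c * b
      rot = solve-∀
      lem : ∀ w u e k K p → w ℤ.* p ℤ.* (w ℤ.+ (1ℤ ℤ.+ k) ℤ.* u ℤ.+ (+ 2 ℤ.* K ℤ.+ + 8 ℤ.* k) ℤ.* e) ℤ.- p ℤ.* (w ℤ.+ k ℤ.* u ℤ.+ K ℤ.* e) ℤ.* (w ℤ.+ u)
        ≡ p ℤ.* (k ℤ.* (+ 8 ℤ.* (w ℤ.* e) ℤ.- u ℤ.* u) ℤ.+ K ℤ.* e ℤ.* (w ℤ.- u))
      lem = ℤ.solve-∀

  module CentredMoment (T′ k Λ : ℕ) (Λ>0 : 1 ≤ Λ) where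
    private
      T = suc T′

    -- A polynomial substitute for the exponential in a Freedman-type martingale argument: adding an independent centred summand
    -- of variance v multiplies the mean of Φ by at most 1 + O(v/Λ).
    Φ : ℤ → ℕ
    Φ y = (Λ + ∣ y ∣ * ∣ y ∣) ^ k

    -- `T` times the deviation of a linear form from its mean. The scaling makes each summand
    -- integral and exactly centred: `C (T - 1)` on one letter, `-C` on the other `T - 1`.
    centred : ∀ {N} → (Fin N → ℕ) → Vec (Fin T) N → ℤ
    centred C []      = 0ℤ
    centred C (t ∷ ω) = + C zero ℤ.* (+ T ℤ.* + hit t ℤ.- 1ℤ) ℤ.+ centred (C ∘ suc) ω

    centred-≡ : ∀ {N} (C : Fin N → ℕ) ω → centred C ω ℤ.+ + ∑ C ≡ + (T * ∑ λ w → C w * hit (lookup ω w))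
    centred-≡ C []      = cong +_ (sym (*-zeroʳ T))
    centred-≡ C (t ∷ ω) = trans (cong (λ z → + C zero ℤ.* (+ T ℤ.* + hit t ℤ.- 1ℤ) ℤ.+ centred (C ∘ suc) ω ℤ.+ z) (ℤ.pos-+ (C zero) _))
      (trans (lem (+ C zero) (+ T) (+ hit t) (centred (C ∘ suc) ω) (+ ∑ (C ∘ suc)))
      (trans (cong (λ z → + T ℤ.* (+ C zero ℤ.* + hit t) ℤ.+ z) (centred-≡ (C ∘ suc) ω))
      (trans (cong (λ z → + T ℤ.* z ℤ.+ + (T * R)) (sym (ℤ.pos-* (C zero) (hit t))))
      (trans (cong (λ z → z ℤ.+ + (T * R)) (sym (ℤ.pos-* T (C zero * hit t)))) (trans (sym (ℤ.pos-+ (T * (C zero * hit t)) (T * R))) (cong +_ (sym (*-distribˡ-+ T (C zero * hit t) R))))))))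
      where
      R = ∑ λ w → C (suc w) * hit (lookup ω w)
      lem : ∀ c T h g s → c ℤ.* (T ℤ.* h ℤ.- 1ℤ) ℤ.+ g ℤ.+ (c ℤ.+ s) ≡ T ℤ.* (c ℤ.* h) ℤ.+ (g ℤ.+ s)
      lem = ℤ.solve-∀

    private
      -- `bernoulli₂` with `u = 2 y δ + δ^2` and `e = δ^2`. The assumption `3 δ^2 ≤ Λ` yields both
      -- side conditions, as the explicit sums of squares show.
      shifted : ∀ (y δ : ℤ) → + 3 ℤ.* (δ ℤ.* δ) ℤ.≤ + Λ →
        + ((Λ + ∣ y ∣ * ∣ y ∣) * Φ (y ℤ.+ δ)) ℤ.≤ + Φ y ℤ.* (+ (Λ + ∣ y ∣ * ∣ y ∣) ℤ.+ + k ℤ.* (+ 2 ℤ.* (y ℤ.* δ) ℤ.+ δ ℤ.* δ) ℤ.+ + κ k ℤ.* + (∣ δ ∣ * ∣ δ ∣))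
      shifted y δ h = bernoulli₂ w w′ e u w′≡
          (by-diff {d = (+ Λ ℤ.- + 3 ℤ.* (δ ℤ.* δ)) ℤ.+ (δ ℤ.* δ ℤ.+ (y ℤ.- δ) ℤ.* (y ℤ.- δ))} (0≤-+ (diff h) (0≤-+ (0≤-sq δ) (0≤-sq (y ℤ.- δ))))
            (trans (cong (ℤ._- u) w≡) (lem₁ (+ Λ) y δ)))
          (by-diff {d = (δ ℤ.* δ) ℤ.* (+ 8 ℤ.* (+ Λ ℤ.- + 3 ℤ.* (δ ℤ.* δ)) ℤ.+ (+ 22 ℤ.* (δ ℤ.* δ) ℤ.+ (+ 2 ℤ.* y ℤ.- δ) ℤ.* (+ 2 ℤ.* y ℤ.- δ)))}
            (0≤-* (0≤-sq δ) (0≤-+ (0≤-* (0≤+ 8) (diff h)) (0≤-+ (0≤-* (0≤+ 22) (0≤-sq δ)) (0≤-sq (+ 2 ℤ.* y ℤ.- δ)))))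
            (trans (cong₂ (λ a b → + 8 ℤ.* (a ℤ.* b) ℤ.- u ℤ.* u) w≡ (+sq δ)) (lem₂ (+ Λ) y δ))) k
        where
        w w′ e : ℕ
        w  = Λ + ∣ y ∣ * ∣ y ∣
        w′ = Λ + ∣ y ℤ.+ δ ∣ * ∣ y ℤ.+ δ ∣
        e  = ∣ δ ∣ * ∣ δ ∣
        u : ℤ
        u = + 2 ℤ.* (y ℤ.* δ) ℤ.+ δ ℤ.* δ
        w≡ : + w ≡ + Λ ℤ.+ y ℤ.* y
        w≡ = trans (ℤ.pos-+ Λ _) (cong (λ z → + Λ ℤ.+ z) (+sq y))
        lem₀ : ∀ l y d → l ℤ.+ (y ℤ.+ d) ℤ.* (y ℤ.+ d) ≡ l ℤ.+ y ℤ.* y ℤ.+ (+ 2 ℤ.* (y ℤ.* d) ℤ.+ d ℤ.* d)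
        lem₀ = ℤ.solve-∀
        w′≡ : + w′ ≡ + w ℤ.+ u
        w′≡ = trans (ℤ.pos-+ Λ _) (trans (cong (λ z → + Λ ℤ.+ z) (+sq (y ℤ.+ δ))) (trans (lem₀ (+ Λ) y δ) (cong (ℤ._+ u) (sym w≡))))
        lem₁ : ∀ l y d → l ℤ.+ y ℤ.* y ℤ.- (+ 2 ℤ.* (y ℤ.* d) ℤ.+ d ℤ.* d) ≡ (l ℤ.- + 3 ℤ.* (d ℤ.* d)) ℤ.+ (d ℤ.* d ℤ.+ (y ℤ.- d) ℤ.* (y ℤ.- d))
        lem₁ = ℤ.solve-∀
        lem₂ : ∀ l y d → + 8 ℤ.* ((l ℤ.+ y ℤ.* y) ℤ.* (d ℤ.* d)) ℤ.- (+ 2 ℤ.* (y ℤ.* d) ℤ.+ d ℤ.* d) ℤ.* (+ 2 ℤ.* (y ℤ.* d) ℤ.+ d ℤ.* d)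
          ≡ (d ℤ.* d) ℤ.* (+ 8 ℤ.* (l ℤ.- + 3 ℤ.* (d ℤ.* d)) ℤ.+ (+ 22 ℤ.* (d ℤ.* d) ℤ.+ (+ 2 ℤ.* y ℤ.- d) ℤ.* (+ 2 ℤ.* y ℤ.- d)))
        lem₂ = ℤ.solve-∀

      -- One letter shifts `y` by `c T′` and the other `T′` letters shift it by `-c`, so the
      -- first-order terms of `shifted` cancel and only a variance of at most `c^2 T` per letter is
      -- left.
      one-step : ∀ c y → 3 * ((c * T) * (c * T)) ≤ Λ →
        Λ * ∑ {T} (λ t → Φ (y ℤ.+ + c ℤ.* (+ T ℤ.* + hit t ℤ.- 1ℤ))) ≤ T * (Φ y * (Λ + (k + κ k) * (c * c) * T))
      one-step c y h = *-cancelˡ-≤ w ⦃ w≢0 ⦄ (begin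
        w * (Λ * S) ≡⟨ rot w Λ S ⟩
        Λ * (w * S) ≡⟨ cong (λ z → Λ * (w * z)) S≡ ⟩
        Λ * (w * (Φ₁ + T′ * Φ₀)) ≤⟨ *-monoʳ-≤ Λ main ⟩
        Λ * (Φ y * (T * w + (k + κ k) * (c * c * (T′ * T)))) ≤⟨ *-monoʳ-≤ Λ (*-monoʳ-≤ (Φ y) (+-monoʳ-≤ (T * w) (*-monoʳ-≤ (k + κ k) (*-monoʳ-≤ (c * c) (*-monoˡ-≤ T (n≤1+n T′)))))) ⟩
        Λ * (Φ y * (T * w + (k + κ k) * (c * c * (T * T)))) ≡⟨ arr Λ (Φ y) T w ((k + κ k)) (c * c) ⟩
        T * (Φ y * (w * Λ + Λ * ((k + κ k) * (c * c) * T))) ≤⟨ *-monoʳ-≤ T (*-monoʳ-≤ (Φ y) (+-monoʳ-≤ (w * Λ) (*-monoˡ-≤ ((k + κ k) * (c * c) * T) (m≤m+n Λ (∣ y ∣ * ∣ y ∣))))) ⟩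
        T * (Φ y * (w * Λ + w * ((k + κ k) * (c * c) * T))) ≡⟨ arr₂ T (Φ y) w Λ ((k + κ k) * (c * c) * T) ⟩
        w * (T * (Φ y * (Λ + (k + κ k) * (c * c) * T))) ∎)
        where
        open ≤-Reasoning
        w S Φ₁ Φ₀ : ℕ
        w = Λ + ∣ y ∣ * ∣ y ∣
        w≢0 : NonZero w
        w≢0 = >-nonZero (≤-trans Λ>0 (m≤m+n Λ _))
        S = ∑ {T} (λ t → Φ (y ℤ.+ + c ℤ.* (+ T ℤ.* + hit t ℤ.- 1ℤ)))
        δ₁ δ₀ : ℤ
        δ₁ = + c ℤ.* + T′
        δ₀ = ℤ.- + c
        Φ₁ = Φ (y ℤ.+ δ₁)
        Φ₀ = Φ (y ℤ.+ δ₀)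
        rot : ∀ a b c → a * (b * c) ≡ b * (a * c)
        rot = solve-∀
        arr : ∀ l p t w k c → l * (p * (t * w + k * (c * (t * t)))) ≡ t * (p * (w * l + l * (k * c * t)))
        arr = solve-∀
        arr₂ : ∀ t p w l z → t * (p * (w * l + w * z)) ≡ w * (t * (p * (l + z)))
        arr₂ = solve-∀
        S≡ : S ≡ Φ₁ + T′ * Φ₀
        S≡ = cong₂ _+_ (cong (λ z → Φ (y ℤ.+ + c ℤ.* z)) (trans (cong (ℤ._- 1ℤ) (ℤ.*-identityʳ (+ T))) refl))
                       (trans (∑-const T′ _) (cong (λ z → T′ * Φ (y ℤ.+ z)) (trans (cong (λ z → + c ℤ.* (z ℤ.- 1ℤ)) (ℤ.*-zeroʳ (+ T))) (trans (ℤ.*-comm (+ c) (ℤ.- 1ℤ)) (ℤ.-1*i≡-i (+ c))))))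
        abs₁ : ∣ δ₁ ∣ ≡ c * T′
        abs₁ = ℤ.abs-* (+ c) (+ T′)
        abs₀ : ∣ δ₀ ∣ ≡ c
        abs₀ = ℤ.∣-i∣≡∣i∣ (+ c)
        small : ∀ δ → ∣ δ ∣ ≤ c * T → + 3 ℤ.* (δ ℤ.* δ) ℤ.≤ + Λ
        small δ p = subst (ℤ._≤ + Λ) (trans (ℤ.pos-* 3 (∣ δ ∣ * ∣ δ ∣)) (cong (λ z → + 3 ℤ.* z) (+sq δ))) (ℤ.+≤+ (≤-trans (*-monoʳ-≤ 3 (*-mono-≤ p p)) h))
        s₁ = shifted y δ₁ (small δ₁ (≤-trans (≤-reflexive abs₁) (*-monoʳ-≤ c (n≤1+n T′))))
        s₀ = shifted y δ₀ (small δ₀ (≤-trans (≤-reflexive abs₀) (m≤m*n c T)))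
        lemℤ : ∀ p w k K y c t → p ℤ.* (w ℤ.+ k ℤ.* (+ 2 ℤ.* (y ℤ.* (c ℤ.* t)) ℤ.+ (c ℤ.* t) ℤ.* (c ℤ.* t)) ℤ.+ K ℤ.* ((c ℤ.* t) ℤ.* (c ℤ.* t)))
            ℤ.+ t ℤ.* (p ℤ.* (w ℤ.+ k ℤ.* (+ 2 ℤ.* (y ℤ.* (ℤ.- c)) ℤ.+ (ℤ.- c) ℤ.* (ℤ.- c)) ℤ.+ K ℤ.* ((ℤ.- c) ℤ.* (ℤ.- c))))
          ≡ p ℤ.* ((1ℤ ℤ.+ t) ℤ.* w ℤ.+ (k ℤ.+ K) ℤ.* (c ℤ.* c ℤ.* (t ℤ.* (1ℤ ℤ.+ t))))
        lemℤ = ℤ.solve-∀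
        toℤ : + (Φ y * (T * w + (k + κ k) * (c * c * (T′ * T))))
          ≡ + Φ y ℤ.* ((1ℤ ℤ.+ + T′) ℤ.* + w ℤ.+ (+ k ℤ.+ + κ k) ℤ.* (+ c ℤ.* + c ℤ.* (+ T′ ℤ.* (1ℤ ℤ.+ + T′))))
        toℤ = trans (ℤ.pos-* (Φ y) _) (cong (λ z → + Φ y ℤ.* z) (trans (ℤ.pos-+ (T * w) _) (cong₂ ℤ._+_ (ℤ.pos-* T w)
          (trans (ℤ.pos-* (k + κ k) _) (cong₂ ℤ._*_ (ℤ.pos-+ k (κ k)) (trans (ℤ.pos-* (c * c) _) (cong₂ ℤ._*_ (ℤ.pos-* c c) (ℤ.pos-* T′ T))))))))
        main : w * (Φ₁ + T′ * Φ₀) ≤ Φ y * (T * w + (k + κ k) * (c * c * (T′ * T)))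
        main = ℤ.drop‿+≤+ (subst₂ ℤ._≤_
          (sym (trans (cong +_ (trans (*-distribˡ-+ w Φ₁ (T′ * Φ₀)) (cong (λ z → w * Φ₁ + z) (rot w T′ Φ₀)))) (trans (ℤ.pos-+ (w * Φ₁) (T′ * (w * Φ₀))) (cong (λ z → + (w * Φ₁) ℤ.+ z) (ℤ.pos-* T′ (w * Φ₀))))))
          (trans (cong₂ (λ a b → + Φ y ℤ.* (+ w ℤ.+ + k ℤ.* (+ 2 ℤ.* (y ℤ.* δ₁) ℤ.+ δ₁ ℤ.* δ₁) ℤ.+ + κ k ℤ.* a) ℤ.+ + T′ ℤ.* (+ Φ y ℤ.* (+ w ℤ.+ + k ℤ.* (+ 2 ℤ.* (y ℤ.* δ₀) ℤ.+ δ₀ ℤ.* δ₀) ℤ.+ + κ k ℤ.* b)))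
              (+sq δ₁) (+sq δ₀)) (trans (lemℤ (+ Φ y) (+ w) (+ k) (+ κ k) y (+ c) (+ T′)) (sym toℤ)))
          (ℤ.+-mono-≤ s₁ (ℤ.*-monoˡ-≤-nonNeg (+ T′) s₀)))

      prod : ∀ {N} → (Fin N → ℕ) → ℕ
      prod {zero}  C = 1
      prod {suc N} C = (Λ + (k + κ k) * (C zero * C zero) * T) * prod (C ∘ suc)

      moment-prod : ∀ {N} (C : Fin N → ℕ) y → (∀ w → 3 * ((C w * T) * (C w * T)) ≤ Λ) →
        Λ ^ N * total {T} {N} (λ ω → Φ (y ℤ.+ centred C ω)) ≤ T ^ N * (Φ y * prod C)
      moment-prod {zero}  C y h = ≤-reflexive (cong (λ z → z + 0) (trans (cong Φ (ℤ.+-identityʳ y)) (sym (*-identityʳ (Φ y)))))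
      moment-prod {suc N} C y h = begin
        Λ * Λ ^ N * ∑ {T} (λ t → total λ ω → Φ (y ℤ.+ centred C (t ∷ ω))) ≡⟨ *-assoc Λ (Λ ^ N) _ ⟩
        Λ * (Λ ^ N * ∑ {T} (λ t → total λ ω → Φ (y ℤ.+ centred C (t ∷ ω)))) ≡⟨ cong (Λ *_) (sym (∑-*ˡ {T} (Λ ^ N) (λ t → total λ ω → Φ (y ℤ.+ centred C (t ∷ ω))))) ⟩
        Λ * ∑ {T} (λ t → Λ ^ N * total (λ ω → Φ (y ℤ.+ centred C (t ∷ ω)))) ≤⟨ *-monoʳ-≤ Λ (∑-mono {T} λ t → ≤-trans
             (≤-reflexive (cong (Λ ^ N *_) (total-cong λ ω → cong Φ (sym (ℤ.+-assoc y (+ C zero ℤ.* (+ T ℤ.* + hit t ℤ.- 1ℤ)) (centred (C ∘ suc) ω))))))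
             (moment-prod (C ∘ suc) (Y t) (h ∘ suc))) ⟩
        Λ * ∑ {T} (λ t → T ^ N * (Φ (Y t) * P)) ≡⟨ cong (Λ *_) (trans (∑-*ˡ {T} (T ^ N) (λ t → Φ (Y t) * P)) (cong (T ^ N *_) (∑-*ʳ {T} P (λ t → Φ (Y t))))) ⟩
        Λ * (T ^ N * (∑ {T} (λ t → Φ (Y t)) * P)) ≡⟨ arr Λ (T ^ N) (∑ {T} (λ t → Φ (Y t))) P ⟩
        T ^ N * P * (Λ * ∑ {T} (λ t → Φ (Y t))) ≤⟨ *-monoʳ-≤ (T ^ N * P) (one-step (C zero) y (h zero)) ⟩
        T ^ N * P * (T * (Φ y * (Λ + (k + κ k) * (C zero * C zero) * T))) ≡⟨ arr₂ (T ^ N) P T (Φ y) (Λ + (k + κ k) * (C zero * C zero) * T) ⟩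
        T * T ^ N * (Φ y * prod C) ∎
        where
        open ≤-Reasoning
        P = prod (C ∘ suc)
        Y : Fin T → ℤ
        Y t = y ℤ.+ + C zero ℤ.* (+ T ℤ.* + hit t ℤ.- 1ℤ)
        arr : ∀ l t s p → l * (t * (s * p)) ≡ t * p * (l * s)
        arr = solve-∀
        arr₂ : ∀ n p t f q → n * p * (t * (f * q)) ≡ t * n * (f * (q * p))
        arr₂ = solve-∀

      -- With `z` the added terms this is `Π (1 + z/Λ) ≤ 1/(1 - Σ z/Λ)`, a rational stand-in for the
      -- exponential. When `Σ z` is at most `Λ/2`, the growth factors multiply to at most `2`.
      prod-bound : ∀ {N} (C : Fin N → ℕ) R → ∑ (λ w → (k + κ k) * (C w * C w) * T) + R ≡ Λ → prod C * R ≤ Λ ^ N * Λ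
      prod-bound {zero}  C R e = ≤-trans (≤-reflexive (+-identityʳ R)) (≤-trans (≤-reflexive e) (≤-reflexive (sym (+-identityʳ Λ))))
      prod-bound {suc N} C R e = begin
        (Λ + z) * P * R ≡⟨ arr₁ Λ z P R ⟩
        P * (Λ * R + z * R) ≤⟨ *-monoʳ-≤ P (+-monoʳ-≤ (Λ * R) (≤-trans (≤-reflexive (*-comm z R)) (*-monoˡ-≤ z (≤-trans (m≤n+m R _) (≤-reflexive e))))) ⟩
        P * (Λ * R + Λ * z) ≡⟨ arr₂ P Λ R z ⟩
        Λ * (P * (z + R)) ≤⟨ *-monoʳ-≤ Λ (prod-bound (C ∘ suc) (z + R) (trans (arr₃ _ z R) e)) ⟩
        Λ * (Λ ^ N * Λ) ≡⟨ sym (*-assoc Λ _ Λ) ⟩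
        Λ * Λ ^ N * Λ ∎
        where
        open ≤-Reasoning
        P = prod (C ∘ suc)
        z = (k + κ k) * (C zero * C zero) * T
        arr₁ : ∀ l z p r → (l + z) * p * r ≡ p * (l * r + z * r)
        arr₁ = solve-∀
        arr₂ : ∀ p l r z → p * (l * r + l * z) ≡ l * (p * (z + r))
        arr₂ = solve-∀
        arr₃ : ∀ a z r → a + (z + r) ≡ z + a + r
        arr₃ = solve-∀

    centred-moment : ∀ {N} (C : Fin N → ℕ) → (∀ w → 3 * ((C w * T) * (C w * T)) ≤ Λ) →
      2 * ∑ (λ w → (k + κ k) * (C w * C w) * T) ≤ Λ → total {T} {N} (λ ω → Φ (centred C ω)) ≤ 2 * (T ^ N * Λ ^ k)
    centred-moment {N} C h₁ h₂ = *-cancelˡ-≤ (Λ ^ N) ⦃ m^n≢0 Λ N ⦃ >-nonZero Λ>0 ⦄ ⦄ (*-cancelˡ-≤ Λ ⦃ >-nonZero Λ>0 ⦄ (begin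
      Λ * (Λ ^ N * X) ≤⟨ *-monoʳ-≤ Λ (≤-trans (≤-reflexive (cong (Λ ^ N *_) (total-cong λ ω → cong Φ (sym (ℤ.+-identityˡ (centred C ω)))))) (moment-prod C 0ℤ h₁)) ⟩
      Λ * (T ^ N * (Φ 0ℤ * prod C)) ≡⟨ cong (λ z → Λ * (T ^ N * (z ^ k * prod C))) (+-identityʳ Λ) ⟩
      Λ * (T ^ N * (Λ ^ k * prod C)) ≡⟨ arr Λ (T ^ N) (Λ ^ k) (prod C) ⟩
      T ^ N * Λ ^ k * (prod C * Λ) ≤⟨ *-monoʳ-≤ (T ^ N * Λ ^ k) (*-monoʳ-≤ (prod C) Λ≤2R) ⟩
      T ^ N * Λ ^ k * (prod C * (2 * R)) ≡⟨ arr₂ (T ^ N * Λ ^ k) (prod C) R ⟩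
      2 * (T ^ N * Λ ^ k) * (prod C * R) ≤⟨ *-monoʳ-≤ (2 * (T ^ N * Λ ^ k)) (prod-bound C R (m+[n∸m]≡n Z≤Λ)) ⟩
      2 * (T ^ N * Λ ^ k) * (Λ ^ N * Λ) ≡⟨ arr₃ (2 * (T ^ N * Λ ^ k)) (Λ ^ N) Λ ⟩
      Λ * (Λ ^ N * (2 * (T ^ N * Λ ^ k))) ∎))
      where
      open ≤-Reasoning
      X = total {T} {N} (λ ω → Φ (centred C ω))
      Z = ∑ (λ w → (k + κ k) * (C w * C w) * T)
      Z≤Λ : Z ≤ Λ
      Z≤Λ = ≤-trans (m≤m+n Z _) h₂
      R = Λ ∸ Z
      Λ≤2R : Λ ≤ 2 * R
      Λ≤2R = +-cancelˡ-≤ (2 * Z) _ _ (begin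
        2 * Z + Λ ≤⟨ +-monoˡ-≤ Λ h₂ ⟩
        Λ + Λ ≡⟨ cong (λ z → z + z) (sym (m+[n∸m]≡n Z≤Λ)) ⟩
        Z + R + (Z + R) ≡⟨ arr₄ Z R ⟩
        2 * Z + 2 * R ∎)
        where
        arr₄ : ∀ z r → z + r + (z + r) ≡ 2 * z + 2 * r
        arr₄ = solve-∀
      arr : ∀ l t q p → l * (t * (q * p)) ≡ t * q * (p * l)
      arr = solve-∀
      arr₂ : ∀ a p r → a * (p * (2 * r)) ≡ 2 * a * (p * r)
      arr₂ = solve-∀
      arr₃ : ∀ a b c → a * (b * c) ≡ c * (b * a)
      arr₃ = solve-∀

    -- Markov's inequality for `Φ`: on a bad word it is at least `(V^2)^k`, hence at least
    -- `(Λ Y)^k`, while its mean is at most `2 Λ^k`.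
    centred-tail : ∀ {N} (C : Fin N → ℕ) → (∀ w → 3 * ((C w * T) * (C w * T)) ≤ Λ) →
      2 * ∑ (λ w → (k + κ k) * (C w * C w) * T) ≤ Λ → ∀ Y V → Λ * Y ≤ V * V → (bad : Vec (Fin T) N → Bool) →
      (∀ ω → bad ω ≡ true → V ≤ ∣ centred C ω ∣) → Y ^ k * total (ι ∘ bad) ≤ 2 * T ^ N
    centred-tail {N} C h₁ h₂ Y V h₃ bad h₄ = *-cancelˡ-≤ (Λ ^ k) ⦃ m^n≢0 Λ k ⦃ >-nonZero Λ>0 ⦄ ⦄ (begin
      Λ ^ k * (Y ^ k * total (ι ∘ bad)) ≡⟨ sym (*-assoc (Λ ^ k) (Y ^ k) _) ⟩
      Λ ^ k * Y ^ k * total (ι ∘ bad) ≡⟨ cong (_* total (ι ∘ bad)) (sym (^-distrib-* Λ Y k)) ⟩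
      (Λ * Y) ^ k * total (ι ∘ bad) ≡⟨ sym (total-*ˡ ((Λ * Y) ^ k) (ι ∘ bad)) ⟩
      total (λ ω → (Λ * Y) ^ k * ι (bad ω)) ≤⟨ total-mono pt ⟩
      total (λ ω → Φ (centred C ω)) ≤⟨ centred-moment C h₁ h₂ ⟩
      2 * (T ^ N * Λ ^ k) ≡⟨ arr (T ^ N) (Λ ^ k) ⟩
      Λ ^ k * (2 * T ^ N) ∎)
      where
      open ≤-Reasoning
      arr : ∀ a b → 2 * (a * b) ≡ b * (2 * a)
      arr = solve-∀
      pt : ∀ ω → (Λ * Y) ^ k * ι (bad ω) ≤ Φ (centred C ω)
      pt ω with bad ω in e
      ... | false = ≤-trans (≤-reflexive (*-zeroʳ ((Λ * Y) ^ k))) z≤n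
      ... | true  = ≤-trans (≤-reflexive (*-identityʳ _)) (^-monoˡ-≤ k (≤-trans h₃ (≤-trans (*-mono-≤ (h₄ ω e) (h₄ ω e)) (m≤n+m _ Λ))))

open IntegerMoments

-- Moment bound for quadratic forms with nonnegative coefficients

module QuadraticMoment (T′ : ℕ) {N : ℕ} (W : Fin N → Fin N → ℕ) where
  private
    T = suc T′

    x : Vec (Fin T) N → Fin N → ℕ
    x ω u = hit (lookup ω u)

    hit≤1 : ∀ (t : Fin T) → hit t ≤ 1
    hit≤1 zero    = ≤-refl
    hit≤1 (suc t) = z≤n

    monomial : List (Fin N) → Vec (Fin T) N → ℕ
    monomial []      ω = 1
    monomial (u ∷ F) ω = x ω u * monomial F ω

    occ : Fin N → List (Fin N) → ℕ
    occ u []      = 0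
    occ u (v ∷ F) = ι (v == u) + occ u F

  quadratic : Vec (Fin T) N → ℕ
  quadratic ω = ∑ λ w → ∑ λ w′ → W w w′ * (x ω w * x ω w′)

  private
    total-hit : ∀ {N} (u : Fin N) → T * total {T} (λ ω → hit (lookup ω u)) ≡ T ^ N
    total-hit {suc N} zero = cong (T *_) (begin-equality
      ∑ {T} (λ t → total {T} {N} (λ ω → hit t)) ≡⟨ ∑-cong {T} (λ t → total-const {T} N (hit t)) ⟩
      ∑ {T} (λ t → T ^ N * hit t) ≡⟨ ∑-*ˡ {T} (T ^ N) hit ⟩
      T ^ N * (1 + ∑ {T′} (λ t → 0)) ≡⟨ cong (λ z → T ^ N * (1 + z)) (∑-zero {T′} (λ _ → refl)) ⟩
      T ^ N * 1 ≡⟨ *-identityʳ (T ^ N) ⟩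
      T ^ N ∎)
      where open ≤-Reasoning
    total-hit {suc N} (suc u) = trans (cong (T *_) (∑-const T _)) (cong (T *_) (total-hit u))

    occ-dep : ∀ u F → occ u F ≡ 0 → DependsOn (not ∘ (u ==_)) (monomial F)
    occ-dep u []      e ω ω′ h = refl
    occ-dep u (v ∷ F) e ω ω′ h with v == u in q
    ... | false = cong₂ (λ a b → hit a * b) (h v (cong not (trans (==-sym u v) q))) (occ-dep u F e ω ω′ h)

    -- Outside `F` the coordinate `u` is independent of the monomial and active with probability
    -- `1/T`; inside `F` it is active already and the bound is trivial. The factor `1 + T * occ u F`
    -- covers both cases in one summable expression.
    one-biased : ∀ u F → T * total (λ ω → x ω u * monomial F ω) ≤ total (monomial F) * (1 + T * occ u F)
    one-biased u F with occ u F in e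
    ... | zero  = *-cancelˡ-≤ (T ^ N) ⦃ m^n≢0 T N ⦄ (≤-reflexive (begin-equality
      T ^ N * (T * total (λ ω → x ω u * monomial F ω)) ≡⟨ rot (T ^ N) T _ ⟩
      T * (T ^ N * total (λ ω → x ω u * monomial F ω)) ≡⟨ cong (T *_) (independence (u ==_) (λ ω → x ω u) (monomial F)
                                                            (λ ω ω′ h → cong hit (h u (==-refl u))) (occ-dep u F e)) ⟩
      T * (total (λ ω → x ω u) * total (monomial F)) ≡⟨ sym (*-assoc T (total (λ ω → x ω u)) (total (monomial F))) ⟩
      T * total (λ ω → x ω u) * total (monomial F) ≡⟨ cong (_* total (monomial F)) (total-hit u) ⟩
      T ^ N * total (monomial F) ≡⟨ cong (T ^ N *_) (sym (trans (cong (λ z → total (monomial F) * (1 + z)) (*-zeroʳ T)) (*-identityʳ _))) ⟩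
      T ^ N * (total (monomial F) * (1 + T * 0)) ∎))
      where
      open ≤-Reasoning
      rot : ∀ a b c → a * (b * c) ≡ b * (a * c)
      rot = solve-∀
    ... | suc o = ≤-trans (*-monoʳ-≤ T (total-mono λ ω → ≤-trans (*-monoˡ-≤ (monomial F ω) (hit≤1 (lookup ω u))) (≤-reflexive (+-identityʳ _))))
      (≤-trans (≤-reflexive (*-comm T _)) (*-monoʳ-≤ (total (monomial F)) (≤-trans (m≤m*n T (suc o)) (n≤1+n _))))

    two-biased : ∀ w w′ F → T * T * total (monomial (w ∷ w′ ∷ F)) ≤ total (monomial F) * ((1 + T * (ι (w′ == w) + occ w F)) * (1 + T * occ w′ F))
    two-biased w w′ F = begin
      T * T * total (monomial (w ∷ w′ ∷ F)) ≡⟨ *-assoc T T _ ⟩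
      T * (T * total (monomial (w ∷ w′ ∷ F))) ≤⟨ *-monoʳ-≤ T (one-biased w (w′ ∷ F)) ⟩
      T * (total (monomial (w′ ∷ F)) * (1 + T * occ w (w′ ∷ F))) ≡⟨ sym (*-assoc T (total (monomial (w′ ∷ F))) (1 + T * occ w (w′ ∷ F))) ⟩
      T * total (monomial (w′ ∷ F)) * (1 + T * occ w (w′ ∷ F)) ≤⟨ *-monoˡ-≤ (1 + T * occ w (w′ ∷ F)) (one-biased w′ F) ⟩
      total (monomial F) * (1 + T * occ w′ F) * (1 + T * occ w (w′ ∷ F)) ≡⟨ arr (total (monomial F)) (1 + T * occ w′ F) (1 + T * occ w (w′ ∷ F)) ⟩
      total (monomial F) * ((1 + T * occ w (w′ ∷ F)) * (1 + T * occ w′ F)) ∎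
      where
      open ≤-Reasoning
      arr : ∀ a b c → a * b * c ≡ a * (c * b)
      arr = solve-∀

    occ-sum : ∀ (f : Fin N → ℕ) M F → (∀ w → f w ≤ M) → ∑ (λ w → f w * occ w F) ≤ length F * M
    occ-sum f M []      h = ≤-reflexive (∑-zero {f = λ w → f w * 0} λ w → *-zeroʳ (f w))
    occ-sum f M (v ∷ F) h = begin
      ∑ (λ w → f w * (ι (v == w) + occ w F)) ≡⟨ ∑-cong (λ w → trans (*-distribˡ-+ (f w) (ι (v == w)) (occ w F)) (cong (_+ f w * occ w F) (*-comm (f w) _))) ⟩
      ∑ (λ w → ι (v == w) * f w + f w * occ w F) ≡⟨ ∑-+ (λ w → ι (v == w) * f w) (λ w → f w * occ w F) ⟩
      ∑ (λ w → ι (v == w) * f w) + ∑ (λ w → f w * occ w F) ≤⟨ +-mono-≤ (≤-trans (≤-reflexive (∑-δ v f)) (h v)) (occ-sum f M F h) ⟩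
      M + length F * M ∎
      where open ≤-Reasoning

  module _ (m₀ md m₁ m₂ : ℕ) (h₀ : ∑ (λ w → ∑ λ w′ → W w w′) ≤ m₀) (hd : ∑ (λ w → W w w) ≤ md)
    (hr : ∀ w → ∑ (λ w′ → W w w′) ≤ m₁) (hc : ∀ w′ → ∑ (λ w → W w w′) ≤ m₁) (h₂ : ∀ w w′ → W w w′ ≤ m₂) where
    private
      -- A bound for `T^2` times the mean of the quadratic form once `f` coordinates are known to be
      -- active: `m₀` for free pairs, `T * md` for the diagonal, where `x^2 = x` saves one factor
      -- `1/T`, then pairs with one known coordinate, and pairs with both known, on the diagonal
      -- (`f`) or not (`f * f`).
      bound : ℕ → ℕ
      bound f = m₀ + T * md + 2 * T * f * m₁ + T * T * (f + f * f) * m₂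

      bound-mono : ∀ {f g} → f ≤ g → bound f ≤ bound g
      bound-mono {f} {g} p = +-mono-≤ (+-monoʳ-≤ (m₀ + T * md) (*-monoˡ-≤ m₁ (*-monoʳ-≤ (2 * T) p))) (*-monoˡ-≤ m₂ (*-monoʳ-≤ (T * T) (+-mono-≤ p (*-mono-≤ p p))))

      ∑∑-+ : (f g : Fin N → Fin N → ℕ) → ∑ (λ w → ∑ λ w′ → f w w′ + g w w′) ≡ ∑ (λ w → ∑ λ w′ → f w w′) + ∑ (λ w → ∑ λ w′ → g w w′)
      ∑∑-+ f g = trans (∑-cong λ w → ∑-+ (f w) (g w)) (∑-+ (λ w → ∑ (f w)) (λ w → ∑ (g w)))

      ∑∑-*ˡ : ∀ c (f : Fin N → Fin N → ℕ) → ∑ (λ w → ∑ λ w′ → c * f w w′) ≡ c * ∑ (λ w → ∑ λ w′ → f w w′)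
      ∑∑-*ˡ c f = trans (∑-cong λ w → ∑-*ˡ c (f w)) (∑-*ˡ c (λ w → ∑ (f w)))

      pair-sum : ∀ F → ∑ (λ w → ∑ λ w′ → W w w′ * ((1 + T * (ι (w′ == w) + occ w F)) * (1 + T * occ w′ F))) ≤ bound (length F)
      pair-sum F = begin
        ∑ (λ w → ∑ λ w′ → W w w′ * ((1 + T * (ι (w′ == w) + occ w F)) * (1 + T * occ w′ F)))
          ≡⟨ ∑-cong (λ w → ∑-cong λ w′ → expand (W w w′) T (ι (w′ == w)) (occ w F) (occ w′ F)) ⟩
        ∑ (λ w → ∑ λ w′ → A w w′ + (T * B w w′ + (T * C w w′ + (T * D w w′ + (T * T * G w w′ + T * T * H w w′)))))
          ≡⟨ trans (∑∑-+ A _) (cong (λ z → ∑∑ A + z) (trans (∑∑-+ (λ w w′ → T * B w w′) _) (cong₂ _+_ (∑∑-*ˡ T B)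
             (trans (∑∑-+ (λ w w′ → T * C w w′) _) (cong₂ _+_ (∑∑-*ˡ T C)
             (trans (∑∑-+ (λ w w′ → T * D w w′) _) (cong₂ _+_ (∑∑-*ˡ T D)
             (trans (∑∑-+ (λ w w′ → T * T * G w w′) (λ w w′ → T * T * H w w′)) (cong₂ _+_ (∑∑-*ˡ (T * T) G) (∑∑-*ˡ (T * T) H)))))))))) ⟩
        ∑∑ A + (T * ∑∑ B + (T * ∑∑ C + (T * ∑∑ D + (T * T * ∑∑ G + T * T * ∑∑ H))))
          ≤⟨ +-mono-≤ h₀ (+-mono-≤ (*-monoʳ-≤ T B≤) (+-mono-≤ (*-monoʳ-≤ T C≤) (+-mono-≤ (*-monoʳ-≤ T D≤) (+-mono-≤ (*-monoʳ-≤ (T * T) G≤) (*-monoʳ-≤ (T * T) H≤))))) ⟩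
        m₀ + (T * md + (T * (l * m₁) + (T * (l * m₁) + (T * T * (l * m₂) + T * T * (l * (l * m₂))))))
          ≡⟨ collect m₀ T md l m₁ m₂ ⟩
        bound l ∎
        where
        open ≤-Reasoning
        l = length F
        ∑∑ : (Fin N → Fin N → ℕ) → ℕ
        ∑∑ f = ∑ λ w → ∑ λ w′ → f w w′
        A B C D G H : Fin N → Fin N → ℕ
        A w w′ = W w w′
        B w w′ = ι (w′ == w) * W w w′
        C w w′ = W w w′ * occ w F
        D w w′ = W w w′ * occ w′ F
        G w w′ = ι (w′ == w) * (W w w′ * occ w′ F)
        H w w′ = W w w′ * occ w F * occ w′ F
        expand : ∀ W T i o o′ → W * ((1 + T * (i + o)) * (1 + T * o′)) ≡ W + (T * (i * W) + (T * (W * o) + (T * (W * o′) + (T * T * (i * (W * o′)) + T * T * (W * o * o′)))))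
        expand = solve-∀
        collect : ∀ m₀ T md l m₁ m₂ → m₀ + (T * md + (T * (l * m₁) + (T * (l * m₁) + (T * T * (l * m₂) + T * T * (l * (l * m₂))))))
          ≡ m₀ + T * md + 2 * T * l * m₁ + T * T * (l + l * l) * m₂
        collect = solve-∀
        diagonal : ∀ (f : Fin N → Fin N → ℕ) → ∑ (λ w → ∑ λ w′ → ι (w′ == w) * f w w′) ≡ ∑ (λ w → f w w)
        diagonal f = ∑-cong λ w → trans (∑-cong λ w′ → cong (λ b → ι b * f w w′) (==-sym w′ w)) (∑-δ w (f w))
        B≤ : ∑∑ B ≤ md
        B≤ = ≤-trans (≤-reflexive (diagonal W)) hd
        C≤ : ∑∑ C ≤ l * m₁
        C≤ = ≤-trans (≤-reflexive (∑-cong λ w → ∑-*ʳ (occ w F) (W w))) (occ-sum (λ w → ∑ (W w)) m₁ F hr)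
        D≤ : ∑∑ D ≤ l * m₁
        D≤ = ≤-trans (≤-reflexive (trans (∑-swap D) (∑-cong λ w′ → ∑-*ʳ (occ w′ F) (λ w → W w w′)))) (occ-sum (λ w′ → ∑ (λ w → W w w′)) m₁ F hc)
        G≤ : ∑∑ G ≤ l * m₂
        G≤ = ≤-trans (≤-reflexive (diagonal (λ w w′ → W w w′ * occ w′ F))) (occ-sum (λ w → W w w) m₂ F (λ w → h₂ w w))
        H≤ : ∑∑ H ≤ l * (l * m₂)
        H≤ = ≤-trans (≤-reflexive (trans (∑-swap H) (∑-cong λ w′ → ∑-*ʳ (occ w′ F) (λ w → W w w′ * occ w F))))
               (occ-sum (λ w′ → ∑ (λ w → W w w′ * occ w F)) (l * m₂) F (λ w′ → occ-sum (λ w → W w w′) m₂ F (λ w → h₂ w w′)))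

    -- Every further factor of the quadratic form is averaged under the law conditioned on the coordinates in F being active.
    biased-moment : ∀ k F {n} → length F + 2 * k ≤ n → (T * T) ^ k * total (λ ω → monomial F ω * quadratic ω ^ k) ≤ total (monomial F) * bound n ^ k
    biased-moment zero    F {n} p = ≤-reflexive (trans (+-identityʳ _) (trans (total-cong {f = λ ω → monomial F ω * 1} λ ω → *-identityʳ _) (sym (*-identityʳ _))))
    biased-moment (suc k) F {n} p = begin
      T * T * T²ᵏ * total (λ ω → monomial F ω * (quadratic ω * quadratic ω ^ k))
        ≡⟨ cong (T * T * T²ᵏ *_) (trans (total-cong unfold-Q) (trans (total-∑ (λ w ω → ∑ λ w′ → g w w′ ω))
             (∑-cong λ w → trans (total-∑ (g w)) (∑-cong λ w′ → total-*ˡ (W w w′) (λ ω → monomial (w ∷ w′ ∷ F) ω * quadratic ω ^ k))))) ⟩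
      T * T * T²ᵏ * ∑ (λ w → ∑ λ w′ → W w w′ * S w w′) ≡⟨ sym (∑∑-*ˡ (T * T * T²ᵏ) (λ w w′ → W w w′ * S w w′)) ⟩
      ∑ (λ w → ∑ λ w′ → T * T * T²ᵏ * (W w w′ * S w w′)) ≤⟨ ∑-mono (λ w → ∑-mono λ w′ → term w w′) ⟩
      ∑ (λ w → ∑ λ w′ → total (monomial F) * bound n ^ k * (W w w′ * ((1 + T * (ι (w′ == w) + occ w F)) * (1 + T * occ w′ F))))
        ≡⟨ ∑∑-*ˡ (total (monomial F) * bound n ^ k) _ ⟩
      total (monomial F) * bound n ^ k * ∑ (λ w → ∑ λ w′ → W w w′ * ((1 + T * (ι (w′ == w) + occ w F)) * (1 + T * occ w′ F)))
        ≤⟨ *-monoʳ-≤ (total (monomial F) * bound n ^ k) (≤-trans (pair-sum F) (bound-mono {length F} (≤-trans (m≤m+n (length F) (2 * suc k)) p))) ⟩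
      total (monomial F) * bound n ^ k * bound n ≡⟨ arr₂ (total (monomial F)) (bound n ^ k) (bound n) ⟩
      total (monomial F) * (bound n * bound n ^ k) ∎
      where
      open ≤-Reasoning
      T²ᵏ = (T * T) ^ k
      g : Fin N → Fin N → Vec (Fin T) N → ℕ
      g w w′ ω = W w w′ * (monomial (w ∷ w′ ∷ F) ω * quadratic ω ^ k)
      S : Fin N → Fin N → ℕ
      S w w′ = total (λ ω → monomial (w ∷ w′ ∷ F) ω * quadratic ω ^ k)
      arr₂ : ∀ a b c → a * b * c ≡ a * (c * b)
      arr₂ = solve-∀
      unfold-Q : ∀ ω → monomial F ω * (quadratic ω * quadratic ω ^ k) ≡ ∑ (λ w → ∑ λ w′ → g w w′ ω)
      unfold-Q ω = trans (lem (monomial F ω) (quadratic ω) (quadratic ω ^ k)) (trans (sym (∑∑-*ˡ (monomial F ω * quadratic ω ^ k) (λ w w′ → W w w′ * (x ω w * x ω w′))))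
        (∑-cong λ w → ∑-cong λ w′ → lem₂ (monomial F ω) (quadratic ω ^ k) (W w w′) (x ω w) (x ω w′)))
        where
        lem : ∀ a q p → a * (q * p) ≡ a * p * q
        lem = solve-∀
        lem₂ : ∀ a p w x y → a * p * (w * (x * y)) ≡ w * (x * (y * a) * p)
        lem₂ = solve-∀
      term : ∀ w w′ → T * T * T²ᵏ * (W w w′ * S w w′) ≤ total (monomial F) * bound n ^ k * (W w w′ * ((1 + T * (ι (w′ == w) + occ w F)) * (1 + T * occ w′ F)))
      term w w′ = begin
        T * T * T²ᵏ * (W w w′ * S w w′) ≡⟨ a₁ (T * T) T²ᵏ (W w w′) (S w w′) ⟩
        W w w′ * (T * T) * (T²ᵏ * S w w′) ≤⟨ *-monoʳ-≤ (W w w′ * (T * T)) (biased-moment k (w ∷ w′ ∷ F) (≤-trans (≤-reflexive (a₂ (length F) k)) p)) ⟩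
        W w w′ * (T * T) * (total (monomial (w ∷ w′ ∷ F)) * bound n ^ k) ≡⟨ a₃ (W w w′) (T * T) (total (monomial (w ∷ w′ ∷ F))) (bound n ^ k) ⟩
        W w w′ * bound n ^ k * (T * T * total (monomial (w ∷ w′ ∷ F))) ≤⟨ *-monoʳ-≤ (W w w′ * bound n ^ k) (two-biased w w′ F) ⟩
        W w w′ * bound n ^ k * (total (monomial F) * R) ≡⟨ a₄ (W w w′) (bound n ^ k) (total (monomial F)) R ⟩
        total (monomial F) * bound n ^ k * (W w w′ * R) ∎
        where
        R = (1 + T * (ι (w′ == w) + occ w F)) * (1 + T * occ w′ F)
        a₁ : ∀ t p w s → t * p * (w * s) ≡ w * t * (p * s)
        a₁ = solve-∀
        a₂ : ∀ l k → suc (suc l) + 2 * k ≡ l + 2 * suc k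
        a₂ = solve-∀
        a₃ : ∀ w t m b → w * t * (m * b) ≡ w * b * (t * m)
        a₃ = solve-∀
        a₄ : ∀ w b m r → w * b * (m * r) ≡ m * b * (w * r)
        a₄ = solve-∀

    quadratic-tail : ∀ k B Y t → 1 ≤ B → m₀ + T * md + 2 * T * (2 * k) * m₁ + T * T * (2 * k + 2 * k * (2 * k)) * m₂ ≤ B → B * Y ≤ T * T * t →
      (bad : Vec (Fin T) N → Bool) → (∀ ω → bad ω ≡ true → t ≤ quadratic ω) → Y ^ k * total (ι ∘ bad) ≤ T ^ N
    quadratic-tail k B Y t B>0 hB hY bad hbad = *-cancelˡ-≤ (B ^ k) ⦃ m^n≢0 B k ⦃ >-nonZero B>0 ⦄ ⦄ (begin
      B ^ k * (Y ^ k * total (ι ∘ bad)) ≡⟨ trans (sym (*-assoc (B ^ k) _ _)) (cong (_* total (ι ∘ bad)) (sym (^-distrib-* B Y k))) ⟩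
      (B * Y) ^ k * total (ι ∘ bad) ≤⟨ *-monoˡ-≤ (total (ι ∘ bad)) (^-monoˡ-≤ k hY) ⟩
      (T * T * t) ^ k * total (ι ∘ bad) ≡⟨ trans (cong (_* total (ι ∘ bad)) (^-distrib-* (T * T) t k)) (trans (*-assoc ((T * T) ^ k) _ _) (cong ((T * T) ^ k *_) (sym (total-*ˡ (t ^ k) (ι ∘ bad))))) ⟩
      (T * T) ^ k * total (λ ω → t ^ k * ι (bad ω)) ≤⟨ *-monoʳ-≤ ((T * T) ^ k) (total-mono pt) ⟩
      (T * T) ^ k * total (λ ω → 1 * quadratic ω ^ k) ≤⟨ biased-moment k [] ≤-refl ⟩
      total {T} {N} (λ _ → 1) * bound (2 * k) ^ k ≤⟨ *-mono-≤ (≤-reflexive (trans (total-const {T} N 1) (*-identityʳ (T ^ N)))) (^-monoˡ-≤ k hB) ⟩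
      T ^ N * B ^ k ≡⟨ *-comm (T ^ N) _ ⟩
      B ^ k * T ^ N ∎)
      where
      open ≤-Reasoning
      pt : ∀ ω → t ^ k * ι (bad ω) ≤ 1 * quadratic ω ^ k
      pt ω with bad ω in e
      ... | false = ≤-trans (≤-reflexive (*-zeroʳ (t ^ k))) z≤n
      ... | true  = ≤-trans (≤-reflexive (*-identityʳ _)) (≤-trans (^-monoˡ-≤ k (hbad ω e)) (≤-reflexive (sym (+-identityʳ _))))

-- Incidence structures with A-side and states of the nibble

record Incidence (P m s c : ℕ) : Set where
  field
    A        : Fin P → Bool
    h        : Fin P → Fin m → Bool
    α        : Fin m → Fin P
    α-A      : ∀ u → A (α u) ≡ true
    α-h      : ∀ u → h (α u) u ≡ true
    α-unique : ∀ p u → A p ≡ true → h p u ≡ true → p ≡ α u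
    B-size   : ∀ u → ∑ (λ p → ι (not (A p)) * ι (h p u)) ≡ s
    codeg    : ∀ p q → p ≢ q → ∑ (λ u → ι (h p u) * ι (h q u)) ≤ c

  column-split : ∀ u (f : Fin P → ℕ) → ∑ (λ q → ι (h q u) * f q) ≡ f (α u) + ∑ (λ q → ι (not (A q)) * ι (h q u) * f q)
  column-split u f = trans (∑-cong term) (trans (∑-+ (λ q → ι (α u == q) * f q) (λ q → ι (not (A q)) * ι (h q u) * f q)) (cong (_+ ∑ (λ q → ι (not (A q)) * ι (h q u) * f q)) (∑-δ (α u) f)))
    where
    term : ∀ q → ι (h q u) * f q ≡ ι (α u == q) * f q + ι (not (A q)) * ι (h q u) * f q
    term q with h q u in hq | A q in Aq
    ... | false | true  rewrite ≢-== {i = α u} {q} (λ e → true≢false (subst (λ z → h z u ≡ true) e (α-h u)) hq) = refl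
    ... | false | false rewrite ≢-== {i = α u} {q} (λ e → true≢false (subst (λ z → h z u ≡ true) e (α-h u)) hq) = refl
    ... | true  | true  rewrite sym (α-unique q u Aq hq) | ==-refl q = sym (+-identityʳ _)
    ... | true  | false rewrite ≢-== {i = α u} {q} (λ e → true≢false (subst (λ z → A z ≡ true) e (α-A u)) Aq) = refl

  column-sum : ∀ u → ∑ (λ q → ι (h q u)) ≡ suc s
  column-sum u = trans (∑-cong λ q → sym (*-identityʳ (ι (h q u)))) (trans (column-split u (λ _ → 1)) (cong suc (trans (∑-cong λ q → *-identityʳ (ι (not (A q)) * ι (h q u))) (B-size u))))

  degree-in : (Fin m → Bool) → Fin P → ℕ
  degree-in E p = ∑ λ u → ι (E u) * ι (h p u)

-- A-degrees are equalities because both directions are used: a large A-degree forces B-vertices to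
-- lose edges, a bounded one keeps variances and dependencies small. `trim-state` restores equality
-- after each step.
record State {P m s c} (H : Incidence P m s c) (a b : ℕ) (E : Fin m → Bool) (A′ : Fin P → Bool) : Set where
  open Incidence H
  field
    A′⊂A  : ∀ p → A′ p ≡ true → A p ≡ true
    alive : ∀ u → E u ≡ true → A′ (α u) ≡ true
    A-deg : ∀ p → A′ p ≡ true → degree-in E p ≡ a
    B-deg : ∀ p → A p ≡ false → degree-in E p ≤ b

∑-<ᵇ : ∀ {n} d → d ≤ n → ∑ {n} (λ j → ι (toℕ j <ᵇ d)) ≡ d
∑-<ᵇ {zero}  zero    p = refl
∑-<ᵇ {suc n} zero    p = ∑-zero {suc n} {λ j → ι (toℕ j <ᵇ 0)} λ _ → refl
∑-<ᵇ {suc n} (suc d) p = cong suc (∑-<ᵇ {n} d (s≤s⁻¹ p))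

ι*ι-01 : ∀ a b → ι a * ι b * (ι a * ι b) ≡ ι a * ι b
ι*ι-01 a b = trans (cong₂ _*_ (sym (ι-∧ a b)) (sym (ι-∧ a b))) (trans (ι-sq (a ∧ b)) (ι-∧ a b))

ι* : ∀ b x → ι b * x ≤ x
ι* true  x = ≤-reflexive (+-identityʳ x)
ι* false x = z≤n

*ι : ∀ x b → x * ι b ≤ x
*ι x b = ≤-trans (≤-reflexive (*-comm x _)) (ι* b x)

∑-pull : ∀ {n k} (f : Fin n → ℕ) (g : Fin n → Fin k → ℕ) → ∑ (λ w → ∑ λ q → f q * g q w) ≡ ∑ λ q → f q * ∑ (g q)
∑-pull f g = trans (∑-swap λ w q → f q * g q w) (∑-cong λ q → ∑-*ˡ (f q) (g q))

-- Coordinates of the random experiment: the edges, and b dummy coordinates per vertex, of which just enough are switched on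
-- to give every B-vertex exactly b incident coordinates.
module Extended {P m s c a b} (H : Incidence P m s c) (E : Fin m → Bool) (A′ : Fin P → Bool) (st : State H a b E A′) (b≤a : b ≤ a) where
  open Incidence H public
  open State st public

  N : ℕ
  N = m + P * b

  deficit : Fin P → ℕ
  deficit p = ι (not (A p)) * (b ∸ degree-in E p)

  ext : Fin P → Fin m ⊎ Fin (P * b) → ℕ
  ext p (inj₁ u) = ι (E u) * ι (h p u)
  ext p (inj₂ w) = ι (p == proj₁ (remQuot {P} b w)) * ι (toℕ (proj₂ (remQuot {P} b w)) <ᵇ deficit p)

  h⁺ : Fin P → Fin N → ℕ
  h⁺ p w = ext p (splitAt m w)

  ρ : Fin P → ℕ
  ρ p = ∑ (h⁺ p)

  h⁺-edge : ∀ p u → h⁺ p (u ↑ˡ (P * b)) ≡ ι (E u) * ι (h p u)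
  h⁺-edge p u = cong (ext p) (Fin.splitAt-↑ˡ m u (P * b))

  h⁺-01 : ∀ p w → h⁺ p w * h⁺ p w ≡ h⁺ p w
  h⁺-01 p w with splitAt m w
  ... | inj₁ u  = ι*ι-01 (E u) (h p u)
  ... | inj₂ w′ = ι*ι-01 (p == proj₁ (remQuot {P} b w′)) (toℕ (proj₂ (remQuot {P} b w′)) <ᵇ deficit p)

  private
    dead-degree : ∀ p → A p ≡ true → A′ p ≡ false → degree-in E p ≡ 0
    dead-degree p Ap A′p = ∑-zero term
      where
      term : ∀ u → ι (E u) * ι (h p u) ≡ 0
      term u with E u in Eu | h p u in hp
      ... | false | _     = refl
      ... | true  | false = refl
      ... | true  | true  = ⊥-elim (true≢false (subst (λ z → A′ z ≡ true) (sym (α-unique p u Ap hp)) (alive u Eu)) A′p)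

    deficit≤ : ∀ p → deficit p ≤ b
    deficit≤ p = ≤-trans (ι* (not (A p)) (b ∸ degree-in E p)) (m∸n≤m b (degree-in E p))

  ρ-split : ∀ p → ρ p ≡ degree-in E p + deficit p
  ρ-split p = trans (∑-⊎ m (ext p)) (cong (degree-in E p +_)
    (trans (∑-× P b (λ v → ι (p == proj₁ v) * ι (toℕ (proj₂ v) <ᵇ deficit p)))
    (trans (∑-cong λ q → ∑-*ˡ {b} (ι (p == q)) (λ j → ι (toℕ j <ᵇ deficit p))) (trans (∑-δ p (λ q → ∑ {b} (λ j → ι (toℕ j <ᵇ deficit p)))) (∑-<ᵇ (deficit p) (deficit≤ p))))))

  ρ-B : ∀ p → A p ≡ false → ρ p ≡ b
  ρ-B p Bp = trans (ρ-split p) (trans (cong (λ z → degree-in E p + ι (not z) * (b ∸ degree-in E p)) Bp) (trans (cong (degree-in E p +_) (+-identityʳ _)) (m+[n∸m]≡n (B-deg p Bp))))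

  ρ-A : ∀ p → A p ≡ true → ρ p ≡ degree-in E p
  ρ-A p Ap = trans (ρ-split p) (trans (cong (λ z → degree-in E p + ι (not z) * (b ∸ degree-in E p)) Ap) (+-identityʳ _))

  ρ-A′ : ∀ p → A′ p ≡ true → ρ p ≡ a
  ρ-A′ p A′p = trans (ρ-A p (A′⊂A p A′p)) (A-deg p A′p)

  ρ≤a : ∀ p → ρ p ≤ a
  ρ≤a p with A p in Ap
  ... | false = ≤-trans (≤-reflexive (ρ-B p Ap)) b≤a
  ... | true  with A′ p in A′p
  ...   | true  = ≤-reflexive (ρ-A′ p A′p)
  ...   | false = ≤-trans (≤-reflexive (trans (ρ-A p Ap) (dead-degree p Ap A′p))) z≤n

  degree≤ρ : ∀ p → degree-in E p ≤ ρ p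
  degree≤ρ p = ≤-trans (m≤m+n _ _) (≤-reflexive (sym (ρ-split p)))

  degree≤a : ∀ p → degree-in E p ≤ a
  degree≤a p = ≤-trans (degree≤ρ p) (ρ≤a p)

  h⁺-column : ∀ w → ∑ (λ p → h⁺ p w) ≤ suc s
  h⁺-column w with splitAt m w
  ... | inj₁ u  = ≤-trans (∑-mono λ p → ι* (E u) (ι (h p u))) (≤-reflexive (column-sum u))
  ... | inj₂ w′ = ≤-trans (∑-mono {g = λ p → ι (proj₁ (remQuot {P} b w′) == p) * 1}
                    λ p → ≤-trans (*-monoʳ-≤ (ι (p == proj₁ (remQuot {P} b w′))) (ι≤1 (toℕ (proj₂ (remQuot {P} b w′)) <ᵇ deficit p))) (≤-reflexive (cong (λ z → ι z * 1) (==-sym p _))))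
                    (≤-trans (≤-reflexive (∑-δ (proj₁ (remQuot {P} b w′)) (λ _ → 1))) (s≤s z≤n))

  h⁺-codeg : ∀ p q → p ≢ q → ∑ (λ w → h⁺ p w * h⁺ q w) ≤ c
  h⁺-codeg p q p≢q = ≤-trans (≤-reflexive (∑-⊎ m (λ w → ext p w * ext q w)))
    (≤-trans (+-mono-≤ (∑-mono λ u → *-mono-≤ (ι* (E u) (ι (h p u))) (ι* (E u) (ι (h q u)))) (≤-reflexive (∑-zero dummy)))
    (≤-trans (≤-reflexive (+-identityʳ _)) (codeg p q p≢q)))
    where
    dummy : ∀ w → ext p (inj₂ w) * ext q (inj₂ w) ≡ 0
    dummy w with p == proj₁ (remQuot {P} b w) in e₁ | q == proj₁ (remQuot {P} b w) in e₂
    ... | false | _     = refl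
    ... | true  | false = *-zeroʳ (ι (toℕ (proj₂ (remQuot {P} b w)) <ᵇ deficit p) + 0)
    ... | true  | true  = ⊥-elim (p≢q (trans (==-true {i = p} e₁) (sym (==-true {i = q} e₂))))

  column-ρ : ∀ u → E u ≡ true → ∑ (λ q → ι (h q u) * ρ q) ≡ a + s * b
  column-ρ u Eu = trans (column-split u ρ) (cong₂ _+_ (ρ-A′ (α u) (alive u Eu)) (trans (∑-cong term) (trans (∑-*ʳ b (λ q → ι (not (A q)) * ι (h q u))) (cong (_* b) (B-size u)))))
    where
    term : ∀ q → ι (not (A q)) * ι (h q u) * ρ q ≡ ι (not (A q)) * ι (h q u) * b
    term q with A q in Aq
    ... | true  = refl
    ... | false = cong ((ι (h q u) + 0) *_) (ρ-B q Aq)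

-- Coefficients of the linear and quadratic statistics attached to a vertex

∑-ι* : ∀ {n} (i : Fin n) (f : Fin n → ℕ) → ∑ (λ j → ι (not (j == i)) * f j) + f i ≡ ∑ f
∑-ι* i f = trans (cong (∑ (λ j → ι (not (j == i)) * f j) +_) (sym (∑-δ i f))) (trans (sym (∑-+ (λ j → ι (not (j == i)) * f j) (λ j → ι (i == j) * f j)))
  (∑-cong λ j → trans (sym (*-distribʳ-+ (f j) (ι (not (j == i))) (ι (i == j))))
    (trans (cong (λ z → (ι (not z) + ι (i == j)) * f j) (==-sym j i)) (trans (cong (_* f j) (trans (+-comm (ι (not (i == j))) (ι (i == j))) (ι-not (i == j)))) (+-identityʳ (f j))))))

off-diagonal : ∀ {n} (f : Fin n → ℕ) → (∀ q → f q * f q ≡ f q) →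
  ∑ f * (∑ f ∸ 1) ≡ ∑ λ q → ∑ λ q′ → ι (not (q == q′)) * (f q * f q′)
off-diagonal f sq = trans (*-distribˡ-∸ (∑ f) (∑ f) 1) (trans (cong (∑ f * ∑ f ∸_) (*-identityʳ (∑ f))) (trans (cong (_∸ ∑ f) (sym S²)) (m+n∸n≡m O (∑ f))))
  where
  O = ∑ λ q → ∑ λ q′ → ι (not (q == q′)) * (f q * f q′)
  S² : O + ∑ f ≡ ∑ f * ∑ f
  S² = trans (cong (O +_) (∑-cong (sym ∘ sq))) (trans (sym (∑-+ (λ q → ∑ λ q′ → ι (not (q == q′)) * (f q * f q′)) (λ q → f q * f q)))
    (trans (∑-cong λ q → trans (cong (_+ f q * f q) (∑-cong λ q′ → cong (λ z → ι (not z) * (f q * f q′)) (==-sym q q′))) (trans (∑-ι* q (λ q′ → f q * f q′)) (∑-*ˡ (f q) f))) (∑-*ʳ (∑ f) f)))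

module Weights {P m s c a b} (H : Incidence P m s c) (E : Fin m → Bool) (A′ : Fin P → Bool) (st : State H a b E A′) (b≤a : b ≤ a) where
  open Extended H E A′ st b≤a public

  e : Fin P → Fin m → ℕ
  e p u = ι (E u) * ι (h p u)

  -- Hits at `p` itself are left out: they do no harm to an A-vertex that stays uncovered, and at a
  -- B-vertex they only lower a degree that is to be bounded from above.
  K : Fin P → Fin P → Fin m → ℕ
  K p q u = ι (not (q == p)) * ι (h q u)

  y : Fin P → Fin m → Fin N → ℕ
  y p u w = ∑ λ q → K p q u * h⁺ q w

  -- The first-order effect of activating `w` on the degree of `p`: an edge at `p` counts once for
  -- each vertex other than `p` that it shares with `w`.
  C : Fin P → Fin N → ℕ
  C p w = ∑ λ u → e p u * y p u w

  r : Fin N → Fin N → ℕ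
  r w w′ = ι (not (w == w′)) * ∑ (λ q → h⁺ q w * h⁺ q w′)

  -- `W₁` carries `Z (Z - 1)`, where `Z` counts the hits on an edge away from `p`; the subtraction
  -- removes the trivial diagonal pairs. `W₂` carries an active coordinate at the A-vertex of an
  -- edge together with a second one meeting it, without which that A-vertex could not be hit and
  -- stay uncovered. Both serve upper bounds at B-vertices, so `W` vanishes on A.
  W₁ W₂ W : Fin P → Fin N → Fin N → ℕ
  W₁ p w w′ = ∑ λ u → e p u * (y p u w * (y p u w′ ∸ ι (w == w′)))
  W₂ p w w′ = ∑ λ u → e p u * (h⁺ (α u) w * r w w′)
  W  p w w′ = ι (not (A p)) * (W₁ p w w′ + W₂ p w w′)

  r₁ : ℕ
  r₁ = suc s

  M : ℕ
  M = r₁ * a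

  module _ (p : Fin P) where
    K≤ : ∀ q u → K p q u ≤ ι (h q u)
    K≤ q u = ι* (not (q == p)) (ι (h q u))

    K≤1 : ∀ q u → K p q u ≤ 1
    K≤1 q u = ≤-trans (K≤ q u) (ι≤1 (h q u))

    K-column : ∀ u → ∑ (λ q → K p q u) ≤ r₁
    K-column u = ≤-trans (∑-mono λ q → K≤ q u) (≤-reflexive (column-sum u))

    κ-codeg : ∀ q → ∑ (λ u → e p u * K p q u) ≤ c
    κ-codeg q with q == p in q≡p
    ... | true  = ≤-trans (≤-reflexive (∑-zero {f = λ u → e p u * 0} λ u → *-zeroʳ (e p u))) z≤n
    ... | false = ≤-trans (∑-mono λ u → *-mono-≤ (ι* (E u) (ι (h p u))) (≤-reflexive (+-identityʳ (ι (h q u)))))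
                    (codeg p q λ p≡q → true≢false (subst (λ z → (q == z) ≡ true) (sym p≡q) (==-refl q)) q≡p)

    y≤r₁ : ∀ u w → y p u w ≤ r₁
    y≤r₁ u w = ≤-trans (∑-mono λ q → ≤-trans (*-monoˡ-≤ (h⁺ q w) (K≤1 q u)) (≤-reflexive (+-identityʳ (h⁺ q w)))) (h⁺-column w)

    y-row : ∀ u → ∑ (y p u) ≤ M
    y-row u = ≤-trans (≤-reflexive (∑-pull (λ q → K p q u) h⁺)) (≤-trans (∑-*≤ (λ q → K p q u) ρ ρ≤a) (*-monoˡ-≤ a (K-column u)))

    C-κ : ∀ w → C p w ≡ ∑ λ q → ∑ (λ u → e p u * K p q u) * h⁺ q w
    C-κ w = trans (∑-cong λ u → trans (sym (∑-*ˡ (e p u) (λ q → K p q u * h⁺ q w))) (∑-cong λ q → sym (*-assoc (e p u) (K p q u) (h⁺ q w))))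
      (trans (∑-swap (λ u q → e p u * K p q u * h⁺ q w)) (∑-cong λ q → ∑-*ʳ (h⁺ q w) (λ u → e p u * K p q u)))

    C≤ : ∀ w → C p w ≤ c * r₁
    C≤ w = begin
      C p w ≡⟨ C-κ w ⟩
      ∑ (λ q → ∑ (λ u → e p u * K p q u) * h⁺ q w) ≤⟨ ∑-mono (λ q → *-monoˡ-≤ (h⁺ q w) (κ-codeg q)) ⟩
      ∑ (λ q → c * h⁺ q w) ≡⟨ ∑-*ˡ c (λ q → h⁺ q w) ⟩
      c * ∑ (λ q → h⁺ q w) ≤⟨ *-monoʳ-≤ c (h⁺-column w) ⟩
      c * r₁ ∎
      where open ≤-Reasoning

    ∑C : ∑ (C p) ≡ ∑ λ u → e p u * ∑ (λ q → K p q u * ρ q)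
    ∑C = trans (∑-pull (e p) (y p)) (∑-cong λ u → cong (e p u *_) (∑-pull (λ q → K p q u) h⁺))

    -- The vertices of a live edge meet `a + s * b` coordinates in all by `column-ρ`; the term with
    -- `ρ p` puts back the excluded vertex `p`. For `p` in `A′` this leaves `a * (s * b)`, for `p`
    -- in B it leaves the degree times `a + (s - 1) * b`.
    ∑C-exact : ∑ (C p) + degree-in E p * ρ p ≡ degree-in E p * (a + s * b)
    ∑C-exact = begin-equality
      ∑ (C p) + degree-in E p * ρ p ≡⟨ cong₂ _+_ ∑C (sym (∑-*ʳ (ρ p) (e p))) ⟩
      ∑ (λ u → e p u * ∑ (λ q → K p q u * ρ q)) + ∑ (λ u → e p u * ρ p) ≡⟨ sym (∑-+ (λ u → e p u * ∑ (λ q → K p q u * ρ q)) (λ u → e p u * ρ p)) ⟩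
      ∑ (λ u → e p u * ∑ (λ q → K p q u * ρ q) + e p u * ρ p) ≡⟨ ∑-cong term ⟩
      ∑ (λ u → e p u * (a + s * b)) ≡⟨ ∑-*ʳ (a + s * b) (e p) ⟩
      degree-in E p * (a + s * b) ∎
      where
      open ≤-Reasoning
      term : ∀ u → e p u * ∑ (λ q → K p q u * ρ q) + e p u * ρ p ≡ e p u * (a + s * b)
      term u with E u in Eu | h p u in hp
      ... | false | _     = refl
      ... | true  | false = refl
      ... | true  | true  = trans (cong₂ _+_ (+-identityʳ _) (+-identityʳ (ρ p))) (trans (trans (cong₂ _+_ (∑-cong λ q → *-assoc (ι (not (q == p))) (ι (h q u)) (ρ q)) (sym (trans (cong (λ z → ι z * ρ p) hp) (+-identityʳ (ρ p)))))
                            (trans (∑-ι* p (λ q → ι (h q u) * ρ q)) (column-ρ u Eu))) (sym (+-identityʳ _)))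

    ∑C≤ : ∑ (C p) ≤ a * M
    ∑C≤ = ≤-trans (≤-reflexive ∑C) (≤-trans (∑-*≤ (e p) _ λ u → ≤-trans (∑-*≤ (λ q → K p q u) ρ ρ≤a) (*-monoˡ-≤ a (K-column u))) (*-monoˡ-≤ M (degree≤a p)))

    W₁≤ : ∀ w w′ → W₁ p w w′ ≤ ∑ λ u → e p u * y p u w * y p u w′
    W₁≤ w w′ = ∑-mono λ u → ≤-trans (*-monoʳ-≤ (e p u) (*-monoʳ-≤ (y p u w) (m∸n≤m (y p u w′) (ι (w == w′))))) (≤-reflexive (sym (*-assoc (e p u) (y p u w) (y p u w′))))

    W₁-row : ∀ w → ∑ (W₁ p w) ≤ C p w * M
    W₁-row w = ≤-trans (∑-mono (W₁≤ w)) (≤-trans (≤-reflexive (∑-pull (λ u → e p u * y p u w) (y p))) (∑-*≤ (λ u → e p u * y p u w) (λ u → ∑ (y p u)) y-row))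

    W₁-column : ∀ w′ → ∑ (λ w → W₁ p w w′) ≤ C p w′ * M
    W₁-column w′ = ≤-trans (∑-mono λ w → ≤-trans (W₁≤ w w′) (≤-reflexive (∑-cong λ u → swap (e p u) (y p u w) (y p u w′))))
      (≤-trans (≤-reflexive (∑-pull (λ u → e p u * y p u w′) (y p))) (∑-*≤ (λ u → e p u * y p u w′) (λ u → ∑ (y p u)) y-row))
      where
      swap : ∀ a b c → a * b * c ≡ a * c * b
      swap = solve-∀

    W₁-entry : ∀ w w′ → W₁ p w w′ ≤ C p w * r₁
    W₁-entry w w′ = ≤-trans (W₁≤ w w′) (∑-*≤ (λ u → e p u * y p u w) (λ u → y p u w′) (λ u → y≤r₁ u w′))

    n : Fin N → ℕ
    n w = ∑ λ u → e p u * h⁺ (α u) w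

    W₂-n : ∀ w w′ → W₂ p w w′ ≡ n w * r w w′
    W₂-n w w′ = trans (∑-cong λ u → sym (*-assoc (e p u) (h⁺ (α u) w) (r w w′))) (∑-*ʳ (r w w′) (λ u → e p u * h⁺ (α u) w))

    n≤C : A p ≡ false → ∀ w → n w ≤ C p w
    n≤C Bp w = ∑-mono λ u → *-monoʳ-≤ (e p u) (≤-trans (≤-reflexive (sym (lem u))) (≤∑ (λ q → K p q u * h⁺ q w) (α u)))
      where
      lem : ∀ u → K p (α u) u * h⁺ (α u) w ≡ h⁺ (α u) w
      lem u rewrite ≢-== {i = α u} {p} (λ e → true≢false (subst (λ z → A z ≡ true) e (α-A u)) Bp) | α-h u = +-identityʳ _

    -- On the diagonal `y (y - 1)` counts ordered pairs of distinct vertices of an edge that both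
    -- lie on `w`, so codegrees apply. The plain square would give order `a^2` instead of `a c`, too
    -- much after multiplication by `T`.
    W₁-diagonal : ∑ (λ w → W₁ p w w) ≤ a * (r₁ * (r₁ * c))
    W₁-diagonal = begin
      ∑ (λ w → ∑ λ u → e p u * (y p u w * (y p u w ∸ ι (w == w)))) ≡⟨ ∑-pull (e p) (λ u w → y p u w * (y p u w ∸ ι (w == w))) ⟩
      ∑ (λ u → e p u * ∑ λ w → y p u w * (y p u w ∸ ι (w == w))) ≤⟨ ∑-*≤ (e p) _ per-edge ⟩
      degree-in E p * (r₁ * (r₁ * c)) ≤⟨ *-monoˡ-≤ (r₁ * (r₁ * c)) (degree≤a p) ⟩
      a * (r₁ * (r₁ * c)) ∎
      where
      open ≤-Reasoning
      per-edge : ∀ u → ∑ (λ w → y p u w * (y p u w ∸ ι (w == w))) ≤ r₁ * (r₁ * c)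
      per-edge u = begin
        ∑ (λ w → y p u w * (y p u w ∸ ι (w == w)))
          ≡⟨ ∑-cong (λ w → trans (cong (λ z → y p u w * (y p u w ∸ ι z)) (==-refl w)) (off-diagonal (λ q → K p q u * h⁺ q w) (sq w))) ⟩
        ∑ (λ w → ∑ λ q → ∑ λ q′ → ι (not (q == q′)) * (K p q u * h⁺ q w * (K p q′ u * h⁺ q′ w)))
          ≡⟨ ∑-cong (λ w → ∑-cong λ q → trans (∑-cong λ q′ → arr (ι (not (q == q′))) (K p q u) (h⁺ q w) (K p q′ u) (h⁺ q′ w)) (∑-*ˡ (K p q u) (λ q′ → K p q′ u * (ι (not (q == q′)) * (h⁺ q w * h⁺ q′ w))))) ⟩
        ∑ (λ w → ∑ λ q → K p q u * ∑ λ q′ → K p q′ u * (ι (not (q == q′)) * (h⁺ q w * h⁺ q′ w)))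
          ≡⟨ ∑-pull (λ q → K p q u) (λ q w → ∑ λ q′ → K p q′ u * (ι (not (q == q′)) * (h⁺ q w * h⁺ q′ w))) ⟩
        ∑ (λ q → K p q u * ∑ λ w → ∑ λ q′ → K p q′ u * (ι (not (q == q′)) * (h⁺ q w * h⁺ q′ w)))
          ≤⟨ ∑-*≤ (λ q → K p q u) _ inner ⟩
        ∑ (λ q → K p q u) * (r₁ * c) ≤⟨ *-monoˡ-≤ (r₁ * c) (K-column u) ⟩
        r₁ * (r₁ * c) ∎
        where
        arr : ∀ i k h k′ h′ → i * (k * h * (k′ * h′)) ≡ k * (k′ * (i * (h * h′)))
        arr = solve-∀
        sq : ∀ w q → K p q u * h⁺ q w * (K p q u * h⁺ q w) ≡ K p q u * h⁺ q w
        sq w q = trans (arr₂ (K p q u) (h⁺ q w)) (cong₂ _*_ (ι*ι-01 (not (q == p)) (h q u)) (h⁺-01 q w))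
          where
          arr₂ : ∀ k h → k * h * (k * h) ≡ k * k * (h * h)
          arr₂ = solve-∀
        inner : ∀ q → ∑ (λ w → ∑ λ q′ → K p q′ u * (ι (not (q == q′)) * (h⁺ q w * h⁺ q′ w))) ≤ r₁ * c
        inner q = ≤-trans (≤-reflexive (∑-pull (λ q′ → K p q′ u) (λ q′ w → ι (not (q == q′)) * (h⁺ q w * h⁺ q′ w))))
          (≤-trans (∑-*≤ (λ q′ → K p q′ u) _ pair) (*-monoˡ-≤ c (K-column u)))
          where
          pair : ∀ q′ → ∑ (λ w → ι (not (q == q′)) * (h⁺ q w * h⁺ q′ w)) ≤ c
          pair q′ with q Fin.≟ q′
          ... | yes _   = ≤-trans (≤-reflexive (∑-zero {N} {λ _ → 0} λ _ → refl)) z≤n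
          ... | no q≢q′ = ≤-trans (≤-reflexive (∑-cong λ w → +-identityʳ (h⁺ q w * h⁺ q′ w))) (h⁺-codeg q q′ q≢q′)

  r-row : ∀ w → ∑ (r w) ≤ M
  r-row w = begin
    ∑ (λ w′ → ι (not (w == w′)) * ∑ (λ q → h⁺ q w * h⁺ q w′)) ≤⟨ ∑-mono (λ w′ → ι* (not (w == w′)) _) ⟩
    ∑ (λ w′ → ∑ (λ q → h⁺ q w * h⁺ q w′)) ≡⟨ ∑-pull (λ q → h⁺ q w) h⁺ ⟩
    ∑ (λ q → h⁺ q w * ρ q) ≤⟨ ∑-*≤ (λ q → h⁺ q w) ρ ρ≤a ⟩
    ∑ (λ q → h⁺ q w) * a ≤⟨ *-monoˡ-≤ a (h⁺-column w) ⟩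
    r₁ * a ∎
    where open ≤-Reasoning

  r-sym : ∀ w w′ → r w w′ ≡ r w′ w
  r-sym w w′ = cong₂ (λ b z → ι (not b) * z) (==-sym w w′) (∑-cong λ q → *-comm (h⁺ q w) (h⁺ q w′))

  r-column : ∀ w′ → ∑ (λ w → r w w′) ≤ M
  r-column w′ = ≤-trans (≤-reflexive (∑-cong λ w → r-sym w w′)) (r-row w′)

  r≤r₁ : ∀ w w′ → r w w′ ≤ r₁
  r≤r₁ w w′ = ≤-trans (ι* (not (w == w′)) _) (≤-trans (∑-mono λ q → *-monoʳ-≤ (h⁺ q w) (h⁺≤1 q)) (≤-trans (≤-reflexive (∑-cong λ q → *-identityʳ (h⁺ q w))) (h⁺-column w)))
    where
    01≤1 : ∀ x → x * x ≡ x → x ≤ 1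
    01≤1 zero          _ = z≤n
    01≤1 (suc zero)    _ = ≤-refl
    01≤1 (suc (suc x)) q = ⊥-elim (m+1+n≢m x (suc-injective (suc-injective q)))
    h⁺≤1 : ∀ q → h⁺ q w′ ≤ 1
    h⁺≤1 q = 01≤1 (h⁺ q w′) (h⁺-01 q w′)

  private
    masked : ∀ p {x z} → (A p ≡ false → x ≤ z) → ι (not (A p)) * x ≤ z
    masked p f with A p
    ... | true  = z≤n
    ... | false = ≤-trans (≤-reflexive (+-identityʳ _)) (f refl)

    ∑-masked : ∀ p {k} (f g : Fin k → ℕ) {z} → (A p ≡ false → ∑ f + ∑ g ≤ z) → ∑ (λ w → ι (not (A p)) * (f w + g w)) ≤ z
    ∑-masked p f g h = ≤-trans (≤-reflexive (trans (∑-*ˡ (ι (not (A p))) (λ w → f w + g w)) (cong (ι (not (A p)) *_) (∑-+ f g)))) (masked p h)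

  W-row : ∀ p w → ∑ (W p w) ≤ 2 * (C p w * M)
  W-row p w = ∑-masked p (W₁ p w) (W₂ p w) λ Bp → ≤-trans (+-mono-≤ (W₁-row p w)
    (≤-trans (≤-reflexive (trans (∑-cong (W₂-n p w)) (∑-*ˡ (n p w) (r w)))) (*-mono-≤ (n≤C p Bp w) (r-row w)))) (≤-reflexive (cong (C p w * M +_) (sym (+-identityʳ _))))

  W-column : ∀ p w′ → ∑ (λ w → W p w w′) ≤ C p w′ * M + ∑ (λ w → C p w * r w w′)
  W-column p w′ = ∑-masked p (λ w → W₁ p w w′) (λ w → W₂ p w w′) λ Bp → +-mono-≤ (W₁-column p w′)
    (∑-mono λ w → ≤-trans (≤-reflexive (W₂-n p w w′)) (*-monoˡ-≤ (r w w′) (n≤C p Bp w)))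

  m₁ m₂ m₀ md : ℕ
  m₁ = 2 * (c * r₁ * M)
  m₂ = 2 * (c * r₁ * r₁)
  m₀ = 2 * (a * M * M)
  md = a * (r₁ * (r₁ * c))

  W-row≤ : ∀ p w → ∑ (W p w) ≤ m₁
  W-row≤ p w = ≤-trans (W-row p w) (*-monoʳ-≤ 2 (*-monoˡ-≤ M (C≤ p w)))

  W-column≤ : ∀ p w′ → ∑ (λ w → W p w w′) ≤ m₁
  W-column≤ p w′ = ≤-trans (W-column p w′) (≤-trans (+-mono-≤ (*-monoˡ-≤ M (C≤ p w′)) (≤-trans (∑-mono λ w → *-monoˡ-≤ (r w w′) (C≤ p w))
    (≤-trans (≤-reflexive (∑-*ˡ (c * r₁) (λ w → r w w′))) (*-monoʳ-≤ (c * r₁) (r-column w′))))) (≤-reflexive (cong (c * r₁ * M +_) (sym (+-identityʳ _)))))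

  W-entry : ∀ p w w′ → W p w w′ ≤ m₂
  W-entry p w w′ = masked p λ Bp → ≤-trans (+-mono-≤ (≤-trans (W₁-entry p w w′) (*-monoˡ-≤ r₁ (C≤ p w)))
    (≤-trans (≤-reflexive (W₂-n p w w′)) (*-mono-≤ (≤-trans (n≤C p Bp w) (C≤ p w)) (r≤r₁ w w′)))) (≤-reflexive (cong (c * r₁ * r₁ +_) (sym (+-identityʳ _))))

  W-total : ∀ p → ∑ (λ w → ∑ (W p w)) ≤ m₀
  W-total p = ≤-trans (∑-mono (W-row p)) (≤-trans (≤-reflexive (trans (∑-*ˡ 2 (λ w → C p w * M)) (cong (2 *_) (∑-*ʳ M (C p))))) (*-monoʳ-≤ 2 (*-monoˡ-≤ M (∑C≤ p))))

  W-diagonal : ∀ p → ∑ (λ w → W p w w) ≤ md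
  W-diagonal p = ∑-masked p (λ w → W₁ p w w) (λ w → W₂ p w w) λ Bp → ≤-trans (≤-reflexive (trans (cong (∑ (λ w → W₁ p w w) +_) (∑-zero zr)) (+-identityʳ _))) (W₁-diagonal p)
    where
    zr : ∀ w → W₂ p w w ≡ 0
    zr w = trans (W₂-n p w w) (trans (cong (λ z → n p w * (ι (not z) * ∑ (λ q → h⁺ q w * h⁺ q w))) (==-refl w)) (*-zeroʳ (n p w)))

  -- Positive wherever the statistics at `p` have a coefficient involving `w`. As a sum of
  -- coefficients it has row and column sums that are easy to bound, and their product bounds the
  -- dependency degree.
  influence : Fin P → Fin N → ℕ
  influence p w = C p w + (∑ (W p w) + ∑ (λ w′ → W p w′ w))

  influence-row : ∀ p → ∑ (influence p) ≤ a * M + (m₀ + m₀)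
  influence-row p = ≤-trans (≤-reflexive (trans (∑-+ (C p) _) (cong (∑ (C p) +_) (∑-+ (λ w → ∑ (W p w)) (λ w → ∑ (λ w′ → W p w′ w))))))
    (+-mono-≤ (∑C≤ p) (+-mono-≤ (W-total p) (≤-trans (≤-reflexive (∑-swap (λ w w′ → W p w′ w))) (W-total p))))

  -- Double counting, starting from `w`: a vertex `q` on `w`, an edge `u` at `q`, a vertex `p` of
  -- `u`.
  C-column : ∀ w → ∑ (λ p → C p w) ≤ r₁ * M
  C-column w = begin
    ∑ (λ p → ∑ λ u → e p u * y p u w) ≤⟨ ∑-mono (λ p → ∑-mono λ u → *-monoʳ-≤ (e p u) (∑-mono λ q → *-monoˡ-≤ (h⁺ q w) (K≤ p q u))) ⟩
    ∑ (λ p → ∑ λ u → ι (E u) * ι (h p u) * Y u) ≡⟨ ∑-cong (λ p → ∑-cong λ u → arr (ι (E u)) (ι (h p u)) (Y u)) ⟩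
    ∑ (λ p → ∑ λ u → ι (E u) * Y u * ι (h p u)) ≡⟨ ∑-pull (λ u → ι (E u) * Y u) (λ u p → ι (h p u)) ⟩
    ∑ (λ u → ι (E u) * Y u * ∑ (λ p → ι (h p u))) ≡⟨ trans (∑-cong λ u → cong (ι (E u) * Y u *_) (column-sum u)) (∑-*ʳ r₁ (λ u → ι (E u) * Y u)) ⟩
    ∑ (λ u → ι (E u) * Y u) * r₁ ≡⟨ cong (_* r₁) (∑-cong λ u → trans (sym (∑-*ˡ (ι (E u)) (λ q → ι (h q u) * h⁺ q w))) (∑-cong λ q → arr₂ (ι (E u)) (ι (h q u)) (h⁺ q w))) ⟩
    ∑ (λ u → ∑ λ q → h⁺ q w * e q u) * r₁ ≡⟨ cong (_* r₁) (∑-pull (λ q → h⁺ q w) e) ⟩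
    ∑ (λ q → h⁺ q w * degree-in E q) * r₁ ≤⟨ *-monoˡ-≤ r₁ (≤-trans (∑-*≤ (λ q → h⁺ q w) (degree-in E) degree≤a) (*-monoˡ-≤ a (h⁺-column w))) ⟩
    M * r₁ ≡⟨ *-comm M r₁ ⟩
    r₁ * M ∎
    where
    open ≤-Reasoning
    Y : Fin m → ℕ
    Y u = ∑ λ q → ι (h q u) * h⁺ q w
    arr : ∀ a b c → a * b * c ≡ a * c * b
    arr = solve-∀
    arr₂ : ∀ a b c → a * (b * c) ≡ c * (a * b)
    arr₂ = solve-∀

  influence-column : ∀ w → ∑ (λ p → influence p w) ≤ r₁ * M + (2 * (r₁ * M * M) + (r₁ * M * M + r₁ * M * M))
  influence-column w = ≤-trans (≤-reflexive (trans (∑-+ (λ p → C p w) _) (cong (∑ (λ p → C p w) +_) (∑-+ (λ p → ∑ (W p w)) (λ p → ∑ (λ w′ → W p w′ w))))))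
    (+-mono-≤ (C-column w) (+-mono-≤
      (≤-trans (∑-mono λ p → W-row p w) (≤-trans (≤-reflexive (trans (∑-*ˡ 2 (λ p → C p w * M)) (cong (2 *_) (∑-*ʳ M (λ p → C p w))))) (*-monoʳ-≤ 2 (*-monoˡ-≤ M (C-column w)))))
      (≤-trans (∑-mono λ p → W-column p w) (≤-trans (≤-reflexive (∑-+ (λ p → C p w * M) (λ p → ∑ (λ w′ → C p w′ * r w′ w))))
        (+-mono-≤ (≤-trans (≤-reflexive (∑-*ʳ M (λ p → C p w))) (*-monoˡ-≤ M (C-column w)))
          (≤-trans (≤-reflexive (trans (∑-swap (λ p w′ → C p w′ * r w′ w)) (∑-cong λ w′ → ∑-*ʳ (r w′ w) (λ p → C p w′))))
          (≤-trans (∑-mono λ w′ → *-monoˡ-≤ (r w′ w) (C-column w′)) (≤-trans (≤-reflexive (∑-*ˡ (r₁ * M) (λ w′ → r w′ w))) (*-monoʳ-≤ (r₁ * M) (r-column w))))))))))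

-- One nibble step, for a fixed outcome of the experiment

does⇒ : ∀ {A : Set} (d : Dec A) → does d ≡ true → A
does⇒ (yes p) _ = p

does-false : ∀ {A : Set} (d : Dec A) → does d ≡ false → ¬ A
does-false (no p) _ = p

ι-does : ∀ {x} (d : Dec (1 ≤ x)) → ι (does d) ≤ x
ι-does (yes p) = p
ι-does (no  _) = z≤n

record Matching {P m s c} (H : Incidence P m s c) (E : Fin m → Bool) (A′ : Fin P → Bool) : Set where
  open Incidence H
  field
    M        : Fin m → Bool
    M⊂E      : ∀ u → M u ≡ true → E u ≡ true
    disjoint : ∀ p u v → u ≢ v → M u ≡ true → M v ≡ true → h p u ≡ true → h p v ≡ true → ⊥
    covers   : ∀ p → A′ p ≡ true → ∃ λ u → M u ≡ true × h p u ≡ true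

trim : ∀ {n} (f : Fin n → Bool) k → k ≤ ∑ (ι ∘ f) → Σ (Fin n → Bool) λ g → (∀ u → g u ≡ true → f u ≡ true) × ∑ (ι ∘ g) ≡ k
trim {n}     f zero    p = (λ _ → false) , (λ _ ()) , ∑-zero {n} λ _ → refl
trim {suc n} f (suc k) p with f zero in f0
... | false with trim (f ∘ suc) (suc k) p
...   | g , s , e = g′ , s′ , e
  where
  g′ : Fin (suc n) → Bool
  g′ zero    = false
  g′ (suc u) = g u
  s′ : ∀ u → g′ u ≡ true → f u ≡ true
  s′ (suc u) q = s u q
trim {suc n} f (suc k) p | true with trim (f ∘ suc) k (s≤s⁻¹ p)
...   | g , s , e = g′ , s′ , cong suc e
  where
  g′ : Fin (suc n) → Bool
  g′ zero    = true
  g′ (suc u) = g u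
  s′ : ∀ u → g′ u ≡ true → f u ≡ true
  s′ zero    q = f0
  s′ (suc u) q = s u q

module _ {P m s c} (H : Incidence P m s c) where
  open Incidence H

  -- Every edge has a single A-vertex, so cutting down the edges of each A-vertex separately causes
  -- no interference, and B-degrees only drop.
  trim-state : ∀ {k b E A′} → (∀ p → A′ p ≡ true → A p ≡ true) → (∀ u → E u ≡ true → A′ (α u) ≡ true) →
    (∀ p → A′ p ≡ true → k ≤ degree-in E p) → (∀ p → A p ≡ false → degree-in E p ≤ b) →
    Σ (Fin m → Bool) λ E₂ → (∀ u → E₂ u ≡ true → E u ≡ true) × State H k b E₂ A′
  trim-state {k} {b} {E} {A′} A′⊂A alive large small = E₂ , E₂⊂E , record
    { A′⊂A = A′⊂A ; alive = λ u q → alive u (E₂⊂E u q)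
    ; A-deg = A-deg
    ; B-deg = λ p Bp → ≤-trans (∑-mono λ u → *-monoˡ-≤ (ι (h p u)) (ι-mono (E₂⊂E u))) (small p Bp) }
    where
    ι-mono : ∀ {x y} → (x ≡ true → y ≡ true) → ι x ≤ ι y
    ι-mono {false} f = z≤n
    ι-mono {true}  f rewrite f refl = ≤-refl
    cut : ∀ p → Σ (Fin m → Bool) λ g → (∀ u → g u ≡ true → (E u ∧ h p u) ≡ true) × (A′ p ≡ true → ∑ (ι ∘ g) ≡ k)
    cut p with A′ p in A′p
    ... | false = (λ u → E u ∧ h p u) , (λ u q → q) , λ ()
    ... | true  with trim (λ u → E u ∧ h p u) k (≤-trans (large p A′p) (≤-reflexive (∑-cong λ u → sym (ι-∧ (E u) (h p u)))))
    ...   | g , s , e = g , s , λ _ → e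
    E₂ : Fin m → Bool
    E₂ u = proj₁ (cut (α u)) u
    E₂⊂E : ∀ u → E₂ u ≡ true → E u ≡ true
    E₂⊂E u q = ∧-fst (proj₁ (proj₂ (cut (α u))) u q)
    A-deg : ∀ p → A′ p ≡ true → degree-in E₂ p ≡ k
    A-deg p A′p = trans (∑-cong term) (proj₂ (proj₂ (cut p)) A′p)
      where
      term : ∀ u → ι (E₂ u) * ι (h p u) ≡ ι (proj₁ (cut p) u)
      term u with h p u in hp
      ... | true  rewrite sym (α-unique p u (A′⊂A p A′p) hp) = *-identityʳ _
      ... | false with proj₁ (cut p) u in g
      ...   | false = *-zeroʳ (ι (E₂ u))
      ...   | true  = ⊥-elim (true≢false (∧-snd {E u} (proj₁ (proj₂ (cut p)) u g)) hp)

module Step {P m s c a b} (H : Incidence P m s c) (E : Fin m → Bool) (A′ : Fin P → Bool) (st : State H a b E A′) (b≤a : b ≤ a)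
  (T′ : ℕ) (ω : Vec (Fin (suc T′)) (m + P * b)) where
  open Weights H E A′ st b≤a

  x : Fin N → ℕ
  x w = hit (lookup ω w)

  x-sq : ∀ w → x w * x w ≡ x w
  x-sq w with lookup ω w
  ... | zero  = refl
  ... | suc _ = refl

  x-one : ∀ w {k} → x w ≡ suc k → x w ≡ 1
  x-one w e with lookup ω w
  ... | zero = refl

  z : Fin P → ℕ
  z q = ∑ λ w → h⁺ q w * x w

  ★ : Fin m → Fin N
  ★ u = u ↑ˡ (P * b)

  -- For an active `u`, `z q ≤ 1` says that no other coordinate at `q` is active. Dummies count as
  -- well: they may spoil an edge.
  Isolated : Fin m → Set
  Isolated u = E u ≡ true × x (★ u) ≡ 1 × (∀ q → h q u ≡ true → z q ≤ 1)

  Uncovered : (Fin m → Bool) → Fin P → Set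
  Uncovered M p = A′ p ≡ true × ¬ (∃ λ u → M u ≡ true × h p u ≡ true)

  -- A B-vertex met by any active coordinate, dummy or unsuccessful edge included, kills its edges.
  -- This wastes edges, but makes the first-order loss linear in the activations, with a mean that
  -- is known exactly.
  Surviving : (Fin P → Bool) → Fin m → Set
  Surviving A″ u = E u ≡ true × A″ (α u) ≡ true × (∀ q → A q ≡ false → h q u ≡ true → z q ≡ 0)

  private
    isolated? : ∀ u → Dec (Isolated u)
    isolated? u = (E u Bool.≟ true) ×-dec ((x (★ u) ≟ 1) ×-dec Fin.all? λ q → (h q u Bool.≟ true) →-dec (z q ≤? 1))

    uncovered? : ∀ M p → Dec (Uncovered M p)
    uncovered? M p = (A′ p Bool.≟ true) ×-dec ¬? (Fin.any? λ u → (M u Bool.≟ true) ×-dec (h p u Bool.≟ true))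

    surviving? : ∀ A″ u → Dec (Surviving A″ u)
    surviving? A″ u = (E u Bool.≟ true) ×-dec ((A″ (α u) Bool.≟ true) ×-dec Fin.all? λ q → (A q Bool.≟ false) →-dec ((h q u Bool.≟ true) →-dec (z q ≟ 0)))

  abstract
    M₁ : Fin m → Bool
    M₁ u = does (isolated? u)

    M₁⇒ : ∀ u → M₁ u ≡ true → Isolated u
    M₁⇒ u = does⇒ (isolated? u)

    ⇒M₁ : ∀ u → Isolated u → M₁ u ≡ true
    ⇒M₁ u = dec-true (isolated? u)

    A″ : Fin P → Bool
    A″ p = does (uncovered? M₁ p)

    A″⇒ : ∀ p → A″ p ≡ true → Uncovered M₁ p
    A″⇒ p = does⇒ (uncovered? M₁ p)

    ⇒A″ : ∀ p → Uncovered M₁ p → A″ p ≡ true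
    ⇒A″ p = dec-true (uncovered? M₁ p)

    E₁ : Fin m → Bool
    E₁ u = does (surviving? A″ u)

    E₁⇒ : ∀ u → E₁ u ≡ true → Surviving A″ u
    E₁⇒ u = does⇒ (surviving? A″ u)

    ⇒E₁ : ∀ u → Surviving A″ u → E₁ u ≡ true
    ⇒E₁ u = dec-true (surviving? A″ u)

  h⁺-★ : ∀ p u → E u ≡ true → h p u ≡ true → h⁺ p (★ u) ≡ 1
  h⁺-★ p u Eu hp = trans (h⁺-edge p u) (cong₂ (λ a b → ι a * ι b) Eu hp)

  hit-★ : ∀ p u → E u ≡ true → x (★ u) ≡ 1 → h p u ≡ true → h⁺ p (★ u) * x (★ u) ≡ 1
  hit-★ p u Eu xu hp = cong₂ _*_ (h⁺-★ p u Eu hp) xu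

  M₁-disjoint : ∀ p u v → u ≢ v → M₁ u ≡ true → M₁ v ≡ true → h p u ≡ true → h p v ≡ true → ⊥
  M₁-disjoint p u v u≢v Mu Mv hu hv with M₁⇒ u Mu | M₁⇒ v Mv
  ... | Eu , xu , zu | Ev , xv , _ = 1+n≰n (≤-trans (≤-reflexive (sym (cong₂ _+_ (hit-★ p u Eu xu hu) (hit-★ p v Ev xv hv))))
    (≤-trans (≤∑₂ (λ w → h⁺ p w * x w) (u≢v ∘ Fin.↑ˡ-injective (P * b) u v)) (zu p hu)))

  F : Fin P → ℕ
  F p = ∑ λ w → C p w * x w

  Z : Fin P → Fin m → ℕ
  Z p u = ∑ λ q → K p q u * z q

  Z-y : ∀ p u → Z p u ≡ ∑ λ w → y p u w * x w
  Z-y p u = trans (∑-cong λ q → trans (sym (∑-*ˡ (K p q u) (λ w → h⁺ q w * x w))) (∑-cong λ w → sym (*-assoc (K p q u) (h⁺ q w) (x w))))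
    (trans (∑-swap (λ q w → K p q u * h⁺ q w * x w)) (∑-cong λ w → ∑-*ʳ (x w) (λ q → K p q u * h⁺ q w)))

  F-Z : ∀ p → F p ≡ ∑ λ u → e p u * Z p u
  F-Z p = trans (∑-cong λ w → trans (sym (∑-*ʳ (x w) (λ u → e p u * y p u w))) (∑-cong λ u → *-assoc (e p u) (y p u w) (x w)))
    (trans (∑-pull (e p) (λ u w → y p u w * x w)) (∑-cong λ u → cong (e p u *_) (sym (Z-y p u))))

  -- A union bound is enough: an edge that dies at an uncovered `p` has a hit B-vertex, so `Z p u`
  -- is at least `1`.
  survivors-A : ∀ p → A″ p ≡ true → degree-in E p ≤ degree-in E₁ p + F p
  survivors-A p A″p = ≤-trans (∑-mono term) (≤-reflexive (trans (∑-+ (λ u → ι (E₁ u) * ι (h p u)) (λ u → e p u * Z p u)) (cong (degree-in E₁ p +_) (sym (F-Z p)))))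
    where
    Ap : A p ≡ true
    Ap = A′⊂A p (proj₁ (A″⇒ p A″p))
    term : ∀ u → e p u ≤ ι (E₁ u) * ι (h p u) + e p u * Z p u
    term u with Z p u in Zu
    ... | suc k = ≤-trans (≤-trans (≤-reflexive (sym (*-identityʳ (e p u)))) (*-monoʳ-≤ (e p u) (s≤s z≤n))) (m≤n+m _ _)
    ... | zero  with E u in Eu | h p u in hp
    ...   | false | _     = z≤n
    ...   | true  | false = z≤n
    ...   | true  | true  = ≤-trans (≤-reflexive (sym (trans (*-identityʳ _) (cong ι (⇒E₁ u (Eu , subst (λ q → A″ q ≡ true) (α-unique p u Ap hp) A″p , zeros)))))) (m≤m+n _ _)
      where
      zeros : ∀ q → A q ≡ false → h q u ≡ true → z q ≡ 0
      zeros q Bq hq = n≤0⇒n≡0 (≤-trans (≤-reflexive (sym one)) (≤-trans (≤∑ (λ q → K p q u * z q) q) (≤-reflexive Zu)))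
        where
        one : K p q u * z q ≡ z q
        one = trans (cong₂ (λ i j → ι (not i) * ι j * z q) (≢-== {i = q} {p} λ e → true≢false (subst (λ z → A z ≡ true) (sym e) Ap) Bq) hq) (+-identityʳ _)

  conflict : Fin m → ℕ
  conflict u = ∑ λ w → ∑ λ w′ → h⁺ (α u) w * r w w′ * (x w * x w′)

  pairs : Fin P → Fin m → ℕ
  pairs p u = ∑ λ w → ∑ λ w′ → y p u w * (y p u w′ ∸ ι (w == w′)) * (x w * x w′)

  Q : Fin P → ℕ
  Q p = ∑ λ w → ∑ λ w′ → W p w w′ * (x w * x w′)

  -- Since `x^2 = x`, the diagonal contributes `y (y - 1) x`, which makes `pairs p u` equal to
  -- `Z (Z - 1)`.
  Z-pairs : ∀ p u → pairs p u + Z p u ≡ Z p u * Z p u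
  Z-pairs p u = begin-equality
    pairs p u + Z p u ≡⟨ cong (pairs p u +_) (Z-y p u) ⟩
    pairs p u + ∑ t ≡⟨ sym (∑-+ (λ w → ∑ λ w′ → Y w * (Y w′ ∸ ι (w == w′)) * (x w * x w′)) t) ⟩
    ∑ (λ w → ∑ (λ w′ → Y w * (Y w′ ∸ ι (w == w′)) * (x w * x w′)) + t w)
      ≡⟨ ∑-cong (λ w → trans (cong (∑ (λ w′ → Y w * (Y w′ ∸ ι (w == w′)) * (x w * x w′)) +_) (sym (∑-δ w t)))
           (trans (sym (∑-+ (λ w′ → Y w * (Y w′ ∸ ι (w == w′)) * (x w * x w′)) (λ w′ → ι (w == w′) * t w′))) (trans (∑-cong (term w)) (∑-*ˡ (t w) t)))) ⟩
    ∑ (λ w → t w * ∑ t) ≡⟨ ∑-*ʳ (∑ t) t ⟩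
    ∑ t * ∑ t ≡⟨ cong₂ _*_ (sym (Z-y p u)) (sym (Z-y p u)) ⟩
    Z p u * Z p u ∎
    where
    open ≤-Reasoning
    Y : Fin N → ℕ
    Y = y p u
    t : Fin N → ℕ
    t w = Y w * x w
    arr : ∀ a b x y → a * b * (x * y) ≡ a * x * (b * y)
    arr = solve-∀
    square : ∀ n x → x * x ≡ x → n * (n ∸ 1) * (x * x) + (n * x + 0) ≡ n * x * (n * x)
    square zero    x q = refl
    square (suc n) x q = trans (cong₂ (λ i j → suc n * n * i + (suc n * j + 0)) refl (sym q)) (lem n x)
      where
      lem : ∀ n x → suc n * n * (x * x) + (suc n * (x * x) + 0) ≡ suc n * x * (suc n * x)
      lem = solve-∀
    term : ∀ w w′ → Y w * (Y w′ ∸ ι (w == w′)) * (x w * x w′) + ι (w == w′) * t w′ ≡ t w * t w′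
    term w w′ with w Fin.≟ w′
    ... | no  _    = trans (+-identityʳ _) (arr (Y w) (Y w′) (x w) (x w′))
    ... | yes refl = square (Y w) (x w) (x-sq w)

  Q-split : ∀ p → A p ≡ false → Q p ≡ ∑ λ u → e p u * (pairs p u + conflict u)
  Q-split p Bp = trans (∑-cong λ w → trans (∑-cong λ w′ → trans (cong₂ (λ i j → ι (not i) * j * (x w * x w′)) Bp (sym (∑-+ (λ u → e p u * (y p u w * (y p u w′ ∸ ι (w == w′)))) (λ u → e p u * (h⁺ (α u) w * r w w′)))))
      (trans (cong (_* (x w * x w′)) (+-identityʳ (∑ λ u → e p u * (y p u w * (y p u w′ ∸ ι (w == w′))) + e p u * (h⁺ (α u) w * r w w′)))) (trans (sym (∑-*ʳ (x w * x w′) (λ u → e p u * (y p u w * (y p u w′ ∸ ι (w == w′))) + e p u * (h⁺ (α u) w * r w w′))))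
        (∑-cong λ u → arr (e p u) (y p u w * (y p u w′ ∸ ι (w == w′))) (h⁺ (α u) w * r w w′) (x w * x w′)))))
      (∑-pull (e p) (λ u w′ → y p u w * (y p u w′ ∸ ι (w == w′)) * (x w * x w′) + h⁺ (α u) w * r w w′ * (x w * x w′))))
    (trans (∑-pull (e p) (λ u w → ∑ λ w′ → y p u w * (y p u w′ ∸ ι (w == w′)) * (x w * x w′) + h⁺ (α u) w * r w w′ * (x w * x w′)))
      (∑-cong λ u → cong (e p u *_) (trans (∑-cong λ w → ∑-+ (λ w′ → y p u w * (y p u w′ ∸ ι (w == w′)) * (x w * x w′)) (λ w′ → h⁺ (α u) w * r w w′ * (x w * x w′)))
        (∑-+ (λ w → ∑ λ w′ → y p u w * (y p u w′ ∸ ι (w == w′)) * (x w * x w′)) (λ w → ∑ λ w′ → h⁺ (α u) w * r w w′ * (x w * x w′))))))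
    where
    arr : ∀ e a b x → (e * a + e * b) * x ≡ e * (a * x + b * x)
    arr = solve-∀

  -- An active edge f at an uncovered A-vertex is not isolated, so some vertex of f is hit twice.
  conflict-pos : ∀ u → A″ (α u) ≡ true → 1 ≤ z (α u) → 1 ≤ conflict u
  conflict-pos u A″α zα with ∑-pos (λ w → h⁺ (α u) w * x w) zα
  ... | w , q with splitAt m w in sw
  ...   | inj₂ w′ = ⊥-elim (1+n≰n (≤-trans q (≤-reflexive (cong (_* x w) dead))))
    where
    no-dummy : ∀ i → ι i * ι (toℕ (proj₂ (remQuot {P} b w′)) <ᵇ 0) ≡ 0
    no-dummy true  = refl
    no-dummy false = refl
    dead : ι (α u == proj₁ (remQuot {P} b w′)) * ι (toℕ (proj₂ (remQuot {P} b w′)) <ᵇ deficit (α u)) ≡ 0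
    dead = trans (cong (λ d → ι (α u == proj₁ (remQuot {P} b w′)) * ι (toℕ (proj₂ (remQuot {P} b w′)) <ᵇ (ι (not d) * (b ∸ degree-in E (α u))))) (α-A u))
             (no-dummy (α u == proj₁ (remQuot {P} b w′)))
  ...   | inj₁ f with E f in Ef | h (α u) f in hf | x w in xw
  ...     | true | true | suc k = ≤-trans (subst (1 ≤_) (sym conf-w) (≤-trans twice (m≤m*n _ (suc k)))) (≤∑ (λ w → ∑ λ w′ → h⁺ (α u) w * r w w′ * (x w * x w′)) w)
    where
    w≡ : ★ f ≡ w
    w≡ = trans (cong (join m (P * b)) (sym sw)) (Fin.join-splitAt m (P * b) w)
    xw1 : x w ≡ 1
    xw1 = x-one w xw
    not-iso : ¬ (∀ q → h q f ≡ true → z q ≤ 1)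
    not-iso k = proj₂ (A″⇒ (α u) A″α) (f , ⇒M₁ f (Ef , trans (cong x w≡) xw1 , k) , hf)
    R : ℕ
    R = ∑ λ w′ → r w w′ * x w′
    conf-w : ∑ (λ w′ → h⁺ (α u) w * r w w′ * (x w * x w′)) ≡ R * suc k
    conf-w = trans (∑-cong λ w′ → trans (cong (λ i → i * r w w′ * (x w * x w′)) (trans (cong (h⁺ (α u)) (sym w≡)) (h⁺-★ (α u) f Ef hf))) (arr (r w w′) (x w) (x w′)))
      (trans (∑-*ʳ (x w) (λ w′ → r w w′ * x w′)) (cong (R *_) xw))
      where
      arr : ∀ r x y → 1 * r * (x * y) ≡ r * y * x
      arr = solve-∀
    twice : 1 ≤ R
    twice with Fin.¬∀⟶∃¬ P (λ q → h q f ≡ true → z q ≤ 1) (λ q → (h q f Bool.≟ true) →-dec (z q ≤? 1)) not-iso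
    ... | q , bad with h q f in hq
    ...   | false = ⊥-elim (bad λ ())
    ...   | true  = ≤-trans (+-cancelʳ-≤ 1 1 _ (begin
        2 ≤⟨ ≰⇒> (λ z≤1 → bad λ _ → z≤1) ⟩
        z q ≡⟨ sym (∑-ι* w (λ w′ → h⁺ q w′ * x w′)) ⟩
        ∑ (λ w′ → ι (not (w′ == w)) * (h⁺ q w′ * x w′)) + h⁺ q w * x w ≡⟨ cong (∑ (λ w′ → ι (not (w′ == w)) * (h⁺ q w′ * x w′)) +_) (trans (cong (h⁺ q w *_) xw1) (trans (*-identityʳ _) h1)) ⟩
        ∑ (λ w′ → ι (not (w′ == w)) * (h⁺ q w′ * x w′)) + 1 ∎)) (∑-mono term)
      where
      open ≤-Reasoning
      h1 : h⁺ q w ≡ 1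
      h1 = trans (cong (h⁺ q) (sym w≡)) (h⁺-★ q f Ef hq)
      term : ∀ w′ → ι (not (w′ == w)) * (h⁺ q w′ * x w′) ≤ r w w′ * x w′
      term w′ = begin
        ι (not (w′ == w)) * (h⁺ q w′ * x w′) ≡⟨ cong (λ i → ι (not i) * (h⁺ q w′ * x w′)) (==-sym w′ w) ⟩
        ι (not (w == w′)) * (h⁺ q w′ * x w′) ≡⟨ sym (*-assoc (ι (not (w == w′))) (h⁺ q w′) (x w′)) ⟩
        ι (not (w == w′)) * h⁺ q w′ * x w′ ≤⟨ *-monoˡ-≤ (x w′) (*-monoʳ-≤ (ι (not (w == w′))) (≤-trans (≤-reflexive (sym (trans (cong (_* h⁺ q w′) h1) (+-identityʳ _)))) (≤∑ (λ q → h⁺ q w * h⁺ q w′) q))) ⟩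
        r w w′ * x w′ ∎
  conflict-pos u A″α zα | w , () | inj₁ f | true  | true  | zero
  conflict-pos u A″α zα | w , () | inj₁ f | true  | false | _
  conflict-pos u A″α zα | w , () | inj₁ f | false | _     | _

  survivors-B : ∀ p → A p ≡ false → degree-in E₁ p + F p ≤ degree-in E p + Q p
  survivors-B p Bp = ≤-trans (≤-reflexive (trans (cong (degree-in E₁ p +_) (F-Z p)) (sym (∑-+ (λ u → ι (E₁ u) * ι (h p u)) (λ u → e p u * Z p u)))))
    (≤-trans (∑-mono term) (≤-reflexive (trans (∑-+ (e p) (λ u → e p u * (pairs p u + conflict u))) (cong (degree-in E p +_) (sym (Q-split p Bp))))))
    where
    -- 1[u survives] ≤ 1 − Z + Z (Z − 1) + conflict u; the conflict term is needed only when Z = 1.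
    bonferroni : ∀ u ζ S → E₁ u ≡ true → Z p u ≡ ζ → S + ζ ≡ ζ * ζ → 1 + ζ ≤ 1 + (S + conflict u)
    bonferroni u zero          S E₁u Z≡ S≡ = s≤s z≤n
    bonferroni u (suc (suc k)) S E₁u Z≡ S≡ = s≤s (≤-trans (+-cancelʳ-≤ (2 + k) _ _ (≤-trans (≤-trans (≤-reflexive (sym (cong ((2 + k) +_) (+-identityʳ _)))) (*-monoˡ-≤ (2 + k) (s≤s (s≤s (z≤n {k}))))) (≤-reflexive (sym S≡)))) (m≤m+n S _))
    -- A surviving edge has no hit B-vertex other than possibly `p`, and its B-vertices are in fact
    -- all unhit, so the single hit away from `p` is at its A-vertex. That vertex is uncovered
    -- because the edge survives, and `conflict-pos` pays for it.
    bonferroni u (suc zero)    S E₁u Z≡ S≡ = s≤s (≤-trans (conflict-pos u A″α zα) (m≤n+m _ S))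
      where
      surv = E₁⇒ u E₁u
      A″α : A″ (α u) ≡ true
      A″α = proj₁ (proj₂ surv)
      zα : 1 ≤ z (α u)
      zα with ∑-pos (λ q → K p q u * z q) (≤-reflexive (sym Z≡))
      ... | q , k with q == p | h q u in hq
      ...   | true  | _     = ⊥-elim (1+n≰n k)
      ...   | false | false = ⊥-elim (1+n≰n k)
      ...   | false | true  with A q in Aq
      ...     | true  = subst (λ i → 1 ≤ z i) (α-unique q u Aq hq) (≤-trans k (≤-reflexive (+-identityʳ _)))
      ...     | false = ⊥-elim (1+n≰n (≤-trans k (≤-reflexive (trans (+-identityʳ _) (proj₂ (proj₂ surv) q Aq hq)))))
    term : ∀ u → ι (E₁ u) * ι (h p u) + e p u * Z p u ≤ e p u + e p u * (pairs p u + conflict u)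
    term u with E₁ u in E₁u
    ... | true rewrite proj₁ (E₁⇒ u E₁u) with h p u
    ...   | false = z≤n
    ...   | true  = ≤-trans (≤-reflexive (cong suc (+-identityʳ _))) (≤-trans (bonferroni u (Z p u) (pairs p u) E₁u refl (Z-pairs p u)) (≤-reflexive (cong suc (sym (+-identityʳ _)))))
    term u | false = ≤-trans (*-monoʳ-≤ (e p u) (lem (Z p u) (pairs p u) (Z-pairs p u))) (≤-trans (≤-reflexive (*-distribˡ-+ (e p u) 1 _)) (+-mono-≤ (≤-reflexive (*-identityʳ (e p u))) (*-monoʳ-≤ (e p u) (m≤m+n (pairs p u) (conflict u)))))
      where
      lem : ∀ ζ S → S + ζ ≡ ζ * ζ → ζ ≤ 1 + S
      lem zero          S e = z≤n
      lem (suc zero)    S e = s≤s z≤n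
      lem (suc (suc k)) S e = ≤-trans (+-cancelʳ-≤ (2 + k) _ _ (≤-trans (≤-trans (≤-reflexive (sym (cong ((2 + k) +_) (+-identityʳ _)))) (*-monoˡ-≤ (2 + k) (s≤s (s≤s (z≤n {k}))))) (≤-reflexive (sym e)))) (n≤1+n S)

  step : ∀ a₂ b₂ → (∀ p → A′ p ≡ true → a₂ + F p ≤ a) → (∀ p → A p ≡ false → degree-in E p + Q p ≤ b₂ + F p) →
    (∀ E₂ A₂ → State H a₂ b₂ E₂ A₂ → Matching H E₂ A₂) → Matching H E A′
  step a₂ b₂ hA hB continue with trim-state H {a₂} {b₂} {E₁} {A″} (λ p q → A′⊂A p (proj₁ (A″⇒ p q))) (λ u q → proj₁ (proj₂ (E₁⇒ u q)))
    (λ p A″p → +-cancelʳ-≤ (F p) _ _ (≤-trans (hA p (proj₁ (A″⇒ p A″p))) (≤-trans (≤-reflexive (sym (A-deg p (proj₁ (A″⇒ p A″p))))) (survivors-A p A″p))))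
    (λ p Bp → +-cancelʳ-≤ (F p) _ _ (≤-trans (survivors-B p Bp) (hB p Bp)))
  ... | E₂ , E₂⊂E₁ , st₂ with continue E₂ A″ st₂
  ...   | M₂ = record { M = λ u → M₁ u ∨ Matching.M M₂ u ; M⊂E = sub ; disjoint = disj ; covers = cov }
    where
    S₂ : ∀ u → Matching.M M₂ u ≡ true → Surviving A″ u
    S₂ u q = E₁⇒ u (E₂⊂E₁ u (Matching.M⊂E M₂ u q))
    sub : ∀ u → (M₁ u ∨ Matching.M M₂ u) ≡ true → E u ≡ true
    sub u q with M₁ u in M₁u
    ... | true  = proj₁ (M₁⇒ u M₁u)
    ... | false = proj₁ (S₂ u q)
    mixed : ∀ p u v → M₁ u ≡ true → Matching.M M₂ v ≡ true → h p u ≡ true → h p v ≡ true → ⊥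
    mixed p u v Mu Mv hu hv with M₁⇒ u Mu | S₂ v Mv | A p in Ap
    ... | Eu , xu , _ | _ , A″α , zeros | false = 1+n≰n (≤-trans (≤-reflexive (sym (hit-★ p u Eu xu hu))) (≤-trans (≤∑ (λ w → h⁺ p w * x w) (★ u)) (≤-reflexive (zeros p Ap hv))))
    ... | Eu , xu , _ | _ , A″α , zeros | true  = proj₂ (A″⇒ (α v) A″α) (u , Mu , subst (λ i → h i u ≡ true) (α-unique p v Ap hv) hu)
    disj : ∀ p u v → u ≢ v → (M₁ u ∨ Matching.M M₂ u) ≡ true → (M₁ v ∨ Matching.M M₂ v) ≡ true → h p u ≡ true → h p v ≡ true → ⊥
    disj p u v u≢v qu qv hu hv with M₁ u in Mu | M₁ v in Mv
    ... | true  | true  = M₁-disjoint p u v u≢v Mu Mv hu hv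
    ... | true  | false = mixed p u v Mu qv hu hv
    ... | false | true  = mixed p v u Mv qu hv hu
    ... | false | false = Matching.disjoint M₂ p u v u≢v qu qv hu hv
    cov : ∀ p → A′ p ≡ true → ∃ λ u → (M₁ u ∨ Matching.M M₂ u) ≡ true × h p u ≡ true
    cov p A′p with Fin.any? (λ u → (M₁ u Bool.≟ true) ×-dec (h p u Bool.≟ true))
    ... | yes (u , Mu , hu) = u , cong (_∨ Matching.M M₂ u) Mu , hu
    ... | no ¬cov with Matching.covers M₂ p (⇒A″ p (A′p , ¬cov))
    ...   | u , Mu , hu = u , trans (cong (M₁ u ∨_) Mu) (Bool.∨-zeroʳ (M₁ u)) , hu

-- Existence of an outcome that is good at every vertex

private
  abs-bounds : ∀ g F S V → g ℤ.+ ℤ.+ S ≡ ℤ.+ F → ℤ.∣ g ∣ < V → (F < S + V) × (S < F + V)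
  abs-bounds (ℤ.+ n)    F S V e p = ≤-trans (s≤s (≤-reflexive (sym (ℤ.+-injective e)))) (≤-trans (≤-reflexive (cong suc (+-comm n S))) (≤-trans (≤-reflexive (sym (+-suc S n))) (+-monoʳ-≤ S p)))
                                , ≤-<-trans (≤-trans (m≤n+m S n) (≤-reflexive (ℤ.+-injective e))) (m<m+n F (≤-trans (s≤s z≤n) p))
  abs-bounds ℤ.-[1+ n ] F S V e p = ≤-<-trans (≤-trans (m≤m+n F (suc n)) (≤-reflexive (sym S≡))) (m<m+n S (≤-trans (s≤s z≤n) p))
                                , ≤-trans (s≤s (≤-reflexive S≡)) (≤-trans (≤-reflexive (sym (+-suc F (suc n)))) (+-monoʳ-≤ F p))
    where
    S≡ : S ≡ F + suc n
    S≡ = ℤ.+-injective (trans (lem (ℤ.+ S) (ℤ.+ suc n)) (trans (cong (λ z → z ℤ.+ ℤ.+ suc n) e) (sym (ℤ.pos-+ F (suc n)))))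
      where
      lem : ∀ S n → S ≡ ℤ.- n ℤ.+ S ℤ.+ n
      lem = ℤ.solve-∀

module Nibble {P m s c a b} (H : Incidence P m s c) (E : Fin m → Bool) (A′ : Fin P → Bool) (st : State H a b E A′) (b≤a : b ≤ a)
  (T′ k Λ Y t B : ℕ) (Λ>0 : 1 ≤ Λ) (Y>0 : 1 ≤ Y) (B>0 : 1 ≤ B) where
  open Weights H E A′ st b≤a
  open CentredMoment T′ k Λ Λ>0 using (centred; centred-≡; centred-tail)
  open QuadraticMoment T′ using (quadratic; quadratic-tail)

  private
    T : ℕ
    T = suc T′

  -- The bound on coordinates per vertex times the bound on vertices per coordinate; the successor
  -- makes it visibly positive, as the Local Lemma asks.
  degeneracy : ℕ
  degeneracy = suc ((a * M + (m₀ + m₀)) * (r₁ * M + (2 * (r₁ * M * M) + (r₁ * M * M + r₁ * M * M))))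

  module _ (n₁ : 3 * ((c * r₁ * T) * (c * r₁ * T)) ≤ Λ) (n₂ : 2 * ((k + κ k) * (c * r₁ * (a * M)) * T) ≤ Λ) (n₃ : Λ * Y ≤ (T * t) * (T * t))
    (n₄ : m₀ + T * md + 2 * T * (2 * k) * m₁ + T * T * (2 * k + 2 * k * (2 * k)) * m₂ ≤ B) (n₄′ : B * Y ≤ T * T * t)
    (n₅ : 12 * degeneracy ≤ Y ^ k) where

    private
      bad₁ bad₂ bad : Fin P → Vec (Fin T) N → Bool
      bad₁ p ω = does (T * t ≤? ℤ.∣ centred (C p) ω ∣)
      bad₂ p ω = does (t ≤? quadratic (W p) ω)
      bad  p ω = bad₁ p ω ∨ bad₂ p ω

      ∨-false : ∀ {x y} → x ∨ y ≡ false → (x ≡ false) × (y ≡ false)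
      ∨-false {false} e = refl , e

      bad-rare : ∀ p → Y ^ k * total (ι ∘ bad p) ≤ 3 * T ^ N
      bad-rare p = begin
        Y ^ k * total (ι ∘ bad p) ≤⟨ *-monoʳ-≤ (Y ^ k) (total-mono λ ω → ι-∨ (bad₁ p ω) (bad₂ p ω)) ⟩
        Y ^ k * total (λ ω → ι (bad₁ p ω) + ι (bad₂ p ω)) ≡⟨ trans (cong (Y ^ k *_) (total-+ (ι ∘ bad₁ p) (ι ∘ bad₂ p))) (*-distribˡ-+ (Y ^ k) _ _) ⟩
        Y ^ k * total (ι ∘ bad₁ p) + Y ^ k * total (ι ∘ bad₂ p) ≤⟨ +-mono-≤
           (centred-tail (C p) (λ w → ≤-trans (*-monoʳ-≤ 3 (*-mono-≤ (*-monoˡ-≤ T (C≤ p w)) (*-monoˡ-≤ T (C≤ p w)))) n₁)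
             (≤-trans (*-monoʳ-≤ 2 variance) n₂) Y (T * t) n₃ (bad₁ p) (λ ω → does⇒ (T * t ≤? ℤ.∣ centred (C p) ω ∣)))
           (quadratic-tail (W p) m₀ md m₁ m₂ (W-total p) (W-diagonal p) (W-row≤ p) (W-column≤ p) (W-entry p) k B Y t B>0 n₄ n₄′ (bad₂ p) (λ ω → does⇒ (t ≤? quadratic (W p) ω))) ⟩
        2 * T ^ N + T ^ N ≡⟨ +-comm (2 * T ^ N) (T ^ N) ⟩
        3 * T ^ N ∎
        where
        open ≤-Reasoning
        ι-∨ : ∀ x y → ι (x ∨ y) ≤ ι x + ι y
        ι-∨ true  y = s≤s z≤n
        ι-∨ false y = ≤-refl
        variance : ∑ (λ w → (k + κ k) * (C p w * C p w) * T) ≤ (k + κ k) * (c * r₁ * (a * M)) * T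
        variance = begin
          ∑ (λ w → (k + κ k) * (C p w * C p w) * T) ≡⟨ trans (∑-*ʳ T (λ w → (k + κ k) * (C p w * C p w))) (cong (_* T) (∑-*ˡ (k + κ k) (λ w → C p w * C p w))) ⟩
          (k + κ k) * ∑ (λ w → C p w * C p w) * T ≤⟨ *-monoˡ-≤ T (*-monoʳ-≤ (k + κ k) (≤-trans (∑-*≤ (C p) (C p) (C≤ p)) (≤-trans (≤-reflexive (*-comm _ (c * r₁))) (*-monoʳ-≤ (c * r₁) (∑C≤ p))))) ⟩
          (k + κ k) * (c * r₁ * (a * M)) * T ∎

      dep : Fin P → Fin N → Bool
      dep p w = does (1 ≤? influence p w)

      nb : Fin P → Fin P → Bool
      nb p q = does (1 ≤? ∑ λ w → influence p w * influence q w)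

      outside : ∀ {p ω ω′} → (∀ w → dep p w ≡ true → lookup ω w ≡ lookup ω′ w) → ∀ w x → x ≤ influence p w → 1 ≤ x → lookup {A = Fin T} ω w ≡ lookup ω′ w
      outside {p} h w x x≤ 1≤x = h w (dec-true (1 ≤? influence p w) (≤-trans 1≤x x≤))

      centred-dep : ∀ {n} (C : Fin n → ℕ) (ω ω′ : Vec (Fin T) n) → (∀ w → 1 ≤ C w → lookup ω w ≡ lookup ω′ w) → centred C ω ≡ centred C ω′
      centred-dep C []      []        h = refl
      centred-dep C (t ∷ ω) (t′ ∷ ω′) h with C zero in e
      ... | zero  = cong (λ z → ℤ.0ℤ ℤ.+ z) (centred-dep (C ∘ suc) ω ω′ (h ∘ suc))
      ... | suc n = cong₂ (λ i z → ℤ.+ suc n ℤ.* (ℤ.+ T ℤ.* ℤ.+ hit i ℤ.- ℤ.1ℤ) ℤ.+ z) (h zero (≤-trans (s≤s z≤n) (≤-reflexive (sym e)))) (centred-dep (C ∘ suc) ω ω′ (h ∘ suc))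

      quadratic-dep : ∀ p {ω ω′} → (∀ w → dep p w ≡ true → lookup ω w ≡ lookup ω′ w) → quadratic (W p) ω ≡ quadratic (W p) ω′
      quadratic-dep p {ω} {ω′} h = ∑-cong λ w → ∑-cong λ w′ → entry w w′
        where
        entry : ∀ w w′ → W p w w′ * (hit (lookup ω w) * hit (lookup ω w′)) ≡ W p w w′ * (hit (lookup ω′ w) * hit (lookup ω′ w′))
        entry w w′ with W p w w′ in e
        ... | zero  = refl
        ... | suc n = cong₂ (λ i j → suc n * (hit i * hit j))
          (outside {p} {ω} {ω′} h w (∑ (W p w)) (≤-trans (m≤m+n _ _) (m≤n+m _ (C p w))) (≤-trans (≤-trans (s≤s z≤n) (≤-reflexive (sym e))) (≤∑ (W p w) w′)))
          (outside {p} {ω} {ω′} h w′ (∑ (λ w → W p w w′)) (≤-trans (m≤n+m _ (∑ (W p w′))) (m≤n+m _ (C p w′))) (≤-trans (≤-trans (s≤s z≤n) (≤-reflexive (sym e))) (≤∑ (λ w → W p w w′) w)))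

      bad-dep : ∀ p → DependsOn (dep p) (bad p)
      bad-dep p ω ω′ h = cong₂ _∨_ (cong (λ g → does (T * t ≤? ℤ.∣ g ∣)) (centred-dep (C p) ω ω′ λ w → outside {p} {ω} {ω′} h w (C p w) (m≤m+n _ _)))
                                   (cong (λ q → does (t ≤? q)) (quadratic-dep p {ω} {ω′} h))

      nb-dep : ∀ p q → nb p q ≡ false → ∀ w → dep p w ≡ true → dep q w ≡ true → ⊥
      nb-dep p q e w dp dq = does-false (1 ≤? ∑ λ w → influence p w * influence q w) e
        (≤-trans (*-mono-≤ (does⇒ (1 ≤? influence p w) dp) (does⇒ (1 ≤? influence q w) dq)) (≤∑ (λ w → influence p w * influence q w) w))

      few : ∀ p → ∑ (λ q → ι (nb p q)) ≤ degeneracy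
      few p = begin
        ∑ (λ q → ι (nb p q)) ≤⟨ ∑-mono (λ q → ι-does (1 ≤? ∑ λ w → influence p w * influence q w)) ⟩
        ∑ (λ q → ∑ λ w → influence p w * influence q w) ≡⟨ ∑-pull (influence p) (λ w q → influence q w) ⟩
        ∑ (λ w → influence p w * ∑ (λ q → influence q w)) ≤⟨ ∑-*≤ (influence p) _ influence-column ⟩
        ∑ (influence p) * _ ≤⟨ *-monoˡ-≤ _ (influence-row p) ⟩
        _ ≤⟨ n≤1+n _ ⟩
        degeneracy ∎
        where open ≤-Reasoning

      -- The `12` in `n₅` is the `4` of the Local Lemma times the `3` of `bad-rare`: `2` from the
      -- linear tail and `1` from the quadratic one.
      small : ∀ p → 4 * degeneracy * total (ι ∘ bad p) ≤ T ^ N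
      small p = *-cancelˡ-≤ (Y ^ k) ⦃ m^n≢0 Y k ⦃ >-nonZero Y>0 ⦄ ⦄ (begin
        Y ^ k * (4 * degeneracy * total (ι ∘ bad p)) ≡⟨ arr (Y ^ k) (4 * degeneracy) _ ⟩
        4 * degeneracy * (Y ^ k * total (ι ∘ bad p)) ≤⟨ *-monoʳ-≤ (4 * degeneracy) (bad-rare p) ⟩
        4 * degeneracy * (3 * T ^ N) ≡⟨ arr₂ degeneracy (T ^ N) ⟩
        12 * degeneracy * T ^ N ≤⟨ *-monoˡ-≤ (T ^ N) n₅ ⟩
        Y ^ k * T ^ N ∎)
        where
        open ≤-Reasoning
        arr : ∀ a b c → a * (b * c) ≡ b * (a * c)
        arr = solve-∀
        arr₂ : ∀ d n → 4 * d * (3 * n) ≡ 12 * d * n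
        arr₂ = solve-∀

      outcome : ∃ λ ω → ∀ p → bad p ω ≡ false
      outcome = LLL.avoid-all bad dep nb degeneracy (s≤s z≤n) (s≤s z≤n) bad-dep nb-dep small few

    -- The mean loss is at most `μ + 1` at an A-vertex and at least `ν` at a B-vertex of degree `b`.
    -- A B-vertex of degree `d < b` may lose less, but `a + s * b ≤ T` makes `d` minus its mean loss
    -- increasing in `d`, so full degree is the worst case.
    nibble : ∀ a₂ b₂ μ ν → a * (s * b) ≤ T * suc μ → a₂ + (μ + t) ≤ a → T * ν + b * b ≤ b * (a + s * b) → a + s * b ≤ T → b + 2 * t ≤ b₂ + ν →
      (∀ E₂ A₂ → State H a₂ b₂ E₂ A₂ → Matching H E₂ A₂) → Matching H E A′
    nibble a₂ b₂ μ ν hμ ha₂ hν hT hb₂ = Step.step H E A′ st b≤a T′ ω a₂ b₂ hA hB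
      where
      open ≤-Reasoning
      ω = proj₁ outcome
      open Step H E A′ st b≤a T′ ω using (F; Q)
      F-bounds : ∀ p → (T * F p < ∑ (C p) + T * t) × (∑ (C p) < T * F p + T * t)
      F-bounds p = abs-bounds (centred (C p) ω) (T * F p) (∑ (C p)) (T * t) (centred-≡ (C p) ω)
        (≰⇒> (does-false (T * t ≤? ℤ.∣ centred (C p) ω ∣) (proj₁ (∨-false (proj₂ outcome p)))))
      Q-bound : ∀ p → Q p < t
      Q-bound p = ≰⇒> (does-false (t ≤? Q p) (proj₂ (∨-false {bad₁ p ω} (proj₂ outcome p))))
      hA : ∀ p → A′ p ≡ true → a₂ + F p ≤ a
      -- Strictness rounds for free: `T * F p` is below `T * suc (μ + t)`, so the integer `F p` is
      -- at most `μ + t` although the mean loss may exceed `μ`.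
      hA p A′p = ≤-trans (+-monoʳ-≤ a₂ (s≤s⁻¹ (*-cancelˡ-< T _ _ (begin-strict
        T * F p <⟨ proj₁ (F-bounds p) ⟩
        ∑ (C p) + T * t ≡⟨ cong (_+ T * t) ∑C≡ ⟩
        a * (s * b) + T * t ≤⟨ +-monoˡ-≤ (T * t) hμ ⟩
        T * suc μ + T * t ≡⟨ sym (*-distribˡ-+ T (suc μ) t) ⟩
        T * suc (μ + t) ∎)))) ha₂
        where
        ∑C≡ : ∑ (C p) ≡ a * (s * b)
        ∑C≡ = +-cancelʳ-≡ (a * a) _ _ (trans (subst₂ (λ d r → ∑ (C p) + d * r ≡ d * (a + s * b)) (A-deg p A′p) (ρ-A′ p A′p) (∑C-exact p)) (trans (*-distribˡ-+ a a (s * b)) (+-comm (a * a) _)))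
      hB : ∀ p → A p ≡ false → degree-in E p + Q p ≤ b₂ + F p
      hB p Bp = +-cancelʳ-≤ ν _ _ (begin
        d + Q p + ν ≡⟨ arr₁ d (Q p) ν ⟩
        d + ν + Q p ≤⟨ +-mono-≤ d+ν (<⇒≤ (Q-bound p)) ⟩
        b + F p + t + t ≡⟨ arr₂ b (F p) t ⟩
        b + 2 * t + F p ≤⟨ +-monoˡ-≤ (F p) hb₂ ⟩
        b₂ + ν + F p ≡⟨ arr₁ b₂ ν (F p) ⟩
        b₂ + F p + ν ∎)
        where
        d : ℕ
        d = degree-in E p
        arr₁ : ∀ a b c → a + b + c ≡ a + c + b
        arr₁ = solve-∀
        arr₂ : ∀ b f t → b + f + t + t ≡ b + 2 * t + f
        arr₂ = solve-∀
        ∑C≡ : ∑ (C p) + d * b ≡ d * (a + s * b)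
        ∑C≡ = subst (λ r → ∑ (C p) + d * r ≡ d * (a + s * b)) (ρ-B p Bp) (∑C-exact p)
        -- (T − (a + s b)) (b − d) ≥ 0, with e = b − d and f = T − (a + s b), moved around to avoid subtraction.
        rearrange : ∀ d e g f ν S → S + d * (d + e) ≡ d * g → (g + f) * ν + (d + e) * (d + e) ≤ (d + e) * g → (g + f) * (d + ν) ≤ (g + f) * (d + e) + S
        rearrange d e g f ν S h₁ h₂ = +-cancelʳ-≤ ((d + e) * (d + e) + d * (d + e)) _ _ (begin
          (g + f) * (d + ν) + ((d + e) * (d + e) + d * (d + e)) ≡⟨ l₁ d e g f ν ⟩
          ((g + f) * ν + (d + e) * (d + e)) + ((g + f) * d + d * (d + e)) ≤⟨ +-monoˡ-≤ _ h₂ ⟩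
          (d + e) * g + ((g + f) * d + d * (d + e)) ≤⟨ m≤m+n _ (f * e + e * (d + e)) ⟩
          (d + e) * g + ((g + f) * d + d * (d + e)) + (f * e + e * (d + e)) ≡⟨ l₂ d e g f ⟩
          (g + f) * (d + e) + d * g + (d + e) * (d + e) ≡⟨ cong (λ z → (g + f) * (d + e) + z + (d + e) * (d + e)) (sym h₁) ⟩
          (g + f) * (d + e) + (S + d * (d + e)) + (d + e) * (d + e) ≡⟨ l₃ ((g + f) * (d + e)) S (d * (d + e)) ((d + e) * (d + e)) ⟩
          (g + f) * (d + e) + S + ((d + e) * (d + e) + d * (d + e)) ∎)
          where
          l₁ : ∀ d e g f ν → (g + f) * (d + ν) + ((d + e) * (d + e) + d * (d + e)) ≡ ((g + f) * ν + (d + e) * (d + e)) + ((g + f) * d + d * (d + e))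
          l₁ = solve-∀
          l₂ : ∀ d e g f → (d + e) * g + ((g + f) * d + d * (d + e)) + (f * e + e * (d + e)) ≡ (g + f) * (d + e) + d * g + (d + e) * (d + e)
          l₂ = solve-∀
          l₃ : ∀ a b c d → a + (b + c) + d ≡ a + b + (d + c)
          l₃ = solve-∀
        d+ν : d + ν ≤ b + F p + t
        d+ν = <⇒≤ (*-cancelˡ-< T _ _ (begin-strict
          T * (d + ν) ≤⟨ subst₂ (λ β τ → ∑ (C p) + d * β ≡ d * (a + s * b) → τ * ν + β * β ≤ β * (a + s * b) → τ * (d + ν) ≤ τ * β + ∑ (C p))
                                       (m+[n∸m]≡n (B-deg p Bp)) (m+[n∸m]≡n hT) (rearrange d (b ∸ d) (a + s * b) (T ∸ (a + s * b)) ν (∑ (C p))) ∑C≡ hν ⟩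
          T * b + ∑ (C p) <⟨ +-monoʳ-< (T * b) (proj₂ (F-bounds p)) ⟩
          T * b + (T * F p + T * t) ≡⟨ l T b (F p) t ⟩
          T * (b + F p + t) ∎))
          where
          l : ∀ T b f t → T * b + (T * f + T * t) ≡ T * (b + f + t)
          l = solve-∀

-- Finishing: once a ≥ 16 s b, independent uniform choices of edges succeed by the Local Lemma

enumerate : ∀ {m} (f : Fin m → Bool) → Σ (Fin (∑ (ι ∘ f)) → Fin m) λ g → (∀ j → f (g j) ≡ true) × (∀ i j → g i ≡ g j → i ≡ j)
enumerate {zero}  f = (λ ()) , (λ ()) , λ ()
enumerate {suc m} f with f zero in f0 | enumerate (f ∘ suc)
... | false | g , s , inj = suc ∘ g , s , λ i j e → inj i j (Fin.suc-injective e)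
... | true  | g , s , inj = g′ , s′ , inj′
  where
  g′ : Fin (suc (∑ (ι ∘ f ∘ suc))) → Fin (suc m)
  g′ zero    = zero
  g′ (suc j) = suc (g j)
  s′ : ∀ j → f (g′ j) ≡ true
  s′ zero    = f0
  s′ (suc j) = s j
  inj′ : ∀ i j → g′ i ≡ g′ j → i ≡ j
  inj′ zero    zero    e = refl
  inj′ (suc i) (suc j) e = cong suc (inj i j (Fin.suc-injective e))

total-lookup : ∀ {T N} (u : Fin N) (g : Fin T → ℕ) → T * total (λ ω → g (lookup ω u)) ≡ T ^ N * ∑ g
total-lookup {T} {suc N} zero    g = trans (cong (T *_) (trans (∑-cong λ t → total-const {T} N (g t)) (∑-*ˡ (T ^ N) g))) (sym (*-assoc T (T ^ N) (∑ g)))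
total-lookup {T} {suc N} (suc u) g = trans (cong (T *_) (trans (∑-const T _) (total-lookup u g))) (sym (*-assoc T (T ^ N) (∑ g)))

∑-injective≤1 : ∀ {n m} (g : Fin n → Fin m) → (∀ i j → g i ≡ g j → i ≡ j) → ∀ u → ∑ (λ j → ι (u == g j)) ≤ 1
∑-injective≤1 {zero}  g inj u = z≤n
∑-injective≤1 {suc n} g inj u with u Fin.≟ g zero
... | no  _ = ∑-injective≤1 (g ∘ suc) (λ i j e → Fin.suc-injective (inj (suc i) (suc j) e)) u
... | yes e = s≤s (≤-reflexive (∑-zero λ j → cong ι (≢-== λ e′ → Fin.0≢1+n (inj zero (suc j) (trans (sym e) e′)))))

module Finish {P m s c a b} (H : Incidence P m s c) (E : Fin m → Bool) (A′ : Fin P → Bool) (st : State H a b E A′)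
  (s>0 : 1 ≤ s) (a>0 : 1 ≤ a) (b>0 : 1 ≤ b) (wide : 16 * (s * b) ≤ a) where
  open Incidence H
  open State st

  private
    -- How a letter at coordinate `p` is read as a choice of an edge. Vertices outside `A′` select
    -- nothing, so that all vertices share one alphabet.
    record Selection (p : Fin P) : Set where
      field
        selects  : Fin m → Fin a → Bool
        sound    : ∀ u j → selects u j ≡ true → E u ≡ true × h p u ≡ true
        unique   : ∀ u v j → selects u j ≡ true → selects v j ≡ true → u ≡ v
        ≤once    : ∀ u → ∑ (λ j → ι (selects u j)) ≤ 1
        nonempty : A′ p ≡ true → ∀ j → ∃ λ u → selects u j ≡ true

    selection : ∀ p → Selection p
    selection p with A′ p in A′p
    ... | false = record { selects = λ _ _ → false ; sound = λ _ _ () ; unique = λ _ _ _ () ; ≤once = λ u → ≤-trans (≤-reflexive (∑-zero {a} λ _ → refl)) z≤n ; nonempty = λ e → ⊥-elim (true≢false e A′p) }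
    ... | true  with enumerate (λ u → E u ∧ h p u) | trans (∑-cong λ u → ι-∧ (E u) (h p u)) (A-deg p A′p)
    ...   | en | e = go _ e en
      where
      go : ∀ k → k ≡ a → Σ (Fin k → Fin m) (λ g → (∀ j → (E (g j) ∧ h p (g j)) ≡ true) × (∀ i j → g i ≡ g j → i ≡ j)) → Selection p
      go k refl (g , s , inj) = record
        { selects  = λ u j → u == g j
        ; sound    = λ u j e → subst (λ v → E v ≡ true × h p v ≡ true) (sym (==-true {i = u} e)) (∧-fst (s j) , ∧-snd {E (g j)} (s j))
        ; unique   = λ u v j e₁ e₂ → trans (==-true {i = u} e₁) (sym (==-true {i = v} e₂))
        ; ≤once    = ∑-injective≤1 g inj
        ; nonempty = λ _ j → g j , ==-refl (g j) }

    pick : Fin m → Vec (Fin a) P → Bool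
    pick u ω = Selection.selects (selection (α u)) u (lookup ω (α u))

    common : Fin m → Fin m → ℕ
    common u v = ∑ λ q → ι (not (A q)) * ι (h q u) * ι (h q v)

    -- Edges at different A-vertices can meet only in B, and two edges at one A-vertex are never
    -- both picked, so these pairs are the only obstructions.
    clash : Fin m → Fin m → Bool
    clash u v = (E u ∧ E v) ∧ (not (α u == α v) ∧ does (1 ≤? common u v))

    clash≤ : ∀ u v → ι (clash u v) ≤ ι (E u) * (ι (E v) * common u v)
    clash≤ u v with E u | E v
    ... | false | _     = z≤n
    ... | true  | false = z≤n
    ... | true  | true  with not (α u == α v)
    ...   | false = z≤n
    ...   | true  = ≤-trans (ι-does (1 ≤? common u v)) (≤-reflexive (sym (trans (+-identityʳ _) (+-identityʳ _))))

    clash-sym : ∀ u v → clash u v ≡ clash v u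
    clash-sym u v = cong₂ _∧_ (Bool.∧-comm (E u) (E v)) (cong₂ (λ x y → not x ∧ does (1 ≤? y)) (==-sym (α u) (α v)) (∑-cong λ q → arr (ι (not (A q))) (ι (h q u)) (ι (h q v))))
      where
      arr : ∀ a b c → a * b * c ≡ a * c * b
      arr = solve-∀

    Event : Set
    Event = Fin m × Fin m

    code : Fin (m * m) → Event
    code = remQuot m

    bad : Event → Vec (Fin a) P → Bool
    bad (u , v) ω = clash u v ∧ (pick u ω ∧ pick v ω)

    -- The factor `ι (clash u v)` frees harmless pairs of all coordinates, so that only clashing
    -- pairs count in the dependency degree.
    touch : Event → Fin P → ℕ
    touch (u , v) p = ι (clash u v) * (ι (p == α u) + ι (p == α v))

    dep : Event → Fin P → Bool
    dep x p = does (1 ≤? touch x p)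

    nb : Event → Event → Bool
    nb x x′ = does (1 ≤? ∑ λ p → touch x p * touch x′ p)

    -- A clashing pair touches two A-vertices, and each of these is touched by at most `2 a s b`
    -- ordered clashing pairs. Both edges of a pair are picked with probability at most `1/a^2`, so
    -- the Local Lemma asks for `16 s b ≤ a`, which is `wide`.
    Δ : ℕ
    Δ = 4 * (a * (s * b))

    clashes-at : ∀ p → ∑ (λ u → ι (p == α u) * ∑ λ v → ι (clash u v)) ≤ a * (s * b)
    clashes-at p = begin
      ∑ (λ u → ι (p == α u) * ∑ λ v → ι (clash u v)) ≤⟨ ∑-mono (λ u → *-monoʳ-≤ (ι (p == α u)) (per-edge u)) ⟩
      ∑ (λ u → ι (p == α u) * (ι (E u) * (s * b))) ≡⟨ trans (∑-cong λ u → sym (*-assoc (ι (p == α u)) (ι (E u)) (s * b))) (∑-*ʳ (s * b) (λ u → ι (p == α u) * ι (E u))) ⟩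
      ∑ (λ u → ι (p == α u) * ι (E u)) * (s * b) ≤⟨ *-monoˡ-≤ (s * b) deg ⟩
      a * (s * b) ∎
      where
      open ≤-Reasoning
      deg : ∑ (λ u → ι (p == α u) * ι (E u)) ≤ a
      deg with A′ p in A′p
      ... | true  = ≤-trans (∑-mono term) (≤-reflexive (A-deg p A′p))
        where
        term : ∀ u → ι (p == α u) * ι (E u) ≤ ι (E u) * ι (h p u)
        term u with p Fin.≟ α u
        ... | no  _    = z≤n
        ... | yes refl = ≤-reflexive (trans (+-identityʳ _) (sym (trans (cong (λ i → ι (E u) * ι i) (α-h u)) (*-identityʳ _))))
      ... | false = ≤-trans (≤-reflexive (∑-zero term)) z≤n
        where
        term : ∀ u → ι (p == α u) * ι (E u) ≡ 0
        term u with p Fin.≟ α u | E u in Eu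
        ... | no  _    | _     = refl
        ... | yes _    | false = refl
        ... | yes refl | true  = ⊥-elim (true≢false (alive u Eu) A′p)
      per-edge : ∀ u → ∑ (λ v → ι (clash u v)) ≤ ι (E u) * (s * b)
      per-edge u = begin
        ∑ (λ v → ι (clash u v)) ≤⟨ ∑-mono (clash≤ u) ⟩
        ∑ (λ v → ι (E u) * (ι (E v) * common u v)) ≡⟨ ∑-*ˡ (ι (E u)) (λ v → ι (E v) * common u v) ⟩
        ι (E u) * ∑ (λ v → ι (E v) * common u v) ≤⟨ *-monoʳ-≤ (ι (E u)) (begin
          ∑ (λ v → ι (E v) * common u v)
            ≡⟨ ∑-cong (λ v → trans (sym (∑-*ˡ (ι (E v)) (λ q → ι (not (A q)) * ι (h q u) * ι (h q v)))) (∑-cong λ q → arr (ι (E v)) (ι (not (A q)) * ι (h q u)) (ι (h q v)))) ⟩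
          ∑ (λ v → ∑ λ q → ι (not (A q)) * ι (h q u) * (ι (E v) * ι (h q v)))
            ≡⟨ ∑-pull (λ q → ι (not (A q)) * ι (h q u)) (λ q v → ι (E v) * ι (h q v)) ⟩
          ∑ (λ q → ι (not (A q)) * ι (h q u) * degree-in E q)
            ≤⟨ ∑-mono (λ q → B-term q) ⟩
          ∑ (λ q → ι (not (A q)) * ι (h q u) * b)
            ≡⟨ trans (∑-*ʳ b (λ q → ι (not (A q)) * ι (h q u))) (cong (_* b) (B-size u)) ⟩
          s * b ∎) ⟩
        ι (E u) * (s * b) ∎
        where
        arr : ∀ a b c → a * (b * c) ≡ b * (a * c)
        arr = solve-∀
        B-term : ∀ q → ι (not (A q)) * ι (h q u) * degree-in E q ≤ ι (not (A q)) * ι (h q u) * b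
        B-term q with A q in Aq
        ... | true  = z≤n
        ... | false = *-monoʳ-≤ (ι (h q u) + 0) (B-deg q Aq)

    touching : ∀ p → ∑ (λ x → touch (code x) p) ≤ 2 * (a * (s * b))
    touching p = begin
      ∑ (λ x → touch (code x) p) ≡⟨ ∑-× m m (λ x → touch x p) ⟩
      ∑ (λ u → ∑ λ v → ι (clash u v) * (ι (p == α u) + ι (p == α v)))
        ≡⟨ trans (∑-cong λ u → trans (∑-cong λ v → arr (ι (clash u v)) (ι (p == α u)) (ι (p == α v))) (∑-+ (λ v → ι (p == α u) * ι (clash u v)) (λ v → ι (p == α v) * ι (clash u v))))
             (∑-+ (λ u → ∑ λ v → ι (p == α u) * ι (clash u v)) (λ u → ∑ λ v → ι (p == α v) * ι (clash u v))) ⟩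
      ∑ (λ u → ∑ λ v → ι (p == α u) * ι (clash u v)) + ∑ (λ u → ∑ λ v → ι (p == α v) * ι (clash u v))
        ≡⟨ cong₂ _+_ (∑-cong λ u → ∑-*ˡ (ι (p == α u)) (λ v → ι (clash u v)))
             (trans (∑-pull (λ v → ι (p == α v)) (λ v u → ι (clash u v))) (∑-cong λ v → cong (ι (p == α v) *_) (∑-cong λ u → cong ι (clash-sym u v)))) ⟩
      ∑ (λ u → ι (p == α u) * ∑ λ v → ι (clash u v)) + ∑ (λ v → ι (p == α v) * ∑ λ u → ι (clash v u))
        ≤⟨ +-mono-≤ (clashes-at p) (clashes-at p) ⟩
      a * (s * b) + a * (s * b) ≡⟨ cong (a * (s * b) +_) (sym (+-identityʳ _)) ⟩
      2 * (a * (s * b)) ∎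
      where
      open ≤-Reasoning
      arr : ∀ c x y → c * (x + y) ≡ x * c + y * c
      arr = solve-∀

    few : ∀ x → ∑ (λ x′ → ι (nb (code x) (code x′))) ≤ Δ
    few x = begin
      ∑ (λ x′ → ι (nb (code x) (code x′))) ≤⟨ ∑-mono (λ x′ → ι-does (1 ≤? ∑ λ p → touch (code x) p * touch (code x′) p)) ⟩
      ∑ (λ x′ → ∑ λ p → touch (code x) p * touch (code x′) p) ≡⟨ ∑-pull (touch (code x)) (λ p x′ → touch (code x′) p) ⟩
      ∑ (λ p → touch (code x) p * ∑ (λ x′ → touch (code x′) p)) ≤⟨ ∑-*≤ (touch (code x)) _ touching ⟩
      ∑ (touch (code x)) * (2 * (a * (s * b))) ≤⟨ *-monoˡ-≤ (2 * (a * (s * b))) (two (code x)) ⟩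
      2 * (2 * (a * (s * b))) ≡⟨ sym (*-assoc 2 2 (a * (s * b))) ⟩
      Δ ∎
      where
      open ≤-Reasoning
      one : ∀ q → ∑ (λ p → ι (p == q)) ≡ 1
      one q = trans (∑-cong λ p → trans (cong ι (==-sym p q)) (sym (*-identityʳ (ι (q == p))))) (∑-δ q (λ _ → 1))
      two : ∀ x → ∑ (touch x) ≤ 2
      two (u , v) = ≤-trans (∑-mono λ p → ι* (clash u v) (ι (p == α u) + ι (p == α v)))
        (≤-reflexive (trans (∑-+ (λ p → ι (p == α u)) (λ p → ι (p == α v))) (cong₂ _+_ (one (α u)) (one (α v)))))

    pick-rare : ∀ u → a * total (ι ∘ pick u) ≤ a ^ P
    pick-rare u = ≤-trans (≤-reflexive (total-lookup (α u) (λ j → ι (Selection.selects (selection (α u)) u j))))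
      (≤-trans (*-monoʳ-≤ (a ^ P) (Selection.≤once (selection (α u)) u)) (≤-reflexive (*-identityʳ _)))

    aᴾ≢0 : NonZero (a ^ P)
    aᴾ≢0 = m^n≢0 a P ⦃ >-nonZero a>0 ⦄

    pick-dep : ∀ u ω ω′ → lookup ω (α u) ≡ lookup ω′ (α u) → pick u ω ≡ pick u ω′
    pick-dep u ω ω′ e = cong (Selection.selects (selection (α u)) u) e

    bad-rare : ∀ x → a * a * total (ι ∘ bad x) ≤ a ^ P
    bad-rare (u , v) = go (α u Fin.≟ α v)
      where
      open ≤-Reasoning
      arr : ∀ n a x → n * (a * a * x) ≡ a * a * (n * x)
      arr = solve-∀
      arr₂ : ∀ a x y → a * a * (x * y) ≡ a * x * (a * y)
      arr₂ = solve-∀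
      ι-∧∧ : ∀ x y z → ι (x ∧ (y ∧ z)) ≤ ι y * ι z
      ι-∧∧ true  y z = ≤-reflexive (ι-∧ y z)
      ι-∧∧ false y z = z≤n
      no-clash : α u ≡ α v → ∀ ω → bad (u , v) ω ≡ false
      no-clash e ω = cong (_∧ (pick u ω ∧ pick v ω)) (trans (cong (λ i → (E u ∧ E v) ∧ (not i ∧ does (1 ≤? common u v))) (dec-true (α u Fin.≟ α v) e)) (Bool.∧-zeroʳ (E u ∧ E v)))
      go : Dec (α u ≡ α v) → a * a * total (ι ∘ bad (u , v)) ≤ a ^ P
      go (yes e) = ≤-trans (≤-reflexive (trans (cong (a * a *_) (trans (total-cong λ ω → cong ι (no-clash e ω)) (total-zero {a} {P}))) (*-zeroʳ (a * a)))) z≤n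
      go (no αu≢αv) = *-cancelˡ-≤ (a ^ P) ⦃ aᴾ≢0 ⦄ (begin
          a ^ P * (a * a * total (ι ∘ bad (u , v))) ≤⟨ *-monoʳ-≤ (a ^ P) (*-monoʳ-≤ (a * a) (total-mono λ ω → ι-∧∧ (clash u v) (pick u ω) (pick v ω))) ⟩
          a ^ P * (a * a * total (λ ω → ι (pick u ω) * ι (pick v ω))) ≡⟨ arr (a ^ P) a _ ⟩
          a * a * (a ^ P * total (λ ω → ι (pick u ω) * ι (pick v ω))) ≡⟨ cong (a * a *_) (independence (α u ==_) (ι ∘ pick u) (ι ∘ pick v)
                                                                           (λ ω ω′ k → cong ι (pick-dep u ω ω′ (k (α u) (==-refl (α u)))))
                                                                           (λ ω ω′ k → cong ι (pick-dep v ω ω′ (k (α v) (cong not (≢-== αu≢αv)))))) ⟩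
          a * a * (total (ι ∘ pick u) * total (ι ∘ pick v)) ≡⟨ arr₂ a (total (ι ∘ pick u)) (total (ι ∘ pick v)) ⟩
          a * total (ι ∘ pick u) * (a * total (ι ∘ pick v)) ≤⟨ *-mono-≤ (pick-rare u) (pick-rare v) ⟩
          a ^ P * a ^ P ∎)

    small : ∀ x → 4 * Δ * total (ι ∘ bad (code x)) ≤ a ^ P
    small x = ≤-trans (*-monoˡ-≤ _ (begin
      4 * (4 * (a * (s * b))) ≡⟨ arr a (s * b) ⟩
      a * (16 * (s * b)) ≤⟨ *-monoʳ-≤ a wide ⟩
      a * a ∎)) (bad-rare (code x))
      where
      open ≤-Reasoning
      arr : ∀ a x → 4 * (4 * (a * x)) ≡ a * (16 * x)
      arr = solve-∀

    bad-dep : ∀ x → DependsOn (dep x) (bad x)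
    bad-dep (u , v) ω ω′ k with clash u v
    ... | false = refl
    ... | true  = cong₂ _∧_ (pick-dep u ω ω′ (k (α u) (dec-true (1 ≤? _) (subst (λ i → 1 ≤ ι i + ι (α u == α v) + 0) (sym (==-refl (α u))) (s≤s z≤n)))))
                            (pick-dep v ω ω′ (k (α v) (dec-true (1 ≤? _) (subst (λ i → 1 ≤ ι (α v == α u) + ι i + 0) (sym (==-refl (α v))) (≤-trans (m≤n+m 1 (ι (α v == α u))) (m≤m+n _ 0))))))

    nb-dep : ∀ x x′ → nb x x′ ≡ false → ∀ p → dep x p ≡ true → dep x′ p ≡ true → ⊥
    nb-dep x x′ e p dp dq = does-false (1 ≤? ∑ (λ p → touch x p * touch x′ p)) e
      (≤-trans (*-mono-≤ (does⇒ (1 ≤? touch x p) dp) (does⇒ (1 ≤? touch x′ p) dq)) (≤∑ (λ p → touch x p * touch x′ p) p))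

    Δ>0 : 1 ≤ Δ
    Δ>0 = *-mono-≤ {1} {4} (s≤s z≤n) (*-mono-≤ a>0 (*-mono-≤ s>0 b>0))

    abstract
      outcome : ∃ λ ω → ∀ x → bad (code x) ω ≡ false
      outcome = LLL.avoid-all (bad ∘ code) (dep ∘ code) (λ x y → nb (code x) (code y)) Δ a>0 Δ>0
        (bad-dep ∘ code) (λ x x′ → nb-dep (code x) (code x′)) small few

  finish : Matching H E A′
  finish = record { M = λ u → E u ∧ pick u ω ; M⊂E = λ u → ∧-fst ; disjoint = disjoint ; covers = covers }
    where
    ω = proj₁ outcome
    good : ∀ u v → bad (u , v) ω ≡ false
    good u v = subst (λ x → bad x ω ≡ false) (Fin.remQuot-combine {m} u v) (proj₂ outcome (combine u v))
    disjoint : ∀ p u v → u ≢ v → (E u ∧ pick u ω) ≡ true → (E v ∧ pick v ω) ≡ true → h p u ≡ true → h p v ≡ true → ⊥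
    disjoint p u v u≢v Mu Mv hu hv = true≢false (∧-intro (∧-intro (∧-intro (∧-fst {E u} Mu) (∧-fst {E v} Mv)) (∧-intro {not (α u == α v)} (cong not (≢-== α≢)) (dec-true (1 ≤? common u v) shared)))
        (∧-intro (∧-snd {E u} Mu) (∧-snd {E v} Mv))) (good u v)
      where
      α≢ : α u ≢ α v
      α≢ e = u≢v (same (α v) e (∧-snd {E u} Mu))
        where
        same : ∀ q → α u ≡ q → Selection.selects (selection (α u)) u (lookup ω (α u)) ≡ true → u ≡ v
        same q e′ r = Selection.unique (selection (α v)) u v (lookup ω (α v)) (subst (λ i → Selection.selects (selection i) u (lookup ω i) ≡ true) e r) (∧-snd {E v} Mv)
      shared : 1 ≤ common u v
      shared with A p in Ap
      ... | true  = ⊥-elim (α≢ (trans (sym (α-unique p u Ap hu)) (α-unique p v Ap hv)))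
      ... | false = ≤-trans (≤-reflexive (sym (cong₂ _*_ (cong₂ (λ i j → ι (not i) * ι j) Ap hu) (cong ι hv)))) (≤∑ (λ q → ι (not (A q)) * ι (h q u) * ι (h q v)) p)
    covers : ∀ p → A′ p ≡ true → ∃ λ u → (E u ∧ pick u ω) ≡ true × h p u ≡ true
    covers p A′p with Selection.nonempty (selection p) A′p (lookup ω p)
    ... | u , q with Selection.sound (selection p) u (lookup ω p) q
    ...   | Eu , hu = u , ∧-intro Eu (subst (λ i → Selection.selects (selection i) u (lookup ω i) ≡ true) (α-unique p u (A′⊂A p A′p) hu) q) , hu

-- Iteration of the nibble

private
  ≤/ : ∀ m n .⦃ _ : NonZero n ⦄ → n * (m / n) ≤ m
  ≤/ m n = ≤-trans (≤-reflexive (*-comm n (m / n))) (m/n*n≤m m n)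

  </ : ∀ m n .⦃ _ : NonZero n ⦄ → m < n * suc (m / n)
  </ m n = begin-strict
    m ≡⟨ m≡m%n+[m/n]*n m n ⟩
    m % n + m / n * n <⟨ +-monoˡ-< (m / n * n) (m%n<n m n) ⟩
    n + m / n * n ≡⟨ *-comm (suc (m / n)) n ⟩
    n * suc (m / n) ∎
    where open ≤-Reasoning

  positive : ∀ {n} → 1 ≤ n → Σ ℕ λ n′ → suc n′ ≡ n
  positive {suc n} _ = n , refl

module Iterate (s G : ℕ) (1≤s : 1 ≤ s) where
  k κk r : ℕ
  -- The dependency degree is of order `b^5`, with `b ≤ D ≤ Y^G`; one more factor `Y` absorbs the
  -- constant `κ₂`.
  k  = suc (G * 5)
  κk = k + κ k
  r  = suc s

  open Constants s r k κk

  Y₀ : ℕ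
  Y₀ = (4 * κ₀ + (2 * κ₁ + κ₂)) + (17 * s + 18)

  18≤Y₀ : 18 ≤ Y₀
  18≤Y₀ = ≤-trans (m≤n+m 18 (17 * s)) (m≤n+m _ (4 * κ₀ + (2 * κ₁ + κ₂)))

  module _ (Y : ℕ) (Y₀≤Y : Y₀ ≤ Y) {P m c : ℕ} (H : Incidence P m s c) (D : ℕ) (1≤c : 1 ≤ c) where
    private
      Z X : ℕ
      -- Two demands fix these powers: `X * Y * Y ≤ Z` keeps the deviation `t` below the gain of
      -- `δ`, and `Z * Y * Y ≤ X * X` keeps the quadratic form below `t`. Together they force
      -- `X ≥ Y^4`, and both are equalities here.
      Z = Y * Y * Y * Y * Y * Y
      X = Y * Y * Y * Y

      18≤Y : 18 ≤ Y
      18≤Y = ≤-trans 18≤Y₀ Y₀≤Y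
      17s≤Y : 17 * s ≤ Y
      17s≤Y = ≤-trans (≤-trans (m≤m+n (17 * s) 18) (m≤n+m _ (4 * κ₀ + (2 * κ₁ + κ₂)))) Y₀≤Y
      4κ₀≤Y : 4 * κ₀ ≤ Y
      4κ₀≤Y = ≤-trans (≤-trans (m≤m+n (4 * κ₀) _) (m≤m+n (4 * κ₀ + (2 * κ₁ + κ₂)) (17 * s + 18))) Y₀≤Y
      2κ₁≤Y : 2 * κ₁ ≤ Y
      2κ₁≤Y = ≤-trans (≤-trans (≤-trans (m≤m+n (2 * κ₁) κ₂) (m≤n+m _ (4 * κ₀))) (m≤m+n (4 * κ₀ + (2 * κ₁ + κ₂)) (17 * s + 18))) Y₀≤Y
      κ₂≤Y : κ₂ ≤ Y
      κ₂≤Y = ≤-trans (≤-trans (≤-trans (m≤n+m κ₂ (2 * κ₁)) (m≤n+m _ (4 * κ₀))) (m≤m+n (4 * κ₀ + (2 * κ₁ + κ₂)) (17 * s + 18))) Y₀≤Y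

      1≤Y : 1 ≤ Y
      1≤Y = ≤-trans (s≤s z≤n) 18≤Y
      Y≢0 : NonZero Y
      Y≢0 = >-nonZero 1≤Y
      1≤X : 1 ≤ X
      1≤X = *-mono-≤ (*-mono-≤ (*-mono-≤ 1≤Y 1≤Y) 1≤Y) 1≤Y
      X≢0 : NonZero X
      X≢0 = >-nonZero 1≤X
      1≤Z : 1 ≤ Z
      1≤Z = *-mono-≤ (*-mono-≤ 1≤X 1≤Y) 1≤Y
      Z≢0 : NonZero Z
      Z≢0 = >-nonZero 1≤Z
      Y≤X : Y ≤ X
      Y≤X = ≤-trans (≤-reflexive (sym (*-identityˡ Y))) (*-monoˡ-≤ Y (*-mono-≤ (*-mono-≤ 1≤Y 1≤Y) 1≤Y))

      n≤n*p : ∀ n {p} → 1 ≤ p → n ≤ n * p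
      n≤n*p n 1≤p = ≤-trans (≤-reflexive (sym (*-identityʳ n))) (*-monoʳ-≤ n 1≤p)

    -- The last two components say δ/b ≥ 1/Y and (b + δ) (δ/b)^(8s) ≥ D / Y^(8s).
    Invariant : ℕ → ℕ → Set
    Invariant b δ = 1 ≤ b × b ≤ D × b ≤ Y * δ × D * b ^ (8 * s) ≤ (b + δ) * (δ * Y) ^ (8 * s)

    module OneStep (D≤Yᴳ : D ≤ Y ^ G) (hc : c * (Z * Z * Y * Y * (Y * (Y * Y) ^ (8 * s))) ≤ D)
      {b δ : ℕ} (inv : Invariant b δ) (narrow : b + δ ≤ 16 * s * b) where

      private
        1≤b : 1 ≤ b
        1≤b = proj₁ inv
        b≤D = proj₁ (proj₂ inv)
        b≤Yδ = proj₁ (proj₂ (proj₂ inv))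
        pot = proj₂ (proj₂ (proj₂ inv))

        -- The margin `Y^14` is the one that `linear₃` asks for; `Z ≤ b`, `c ≤ b` and
        -- `X * X * c ≤ b` are read off from it.
        cY¹⁴≤b : c * (Z * Z * Y * Y) ≤ b
        cY¹⁴≤b = codegree-small s Y D (b + δ) b δ c (Z * Z * Y * Y) 1≤b 1≤Y (≤-trans (*-monoˡ-≤ s (n≤1+n 16)) 17s≤Y) narrow (≤-trans (m≤n+m δ b) narrow) pot hc

        Z≤b : Z ≤ b
        Z≤b = ≤-trans (≤-trans (≤-trans (n≤n*p Z 1≤Z) (n≤n*p (Z * Z) 1≤Y)) (n≤n*p (Z * Z * Y) 1≤Y))
                (≤-trans (≤-trans (≤-reflexive (sym (*-identityˡ _))) (*-monoˡ-≤ (Z * Z * Y * Y) 1≤c)) cY¹⁴≤b)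

        c≤b : c ≤ b
        c≤b = ≤-trans (n≤n*p c (*-mono-≤ (*-mono-≤ (*-mono-≤ 1≤Z 1≤Z) 1≤Y) 1≤Y)) cY¹⁴≤b

        XXc≤b : X * X * c ≤ b
        XXc≤b = ≤-trans (≤-trans (n≤n*p (X * X * c) (*-mono-≤ (*-mono-≤ (*-mono-≤ (*-mono-≤ (*-mono-≤ 1≤Y 1≤Y) 1≤Y) 1≤Y) 1≤Y) 1≤Y)) (≤-reflexive (l c Y))) cY¹⁴≤b
          where
          l : ∀ c Y → Y * Y * Y * Y * (Y * Y * Y * Y) * c * (Y * Y * Y * Y * Y * Y) ≡ c * (Y * Y * Y * Y * Y * Y * (Y * Y * Y * Y * Y * Y) * Y * Y)
          l = solve-∀

        Xc≤b : X * c ≤ b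
        Xc≤b = ≤-trans (*-monoˡ-≤ c (n≤n*p X 1≤X)) XXc≤b

      t μ ν : ℕ
      t = _/_ b Z ⦃ Z≢0 ⦄
      μ = _/_ ((b + δ) * s) X ⦃ X≢0 ⦄
      ν = _/_ (s * b + δ) X ⦃ X≢0 ⦄

      private
        1≤t : 1 ≤ t
        1≤t = n≢0⇒n>0 λ t≡0 → <⇒≱ (</ b Z ⦃ Z≢0 ⦄) (≤-trans (≤-reflexive (trans (cong (λ z → Z * suc z) t≡0) (*-identityʳ Z))) Z≤b)

        b≤2tZ : b ≤ 2 * t * Z
        b≤2tZ = ≤-trans (<⇒≤ (</ b Z ⦃ Z≢0 ⦄)) (≤-trans (*-monoʳ-≤ Z (+-monoˡ-≤ t 1≤t)) (≤-reflexive (l Z t)))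
          where
          l : ∀ Z t → Z * (t + t) ≡ 2 * t * Z
          l = solve-∀

        W*Y*Y≤b : X * t * Y * Y ≤ b
        W*Y*Y≤b = ≤-trans (≤-reflexive (l Y t)) (≤/ b Z ⦃ Z≢0 ⦄)
          where
          l : ∀ Y t → Y * Y * Y * Y * t * Y * Y ≡ Y * Y * Y * Y * Y * Y * t
          l = solve-∀

        16W : 16 * (X * t) ≤ δ
        16W = ≤-trans (≤-trans (*-monoˡ-≤ (X * t) (≤-trans (m≤n+m 16 2) 18≤Y)) (≤-reflexive (*-comm Y (X * t))))
          (*-cancelˡ-≤ Y ⦃ Y≢0 ⦄ (≤-trans (≤-reflexive (*-comm Y (X * t * Y))) (≤-trans W*Y*Y≤b b≤Yδ)))

        18W : 18 * (X * t) ≤ b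
        18W = ≤-trans (≤-trans (*-monoˡ-≤ (X * t) 18≤Y) (≤-trans (≤-reflexive (*-comm Y (X * t))) (n≤n*p (X * t * Y) 1≤Y))) W*Y*Y≤b

        hμ′ : (b + δ) * s < X * suc μ
        hμ′ = </ ((b + δ) * s) X ⦃ X≢0 ⦄

        module Decr = Decrement s X t b δ μ ν 1≤s (≤-trans 17s≤Y Y≤X) 1≤t 16W 18W narrow
          (≤/ ((b + δ) * s) X ⦃ X≢0 ⦄) (≤/ (s * b + δ) X ⦃ X≢0 ⦄) (<⇒≤ (</ (s * b + δ) X ⦃ X≢0 ⦄))

      open Decr public using (b₂; a₂; δ₂; b₂<b; b₂+δ₂)
      open Decr using (1≤b₂; ratio; loss; a₂+; b₂+ν)

      private
        1≤δ : 1 ≤ δ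
        1≤δ = ≤-trans (*-mono-≤ {1} {16} (s≤s z≤n) (*-mono-≤ 1≤X 1≤t)) 16W

        δb₂≤bδ₂ : δ * b₂ ≤ b * δ₂
        δb₂≤bδ₂ = *-cancelˡ-≤ (2 * X) ⦃ m*n≢0 2 X ⦃ _ ⦄ ⦃ X≢0 ⦄ ⦄ (≤-trans (*-monoˡ-≤ (δ * b₂) (m≤m+n (2 * X) 1)) ratio)

        b₂≤Yδ₂ : b₂ ≤ Y * δ₂
        b₂≤Yδ₂ = *-cancelˡ-≤ δ ⦃ >-nonZero 1≤δ ⦄ (≤-trans δb₂≤bδ₂ (≤-trans (*-monoˡ-≤ δ₂ b≤Yδ) (≤-reflexive (l Y δ δ₂))))
          where
          l : ∀ Y δ d → Y * δ * d ≡ δ * (Y * d)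
          l = solve-∀

        pot₂ : D * b₂ ^ (8 * s) ≤ (b₂ + δ₂) * (δ₂ * Y) ^ (8 * s)
        pot₂ = *-cancelˡ-≤ (b ^ M) ⦃ m^n≢0 b M ⦃ >-nonZero 1≤b ⦄ ⦄ (begin
          b ^ M * (D * b₂ ^ M) ≡⟨ l₁ (b ^ M) D (b₂ ^ M) ⟩
          D * b ^ M * b₂ ^ M ≤⟨ *-monoˡ-≤ (b₂ ^ M) pot ⟩
          (b + δ) * (δ * Y) ^ M * b₂ ^ M ≡⟨ trans (*-assoc (b + δ) _ _) (cong ((b + δ) *_) (trans (sym (^-distrib-* (δ * Y) b₂ M)) (trans (cong (_^ M) (l₂ δ Y b₂)) (^-distrib-* (δ * b₂) Y M)))) ⟩
          (b + δ) * ((δ * b₂) ^ M * Y ^ M) ≡⟨ sym (*-assoc (b + δ) _ _) ⟩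
          (b + δ) * (δ * b₂) ^ M * Y ^ M ≤⟨ *-monoˡ-≤ (Y ^ M) (potential s X (b + δ) a₂ δ δ₂ b b₂ 1≤X (≤-trans (≤-trans (*-monoˡ-≤ s (m≤n+m 4 13)) 17s≤Y) Y≤X) loss ratio) ⟩
          a₂ * (b * δ₂) ^ M * Y ^ M ≡⟨ trans (*-assoc a₂ _ _) (cong (a₂ *_) (trans (sym (^-distrib-* (b * δ₂) Y M)) (trans (cong (_^ M) (*-assoc b δ₂ Y)) (^-distrib-* b (δ₂ * Y) M)))) ⟩
          a₂ * (b ^ M * (δ₂ * Y) ^ M) ≡⟨ l₃ a₂ (b ^ M) ((δ₂ * Y) ^ M) ⟩
          b ^ M * (a₂ * (δ₂ * Y) ^ M) ≡⟨ cong (λ z → b ^ M * (z * (δ₂ * Y) ^ M)) (sym b₂+δ₂) ⟩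
          b ^ M * ((b₂ + δ₂) * (δ₂ * Y) ^ M) ∎)
          where
          open ≤-Reasoning
          M : ℕ
          M = 8 * s
          l₁ : ∀ p D q → p * (D * q) ≡ D * p * q
          l₁ = solve-∀
          l₂ : ∀ δ Y b → δ * Y * b ≡ δ * b * Y
          l₂ = solve-∀
          l₃ : ∀ a p q → a * (p * q) ≡ p * (a * q)
          l₃ = solve-∀

      invariant₂ : Invariant b₂ δ₂
      invariant₂ = 1≤b₂ , ≤-trans (<⇒≤ b₂<b) b≤D , b₂≤Yδ₂ , pot₂

      reduce : ∀ E A′ → State H (b + δ) b E A′ → (∀ E₂ A₂ → State H (b₂ + δ₂) b₂ E₂ A₂ → Matching H E₂ A₂) → Matching H E A′
      reduce E A′ st continue = Nibble.nibble H E A′ st (m≤m+n b δ) T′ k (κ₀ * (c * b) * (suc T′ * suc T′)) Y t (κ₁ * (b * b * b)) Λ>0 1≤Y B>0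
          (linear₁ (b + δ) b c narrow (suc T′) c≤b)
          (linear₂ (b + δ) b c narrow (suc T′) b≤T)
          (linear₃ (b + δ) b c narrow Y Z t (suc T′) 1≤Y 1≤Z cY¹⁴≤b b≤2tZ 4κ₀≤Y)
          (subst (λ T → 2 * ((b + δ) * (r * (b + δ)) * (r * (b + δ))) + T * ((b + δ) * (r * (r * c))) + 2 * T * (2 * k) * (2 * (c * r * (r * (b + δ)))) + T * T * (2 * k + 2 * k * (2 * k)) * (2 * (c * r * r)) ≤ κ₁ * (b * b * b))
            (sym T≡) (quadratic₁ (b + δ) b c narrow X Xc≤b XXc≤b))
          (≤-trans (quadratic₂ (b + δ) b c narrow Y Z t b≤2tZ 2κ₁≤Y) (≤-reflexive (trans (cong (_* t) (l₁ b Y)) (cong (λ T → T * T * t) (sym T≡)))))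
          degenerate
          a₂ b₂ μ ν
          (≤-trans (≤-trans (≤-reflexive (sym (*-assoc (b + δ) s b))) (*-monoˡ-≤ b (<⇒≤ hμ′))) (≤-reflexive (trans (l₂ X (suc μ) b) (cong (_* suc μ) (sym T≡)))))
          (≤-reflexive a₂+)
          (subst (λ T → T * ν + b * b ≤ b * ((b + δ) + s * b)) (sym T≡)
            (≤-trans (+-monoˡ-≤ (b * b) (≤-trans (≤-reflexive (*-assoc b X ν)) (*-monoʳ-≤ b (≤/ (s * b + δ) X ⦃ X≢0 ⦄)))) (≤-reflexive (l₃ b s δ))))
          (≤-trans (+-monoˡ-≤ (s * b) narrow) (≤-trans (≤-reflexive (l₄ s b)) (≤-trans (*-monoʳ-≤ b (≤-trans 17s≤Y Y≤X)) (≤-reflexive (sym T≡)))))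
          (≤-reflexive (sym b₂+ν))
          (λ E₂ A₂ st₂ → continue E₂ A₂ (subst (λ a → State H a b₂ E₂ A₂) (sym b₂+δ₂) st₂))
        where
        T′ : ℕ
        T′ = proj₁ (positive (*-mono-≤ 1≤b 1≤X))
        T≡ : suc T′ ≡ b * X
        T≡ = proj₂ (positive (*-mono-≤ 1≤b 1≤X))
        l₁ : ∀ b Y → b * b * (Y * Y * Y * Y * Y * Y * Y * Y) ≡ b * (Y * Y * Y * Y) * (b * (Y * Y * Y * Y))
        l₁ = solve-∀
        l₂ : ∀ X u b → X * u * b ≡ b * X * u
        l₂ = solve-∀
        l₃ : ∀ b s δ → b * (s * b + δ) + b * b ≡ b * ((b + δ) + s * b)
        l₃ = solve-∀
        l₄ : ∀ s b → 16 * s * b + s * b ≡ b * (17 * s)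
        l₄ = solve-∀
        b≤T : b ≤ suc T′
        b≤T = ≤-trans (n≤n*p b 1≤X) (≤-reflexive (sym T≡))
        Λ>0 : 1 ≤ κ₀ * (c * b) * (suc T′ * suc T′)
        Λ>0 = *-mono-≤ (*-mono-≤ {1} {κ₀} (κ₀>0 (s≤s z≤n)) (*-mono-≤ 1≤c 1≤b)) (s≤s z≤n)
        B>0 : 1 ≤ κ₁ * (b * b * b)
        B>0 = *-mono-≤ {1} {κ₁} κ₁>0 (*-mono-≤ (*-mono-≤ 1≤b 1≤b) 1≤b)
        degenerate : 12 * Nibble.degeneracy H E A′ st (m≤m+n b δ) T′ k (κ₀ * (c * b) * (suc T′ * suc T′)) Y t (κ₁ * (b * b * b)) Λ>0 1≤Y B>0 ≤ Y ^ k
        degenerate = ≤-trans (degeneracy≤ (b + δ) b c narrow (s≤s z≤n) 1≤s 1≤b)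
          (≤-trans (*-mono-≤ κ₂≤Y (^-monoˡ-≤ 5 (≤-trans b≤D D≤Yᴳ))) (≤-reflexive (cong (Y *_) (^-*-assoc Y G 5))))

    -- The recursion is on a bound for `b`, which drops strictly in every step. No estimate of the
    -- number of steps enters, since the invariant already controls all sizes at every step.
    iterate : D ≤ Y ^ G → c * (Z * Z * Y * Y * (Y * (Y * Y) ^ (8 * s))) ≤ D → ∀ n b δ → b ≤ n → Invariant b δ → ∀ E A′ → State H (b + δ) b E A′ → Matching H E A′
    iterate hG hc zero    b δ b≤n inv E A′ st = ⊥-elim (1+n≰n (≤-trans (proj₁ inv) b≤n))
    iterate hG hc (suc n) b δ b≤n inv E A′ st = go (16 * s * b ≤? b + δ)
      where
      go : Dec (16 * s * b ≤ b + δ) → Matching H E A′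
      go (yes wide) = Finish.finish H E A′ st 1≤s (≤-trans (proj₁ inv) (m≤m+n b δ)) (proj₁ inv) (≤-trans (≤-reflexive (sym (*-assoc 16 s b))) wide)
      go (no ¬wide) = S.reduce E A′ st (iterate hG hc n S.b₂ S.δ₂ (s≤s⁻¹ (≤-trans S.b₂<b b≤n)) S.invariant₂)
        where module S = OneStep hG hc {b} {δ} inv (<⇒≤ (≰⇒> ¬wide))

-- D disjoint A-perfect matchings of G as one matching of an auxiliary (r+1)-uniform incidence structure: D copies (v , k) of
-- every vertex, a vertex for every edge of G (so that copies of one edge are not used twice), and padding.

∣∣-∑ : ∀ {n} (p : Subset n) → Subset.∣ p ∣ ≡ ∑ (λ i → ι (lookup p i))
∣∣-∑ []          = refl
∣∣-∑ (true ∷ p)  = cong suc (∣∣-∑ p)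
∣∣-∑ (false ∷ p) = ∣∣-∑ p

∣tabulate∣-∑ : ∀ {n} (f : Fin n → Bool) → Subset.∣ Vec.tabulate f ∣ ≡ ∑ (ι ∘ f)
∣tabulate∣-∑ f = trans (∣∣-∑ (Vec.tabulate f)) (∑-cong λ i → cong ι (lookup∘tabulate f i))

∈⇒ : ∀ {n} {p : Subset n} {v} → v ∈ p → lookup p v ≡ true
∈⇒ = []=⇒lookup

⇒∈ : ∀ {n} (p : Subset n) v → lookup p v ≡ true → v ∈ p
⇒∈ p v = lookup⇒[]= v p

∑-==≤1 : ∀ {n} (i : Fin n) → ∑ (λ j → ι (i == j)) ≤ 1
∑-==≤1 i = ≤-reflexive (trans (∑-cong λ j → sym (*-identityʳ (ι (i == j)))) (∑-δ i (λ _ → 1)))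

module Auxiliary {n m : ℕ} (G : Hypergraph n m) (A₀ : Subset n) (r D c : ℕ) (bounded : RBounded r G) (bip : Bipartite G A₀)
  (1≤c : 1 ≤ c) (cod : ∀ u v → u ≢ v → codegree G u v ≤ c) where

  private
    inc : Fin m → Fin n → Bool
    inc i v = lookup (edge G i) v

  Node : Set
  Node = Fin n × Fin D ⊎ (Fin m ⊎ Fin (m * D) × Fin r)

  P : ℕ
  P = n * D + (m + m * D * r)

  private
    dec₂ : Fin (m + m * D * r) → Fin m ⊎ Fin (m * D) × Fin r
    dec₂ = map₂ (remQuot {m * D} r) ∘ splitAt m

    enc₂ : Fin m ⊎ Fin (m * D) × Fin r → Fin (m + m * D * r)
    enc₂ (inj₁ e)       = e ↑ˡ (m * D * r)
    enc₂ (inj₂ (u , j)) = m ↑ʳ combine u j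

    enc₂-dec₂ : ∀ p → enc₂ (dec₂ p) ≡ p
    enc₂-dec₂ p with splitAt m p in e
    ... | inj₁ i = trans (cong (join m (m * D * r)) (sym e)) (Fin.join-splitAt m (m * D * r) p)
    ... | inj₂ y = trans (cong (m ↑ʳ_) (Fin.combine-remQuot {m * D} r y)) (trans (cong (join m (m * D * r)) (sym e)) (Fin.join-splitAt m (m * D * r) p))

  dec : Fin P → Node
  dec p with splitAt (n * D) p
  ... | inj₁ x = inj₁ (remQuot {n} D x)
  ... | inj₂ y = inj₂ (dec₂ y)

  enc : Node → Fin P
  enc (inj₁ (v , k)) = combine v k ↑ˡ (m + m * D * r)
  enc (inj₂ y)       = (n * D) ↑ʳ enc₂ y

  enc-dec : ∀ p → enc (dec p) ≡ p
  enc-dec p with splitAt (n * D) p in e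
  ... | inj₁ x = trans (cong (_↑ˡ (m + m * D * r)) (Fin.combine-remQuot {n} D x)) (trans (cong (join (n * D) (m + m * D * r)) (sym e)) (Fin.join-splitAt (n * D) _ p))
  ... | inj₂ y = trans (cong ((n * D) ↑ʳ_) (enc₂-dec₂ y)) (trans (cong (join (n * D) (m + m * D * r)) (sym e)) (Fin.join-splitAt (n * D) _ p))

  dec-vertex : ∀ v k → dec (enc (inj₁ (v , k))) ≡ inj₁ (v , k)
  dec-vertex v k rewrite Fin.splitAt-↑ˡ (n * D) (combine v k) (m + m * D * r) = cong inj₁ (Fin.remQuot-combine v k)

  dec-edge : ∀ e → dec (enc (inj₂ (inj₁ e))) ≡ inj₂ (inj₁ e)
  dec-edge e rewrite Fin.splitAt-↑ʳ (n * D) (m + m * D * r) (e ↑ˡ (m * D * r)) | Fin.splitAt-↑ˡ m e (m * D * r) = refl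

  dec-injective : ∀ {p q} → dec p ≡ dec q → p ≡ q
  dec-injective {p} {q} e = trans (sym (enc-dec p)) (trans (cong enc e) (enc-dec q))

  ∑-dec : ∀ (F : Node → ℕ) → ∑ (λ p → F (dec p)) ≡ ∑ (λ v → ∑ λ k → F (inj₁ (v , k))) + (∑ (λ e → F (inj₂ (inj₁ e))) + ∑ (λ u → ∑ λ j → F (inj₂ (inj₂ (u , j)))))
  ∑-dec F = trans (trans (∑-cong lem) (∑-⊎ (n * D) F′)) (cong₂ _+_ (∑-× n D (F ∘ inj₁)) (trans (trans (∑-cong lem₂) (∑-⊎ m F″)) (cong (∑ (λ e → F (inj₂ (inj₁ e))) +_) (∑-× (m * D) r (F ∘ inj₂ ∘ inj₂)))))
    where
    F′ : Fin (n * D) ⊎ Fin (m + m * D * r) → ℕ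
    F′ (inj₁ x) = F (inj₁ (remQuot {n} D x))
    F′ (inj₂ y) = F (inj₂ (dec₂ y))
    lem : ∀ p → F (dec p) ≡ F′ (splitAt (n * D) p)
    lem p with splitAt (n * D) p
    ... | inj₁ x = refl
    ... | inj₂ y = refl
    F″ : Fin m ⊎ Fin (m * D * r) → ℕ
    F″ (inj₁ e) = F (inj₂ (inj₁ e))
    F″ (inj₂ y) = F (inj₂ (inj₂ (remQuot {m * D} r y)))
    lem₂ : ∀ y → F (inj₂ (dec₂ y)) ≡ F″ (splitAt m y)
    lem₂ y with splitAt m y
    ... | inj₁ e = refl
    ... | inj₂ z = refl

  ed : Fin (m * D) → Fin m × Fin D
  ed = remQuot {m} D

  size : Fin m → ℕ
  size i = ∑ λ v → ι (inc i v)

  size≤r : ∀ i → size i ≤ r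
  size≤r i = ≤-trans (≤-reflexive (sym (∣∣-∑ (edge G i)))) (bounded i)

  -- The `k`-th copy of an edge of `G` contains the `k`-th copies of its vertices, one node shared
  -- by all copies of that edge, and padding nodes that belong to it alone.
  hᴺ : Node → Fin (m * D) → Bool
  hᴺ (inj₁ (v , k))        u = (k == proj₂ (ed u)) ∧ inc (proj₁ (ed u)) v
  hᴺ (inj₂ (inj₁ e))       u = e == proj₁ (ed u)
  hᴺ (inj₂ (inj₂ (u′ , j))) u = (u′ == u) ∧ (toℕ j <ᵇ (r ∸ size (proj₁ (ed u))))

  Aᴺ : Node → Bool
  Aᴺ (inj₁ (v , k)) = lookup A₀ v
  Aᴺ (inj₂ _)       = false

  A-weight : ∀ i → ∑ (λ v → ι (inc i v) * ι (lookup A₀ v)) ≡ 1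
  A-weight i = trans (∑-cong λ v → trans (sym (ι-∧ (inc i v) (lookup A₀ v))) (cong ι (sym (lookup-zipWith _∧_ v (edge G i) A₀)))) (trans (sym (∣∣-∑ (edge G i ∩ A₀))) (bip i))

  root : ∀ i → ∃ λ v → inc i v ≡ true × lookup A₀ v ≡ true
  root i with ∑-pos (λ v → ι (inc i v) * ι (lookup A₀ v)) (≤-reflexive (sym (A-weight i)))
  ... | v , q with inc i v in e₁ | lookup A₀ v in e₂
  ...   | true  | true  = v , e₁ , e₂
  ...   | true  | false = ⊥-elim (1+n≰n q)
  ...   | false | _     = ⊥-elim (1+n≰n q)

  root-unique : ∀ i v → inc i v ≡ true → lookup A₀ v ≡ true → v ≡ proj₁ (root i)
  root-unique i v h₁ h₂ with v Fin.≟ proj₁ (root i)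
  ... | yes e = e
  ... | no ne = ⊥-elim (1+n≰n (≤-trans (≤-reflexive (sym (cong₂ _+_ (cong₂ (λ a b → ι a * ι b) h₁ h₂) (cong₂ (λ a b → ι a * ι b) (proj₁ (proj₂ (root i))) (proj₂ (proj₂ (root i)))))))
    (≤-trans (≤∑₂ (λ v → ι (inc i v) * ι (lookup A₀ v)) ne) (≤-reflexive (A-weight i)))))

  ∑ed : ∀ (F : Fin m × Fin D → ℕ) → ∑ (λ u → F (ed u)) ≡ ∑ λ i → ∑ λ k → F (i , k)
  ∑ed = ∑-× m D

  -- The edge node takes the place of the one A-vertex, so there are `size i` B-nodes before
  -- padding, and `r - size i` padding nodes complete them.
  B-count : ∀ u → ∑ (λ p → ι (not (Aᴺ (dec p))) * ι (hᴺ (dec p) u)) ≡ r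
  B-count u = begin-equality
    ∑ (λ p → ι (not (Aᴺ (dec p))) * ι (hᴺ (dec p) u)) ≡⟨ ∑-dec (λ x → ι (not (Aᴺ x)) * ι (hᴺ x u)) ⟩
    ∑ (λ v → ∑ λ k → ι (not (lookup A₀ v)) * ι ((k == κ′) ∧ inc i v)) + (∑ (λ e → 1 * ι (e == i)) + ∑ (λ u′ → ∑ {r} λ j → 1 * ι ((u′ == u) ∧ (toℕ j <ᵇ pad))))
      ≡⟨ cong₂ _+_ (∑-cong vertices) (cong₂ _+_ (trans (∑-cong λ e → trans (*-identityˡ (ι (e == i))) (trans (cong ι (==-sym e i)) (sym (*-identityʳ (ι (i == e)))))) (∑-δ i (λ _ → 1))) pads) ⟩
    ∑ (λ v → ι (not (lookup A₀ v)) * ι (inc i v)) + (1 + pad) ≡⟨ sym (+-assoc _ 1 pad) ⟩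
    ∑ (λ v → ι (not (lookup A₀ v)) * ι (inc i v)) + 1 + pad ≡⟨ cong (_+ pad) sizes ⟩
    size i + pad ≡⟨ m+[n∸m]≡n (size≤r i) ⟩
    r ∎
    where
    open ≤-Reasoning
    i : Fin m
    i = proj₁ (ed u)
    κ′ : Fin D
    κ′ = proj₂ (ed u)
    pad : ℕ
    pad = r ∸ size i
    vertices : ∀ v → ∑ (λ k → ι (not (lookup A₀ v)) * ι ((k == κ′) ∧ inc i v)) ≡ ι (not (lookup A₀ v)) * ι (inc i v)
    vertices v = trans (∑-cong λ k → trans (cong (ι (not (lookup A₀ v)) *_) (trans (ι-∧ (k == κ′) (inc i v)) (cong (λ z → ι z * ι (inc i v)) (==-sym k κ′)))) (arr (ι (not (lookup A₀ v))) (ι (κ′ == k)) (ι (inc i v))))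
      (∑-δ κ′ (λ _ → ι (not (lookup A₀ v)) * ι (inc i v)))
      where
      arr : ∀ a b c → a * (b * c) ≡ b * (a * c)
      arr = solve-∀
    pads : ∑ (λ u′ → ∑ {r} λ j → 1 * ι ((u′ == u) ∧ (toℕ j <ᵇ pad))) ≡ pad
    pads = trans (∑-cong λ u′ → trans (∑-cong {r} λ j → trans (*-identityˡ (ι ((u′ == u) ∧ (toℕ j <ᵇ pad)))) (trans (ι-∧ (u′ == u) (toℕ j <ᵇ pad)) (cong (λ z → ι z * ι (toℕ j <ᵇ pad)) (==-sym u′ u)))) (∑-*ˡ {r} (ι (u == u′)) (λ j → ι (toℕ j <ᵇ pad))))
      (trans (∑-δ u (λ _ → ∑ {r} (λ j → ι (toℕ j <ᵇ pad)))) (∑-<ᵇ {r} pad (m∸n≤m r (size i))))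
    sizes : ∑ (λ v → ι (not (lookup A₀ v)) * ι (inc i v)) + 1 ≡ size i
    sizes = trans (cong (∑ (λ v → ι (not (lookup A₀ v)) * ι (inc i v)) +_) (sym (A-weight i))) (trans (sym (∑-+ (λ v → ι (not (lookup A₀ v)) * ι (inc i v)) (λ v → ι (inc i v) * ι (lookup A₀ v))))
      (∑-cong λ v → lem (lookup A₀ v) (inc i v)))
      where
      lem : ∀ x y → ι (not x) * ι y + ι y * ι x ≡ ι y
      lem true  true  = refl
      lem true  false = refl
      lem false true  = refl
      lem false false = refl

  degree-vertex : ∀ v k → ∑ (λ u → ι (hᴺ (inj₁ (v , k)) u)) ≡ degree G v
  degree-vertex v k = trans (∑ed (λ x → ι ((k == proj₂ x) ∧ inc (proj₁ x) v))) (trans (∑-cong λ i → trans (∑-cong λ k′ → ι-∧ (k == k′) (inc i v)) (∑-δ k (λ _ → ι (inc i v)))) (sym (∣tabulate∣-∑ (λ i → inc i v))))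

  -- One incidence per copy: this meets the degree bound `D` of the B-side exactly, so `D` copies
  -- are as many as the construction can afford.
  degree-edge : ∀ e → ∑ (λ u → ι (hᴺ (inj₂ (inj₁ e)) u)) ≡ D
  degree-edge e = trans (∑ed (λ x → ι (e == proj₁ x))) (trans (∑-cong λ i → trans (∑-const D (ι (e == i))) (*-comm D _)) (∑-δ e (λ _ → D)))

  degree-pad : ∀ u′ j → ∑ (λ u → ι (hᴺ (inj₂ (inj₂ (u′ , j))) u)) ≤ 1
  degree-pad u′ j = ≤-trans (∑-mono λ u → ≤-trans (≤-reflexive (ι-∧ (u′ == u) _)) (*ι (ι (u′ == u)) _)) (∑-==≤1 u′)

  -- Only two vertices in the same copy inherit a codegree from `G`. Distinct copies, and distinct
  -- edge nodes, have no common edge; every other pair has at most one, which `1≤c` covers.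
  codegᴺ : ∀ x y → x ≢ y → ∑ (λ u → ι (hᴺ x u) * ι (hᴺ y u)) ≤ c
  codegᴺ (inj₂ (inj₂ (u′ , j))) y x≢y = ≤-trans (≤-trans (∑-mono λ u → *ι (ι (hᴺ (inj₂ (inj₂ (u′ , j))) u)) (hᴺ y u)) (degree-pad u′ j)) 1≤c
  codegᴺ x (inj₂ (inj₂ (u′ , j))) x≢y = ≤-trans (≤-trans (∑-mono λ u → ι* (hᴺ x u) (ι (hᴺ (inj₂ (inj₂ (u′ , j))) u))) (degree-pad u′ j)) 1≤c
  codegᴺ (inj₂ (inj₁ e)) (inj₂ (inj₁ e′)) x≢y = ≤-trans (≤-reflexive (∑-zero zeros)) z≤n
    where
    zeros : ∀ u → ι (e == proj₁ (ed u)) * ι (e′ == proj₁ (ed u)) ≡ 0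
    zeros u with e Fin.≟ proj₁ (ed u) | e′ Fin.≟ proj₁ (ed u)
    ... | no _   | _      = refl
    ... | yes _  | no _   = refl
    ... | yes e₁ | yes e₂ = ⊥-elim (x≢y (cong (inj₂ ∘ inj₁) (trans e₁ (sym e₂))))
  codegᴺ (inj₁ (v , k)) (inj₂ (inj₁ e)) x≢y = ≤-trans (≤-trans (∑-mono λ u → *-monoˡ-≤ (ι (e == proj₁ (ed u))) (≤-trans (≤-reflexive (ι-∧ (k == proj₂ (ed u)) _)) (*ι (ι (k == proj₂ (ed u))) _)))
    (≤-trans (≤-reflexive (trans (∑ed (λ x → ι (k == proj₂ x) * ι (e == proj₁ x))) (trans (∑-cong λ i → ∑-*ʳ (ι (e == i)) (λ k′ → ι (k == k′))) (trans (∑-cong λ i → *-comm _ (ι (e == i))) (∑-δ e (λ _ → ∑ (λ k′ → ι (k == k′)))))))) (∑-==≤1 k))) 1≤c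
  codegᴺ (inj₂ (inj₁ e)) (inj₁ (v , k)) x≢y = ≤-trans (≤-reflexive (∑-cong λ u → *-comm (ι (hᴺ (inj₂ (inj₁ e)) u)) (ι (hᴺ (inj₁ (v , k)) u)))) (codegᴺ (inj₁ (v , k)) (inj₂ (inj₁ e)) (x≢y ∘ sym))
  codegᴺ (inj₁ (v , k)) (inj₁ (v′ , k′)) x≢y with k Fin.≟ k′
  ... | no k≢k′ = ≤-trans (≤-reflexive (∑-zero zeros)) z≤n
    where
    zeros : ∀ u → ι ((k == proj₂ (ed u)) ∧ inc (proj₁ (ed u)) v) * ι ((k′ == proj₂ (ed u)) ∧ inc (proj₁ (ed u)) v′) ≡ 0
    zeros u with k Fin.≟ proj₂ (ed u) | k′ Fin.≟ proj₂ (ed u)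
    ... | no _   | _      = refl
    ... | yes _  | no _   = *-zeroʳ (ι (inc (proj₁ (ed u)) v))
    ... | yes e₁ | yes e₂ = ⊥-elim (k≢k′ (trans e₁ (sym e₂)))
  ... | yes refl = begin
    ∑ (λ u → ι ((k == proj₂ (ed u)) ∧ inc (proj₁ (ed u)) v) * ι ((k == proj₂ (ed u)) ∧ inc (proj₁ (ed u)) v′))
      ≡⟨ ∑-cong (λ u → lem (k == proj₂ (ed u)) (inc (proj₁ (ed u)) v) (inc (proj₁ (ed u)) v′)) ⟩
    ∑ (λ u → ι (k == proj₂ (ed u)) * ι (inc (proj₁ (ed u)) v ∧ inc (proj₁ (ed u)) v′))
      ≡⟨ ∑ed (λ x → ι (k == proj₂ x) * ι (inc (proj₁ x) v ∧ inc (proj₁ x) v′)) ⟩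
    ∑ (λ i → ∑ λ k′ → ι (k == k′) * ι (inc i v ∧ inc i v′)) ≡⟨ ∑-cong (λ i → ∑-δ k (λ _ → ι (inc i v ∧ inc i v′))) ⟩
    ∑ (λ i → ι (inc i v ∧ inc i v′)) ≡⟨ sym (∣tabulate∣-∑ (λ i → inc i v ∧ inc i v′)) ⟩
    codegree G v v′ ≤⟨ cod v v′ (λ e → x≢y (cong (λ z → inj₁ (z , k)) e)) ⟩
    c ∎
    where
    open ≤-Reasoning
    lem : ∀ x y z → ι (x ∧ y) * ι (x ∧ z) ≡ ι x * ι (y ∧ z)
    lem true  true  z = refl
    lem true  false z = refl
    lem false y     z = refl

  incidence : Incidence P (m * D) r c
  incidence = record
    { A        = Aᴺ ∘ dec
    ; h        = hᴺ ∘ dec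
    ; α        = α
    ; α-A      = λ u → trans (cong Aᴺ (dec-vertex _ _)) (proj₂ (proj₂ (root (proj₁ (ed u)))))
    ; α-h      = λ u → trans (cong (λ x → hᴺ x u) (dec-vertex _ _)) (∧-intro (==-refl (proj₂ (ed u))) (proj₁ (proj₂ (root (proj₁ (ed u))))))
    ; α-unique = α-unique
    ; B-size   = B-count
    ; codeg    = λ p q p≢q → codegᴺ (dec p) (dec q) (p≢q ∘ dec-injective)
    }
    where
    α : Fin (m * D) → Fin P
    α u = enc (inj₁ (proj₁ (root (proj₁ (ed u))) , proj₂ (ed u)))
    α-unique : ∀ p u → Aᴺ (dec p) ≡ true → hᴺ (dec p) u ≡ true → p ≡ α u
    α-unique p u Ap hp = trans (sym (enc-dec p)) (lem (dec p) Ap hp)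
      where
      lem : ∀ x → Aᴺ x ≡ true → hᴺ x u ≡ true → enc x ≡ α u
      lem (inj₁ (v , k)) Ax hx = cong₂ (λ v k → enc (inj₁ (v , k))) (root-unique (proj₁ (ed u)) v (∧-snd {k == proj₂ (ed u)} hx) Ax) (==-true {i = k} (∧-fst hx))

  all-edges : Fin (m * D) → Bool
  all-edges _ = true

  initial-state : ∀ δ → 1 ≤ D → (∀ v → v ∈ A₀ → D + δ ≤ degree G v) → (∀ v → v ∉ A₀ → degree G v ≤ D) →
    Σ (Fin (m * D) → Bool) λ E → (∀ u → E u ≡ true → all-edges u ≡ true) × State incidence (D + δ) D E (Aᴺ ∘ dec)
  initial-state δ 1≤D large small = trim-state incidence {E = all-edges} (λ p q → q) (λ u _ → Incidence.α-A incidence u)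
    (λ p Ap → ≤-trans (lower (dec p) Ap) (≤-reflexive (∑-cong λ u → sym (+-identityʳ (ι (hᴺ (dec p) u))))))
    (λ p Bp → ≤-trans (≤-reflexive (∑-cong λ u → +-identityʳ (ι (hᴺ (dec p) u)))) (upper (dec p) Bp))
    where
    lower : ∀ x → Aᴺ x ≡ true → D + δ ≤ ∑ (λ u → ι (hᴺ x u))
    lower (inj₁ (v , k)) Ax = ≤-trans (large v (⇒∈ A₀ v Ax)) (≤-reflexive (sym (degree-vertex v k)))
    upper : ∀ x → Aᴺ x ≡ false → ∑ (λ u → ι (hᴺ x u)) ≤ D
    upper (inj₁ (v , k))         Bx = ≤-trans (≤-reflexive (degree-vertex v k)) (small v λ v∈A → true≢false (∈⇒ v∈A) Bx)
    upper (inj₂ (inj₁ e))        Bx = ≤-reflexive (degree-edge e)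
    upper (inj₂ (inj₂ (u , j)))  Bx = ≤-trans (degree-pad u j) 1≤D

  split-matching : ∀ {E} → Matching incidence E (Aᴺ ∘ dec) →
    Σ (Fin D → Subset m) λ M → (∀ k → IsAPerfectMatching G A₀ (M k)) × (∀ k l → k ≢ l → Empty (M k ∩ M l))
  split-matching μ = M , (λ k → matching k , perfect k) , edge-disjoint
    where
    open Matching μ renaming (M to M₀)
    M : Fin D → Subset m
    M k = Vec.tabulate λ i → M₀ (combine i k)
    M⇒ : ∀ {k i} → i ∈ M k → M₀ (combine i k) ≡ true
    M⇒ {k} {i} q = trans (sym (lookup∘tabulate (λ i → M₀ (combine i k)) i)) (∈⇒ q)
    ed-combine : ∀ i k → ed (combine i k) ≡ (i , k)
    ed-combine = Fin.remQuot-combine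
    at-vertex : ∀ v i k → v ∈ edge G i → hᴺ (dec (enc (inj₁ (v , k)))) (combine i k) ≡ true
    at-vertex v i k v∈ = trans (cong₂ (λ x y → hᴺ x y) (dec-vertex v k) refl) (trans (cong (λ z → (k == proj₂ z) ∧ inc (proj₁ z) v) (ed-combine i k)) (∧-intro (==-refl k) (∈⇒ v∈)))
    at-edge : ∀ i k → hᴺ (dec (enc (inj₂ (inj₁ i)))) (combine i k) ≡ true
    at-edge i k = trans (cong (λ x → hᴺ x (combine i k)) (dec-edge i)) (trans (cong (λ z → i == proj₁ z) (ed-combine i k)) (==-refl i))
    matching : ∀ k → IsMatching G (M k)
    matching k i j i≢j i∈ j∈ (v , v∈) with x∈p∩q⁻ (edge G i) (edge G j) v∈
    ... | v∈i , v∈j = disjoint (enc (inj₁ (v , k))) (combine i k) (combine j k) (λ e → i≢j (proj₁ (Fin.combine-injective i k j k e))) (M⇒ i∈) (M⇒ j∈) (at-vertex v i k v∈i) (at-vertex v j k v∈j)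
    edge-disjoint : ∀ k l → k ≢ l → Empty (M k ∩ M l)
    edge-disjoint k l k≢l (i , i∈) with x∈p∩q⁻ (M k) (M l) i∈
    ... | i∈k , i∈l = disjoint (enc (inj₂ (inj₁ i))) (combine i k) (combine i l) (λ e → k≢l (proj₂ (Fin.combine-injective i k i l e))) (M⇒ i∈k) (M⇒ i∈l) (at-edge i k) (at-edge i l)
    perfect : ∀ k → APerfect G A₀ (M k)
    perfect k v v∈A with covers (enc (inj₁ (v , k))) (trans (cong Aᴺ (dec-vertex v k)) (∈⇒ v∈A))
    ... | u , Mu , hu with trans (sym (cong (λ x → hᴺ x u) (dec-vertex v k))) hu
    ...   | hu′ = proj₁ (ed u) , ⇒∈ (M k) (proj₁ (ed u)) (trans (lookup∘tabulate (λ i → M₀ (combine i k)) (proj₁ (ed u))) (trans (cong M₀ u≡) Mu))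
                , ⇒∈ (edge G (proj₁ (ed u))) v (∧-snd {k == proj₂ (ed u)} hu′)
      where
      u≡ : combine (proj₁ (ed u)) k ≡ u
      u≡ = trans (cong (combine (proj₁ (ed u))) (==-true {i = k} (∧-fst hu′))) (Fin.combine-remQuot {m} D u)

  reduction : ∀ δ → 1 ≤ D → (∀ v → v ∈ A₀ → D + δ ≤ degree G v) → (∀ v → v ∉ A₀ → degree G v ≤ D) →
    (∀ E → State incidence (D + δ) D E (Aᴺ ∘ dec) → Matching incidence E (Aᴺ ∘ dec)) →
    Σ (Fin D → Subset m) λ M → (∀ k → IsAPerfectMatching G A₀ (M k)) × (∀ k l → k ≢ l → Empty (M k ∩ M l))
  reduction δ 1≤D large small finish = split-matching (finish (proj₁ init) (proj₂ (proj₂ init)))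
    where
    init : Σ (Fin (m * D) → Bool) λ E → (∀ u → E u ≡ true → all-edges u ≡ true) × State incidence (D + δ) D E (Aᴺ ∘ dec)
    init = initial-state δ 1≤D large small

-- Integer roots, rounding and the choice of parameters

m*n≤o⇒m≤o/n : ∀ m n o .⦃ _ : NonZero n ⦄ → m * n ≤ o → m ≤ o / n
m*n≤o⇒m≤o/n m n o h = ≤-trans (≤-reflexive (sym (m*n/n≡m m n))) (/-monoˡ-≤ n h)

integer-root : ∀ g D Y₀ → 1 ≤ g → Y₀ ^ g ≤ D → Σ ℕ λ Y → Y₀ ≤ Y × Y ^ g ≤ D × D < suc Y ^ g
integer-root g D Y₀ 1≤g h₀ = search D Y₀ ≤-refl h₀ (m≤n+m D Y₀)
  where
  ≤^ : ∀ Y → Y ≤ Y ^ g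
  ≤^ zero    = z≤n
  ≤^ (suc Y) = ≤-trans (≤-reflexive (sym (*-identityʳ (suc Y)))) (^-monoʳ-≤ (suc Y) 1≤g)
  search : ∀ n Y → Y₀ ≤ Y → Y ^ g ≤ D → D ≤ Y + n → Σ ℕ λ Y → Y₀ ≤ Y × Y ^ g ≤ D × D < suc Y ^ g
  search zero    Y h₁ h₂ h₃ = Y , h₁ , h₂ , ≤-trans (s≤s (≤-trans h₃ (≤-reflexive (+-identityʳ Y)))) (≤^ (suc Y))
  search (suc n) Y h₁ h₂ h₃ with suc Y ^ g ≤? D
  ... | yes p = search n (suc Y) (≤-trans h₁ (n≤1+n Y)) p (≤-trans h₃ (≤-reflexive (+-suc Y n)))
  ... | no ¬p = Y , h₁ , h₂ , ≰⇒> ¬p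

ceiling : ∀ D Y → 1 ≤ D → 1 ≤ Y → Σ ℕ λ δ → D ≤ Y * δ × (∀ e → D ≤ Y * e → δ ≤ e)
ceiling (suc D) Y _ 1≤Y = suc (D / Y) , upper , λ e h → m<n*o⇒m/o<n (≤-trans h (≤-reflexive (*-comm Y e)))
  where
  instance
    Y≢0 : NonZero Y
    Y≢0 = >-nonZero 1≤Y
  upper : suc D ≤ Y * suc (D / Y)
  upper = begin
    suc D ≡⟨ cong suc (m≡m%n+[m/n]*n D Y) ⟩
    suc (D % Y) + D / Y * Y ≤⟨ +-monoˡ-≤ (D / Y * Y) (m%n<n D Y) ⟩
    Y + D / Y * Y ≡⟨ *-comm (suc (D / Y)) Y ⟩
    Y * suc (D / Y) ∎
    where open ≤-Reasoning

-- Y ≈ D^(1/g), c = ⌊D / Y^h⌋ and α = 1/(2g), where β = a/b and g = h b.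
module Parameters (r a b h : ℕ) (1≤r : 1 ≤ r) (1≤a : 1 ≤ a) (1≤b : 1 ≤ b) (1≤h : 1 ≤ h)
  (collect : ∀ Y → Y * Y * Y * Y * Y * Y * (Y * Y * Y * Y * Y * Y) * Y * Y * (Y * (Y * Y) ^ (8 * r)) ≡ Y ^ h) where
  g : ℕ
  g = h * b

  1≤g : 1 ≤ g
  1≤g = *-mono-≤ 1≤h 1≤b

  open Iterate r (2 * g) 1≤r using (Y₀; 18≤Y₀; iterate) public

  module At (D : ℕ) (1≤D : 1 ≤ D) (Y : ℕ) (Y₀≤Y : Y₀ ≤ Y) (Yᵍ≤D : Y ^ g ≤ D) (D< : D < suc Y ^ g)
    (δ : ℕ) (D≤Yδ : D ≤ Y * δ) (δ-least : ∀ e → D ≤ Y * e → δ ≤ e) where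
    open ≤-Reasoning
    2≤Y : 2 ≤ Y
    2≤Y = ≤-trans (≤-trans (m≤m+n 2 16) 18≤Y₀) Y₀≤Y
    1≤Y : 1 ≤ Y
    1≤Y = ≤-trans (s≤s z≤n) 2≤Y
    Y≢0 : NonZero Y
    Y≢0 = >-nonZero 1≤Y
    Yʰ≢0 : NonZero (Y ^ h)
    Yʰ≢0 = m^n≢0 Y h ⦃ Y≢0 ⦄
    D≢0 : NonZero D
    D≢0 = >-nonZero 1≤D
    b≢0 : NonZero b
    b≢0 = >-nonZero 1≤b
    2g≢0 : NonZero (2 * g)
    2g≢0 = >-nonZero (*-mono-≤ {1} {2} (s≤s z≤n) 1≤g)
    -- Rounding the root down only gives `D < (Y + 1)^g`, and `Y + 1 ≤ Y^2` costs a factor two in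
    -- the exponent. This is the `2` in `α = 1/(2g)` and in `G = 2 * g`.
    D<Y²ᵍ : D < Y ^ (2 * g)
    D<Y²ᵍ = begin-strict
      D <⟨ D< ⟩
      suc Y ^ g ≤⟨ ^-monoˡ-≤ g (≤-trans (+-monoˡ-≤ Y 1≤Y) (≤-trans (≤-reflexive (cong (Y +_) (sym (+-identityʳ Y)))) (*-monoˡ-≤ Y 2≤Y))) ⟩
      (Y * Y) ^ g ≡⟨ cong (_^ g) (cong (Y *_) (sym (*-identityʳ Y))) ⟩
      (Y ^ 2) ^ g ≡⟨ ^-*-assoc Y 2 g ⟩
      Y ^ (2 * g) ∎
    D≤Y²ᵍ : D ≤ Y ^ (2 * g)
    D≤Y²ᵍ = <⇒≤ D<Y²ᵍ
    c : ℕ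
    c = _/_ D (Y ^ h) ⦃ Yʰ≢0 ⦄
    1≤c : 1 ≤ c
    1≤c = m*n≤o⇒m≤o/n 1 (Y ^ h) D ⦃ Yʰ≢0 ⦄ (≤-trans (≤-reflexive (*-identityˡ _)) (≤-trans (^-monoʳ-≤ Y ⦃ Y≢0 ⦄ (≤-trans (≤-reflexive (sym (*-identityʳ h))) (*-monoʳ-≤ h 1≤b))) Yᵍ≤D))
    c-small : c * (Y * Y * Y * Y * Y * Y * (Y * Y * Y * Y * Y * Y) * Y * Y * (Y * (Y * Y) ^ (8 * r))) ≤ D
    c-small = ≤-trans (≤-reflexive (cong (c *_) (collect Y))) (m/n*n≤m D (Y ^ h) ⦃ Yʰ≢0 ⦄)
    module _ {n m : ℕ} (G : Hypergraph n m) (A : Subset n) (bounded : RBounded r G) (bip : Bipartite G A)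
      (degA : ∀ v → v ∈ A → DegLower D 1 (2 * g) (degree G v)) (degB : ∀ v → v ∉ A → degree G v ≤ D) (codegs : ∀ u v → u ≢ v → CodegUpper D a b (codegree G u v)) where
      -- `Y^h` is at most `D^(1/b)`, hence at most `D^(a/b)`, so a codegree of at most `D^(1 - a/b)`
      -- times `Y^h` does not exceed `D`.
      cod : ∀ u v → u ≢ v → codegree G u v ≤ c
      cod u v u≢v = m*n≤o⇒m≤o/n x (Y ^ h) D ⦃ Yʰ≢0 ⦄ (≮⇒≥ λ D<xYʰ → <⇒≱ (begin-strict
        D ^ b <⟨ ^-monoˡ-< b ⦃ b≢0 ⦄ D<xYʰ ⟩
        (x * Y ^ h) ^ b ≡⟨ trans (^-distrib-* x (Y ^ h) b) (cong (x ^ b *_) (^-*-assoc Y h b)) ⟩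
        x ^ b * Y ^ g ≤⟨ *-monoʳ-≤ (x ^ b) (≤-trans Yᵍ≤D (≤-trans (≤-reflexive (sym (*-identityʳ D))) (^-monoʳ-≤ D ⦃ D≢0 ⦄ 1≤a))) ⟩
        x ^ b * D ^ a ∎) (codegs u v u≢v))
        where
        x = codegree G u v
      -- The excess `e` satisfies `e ≥ D / D^(1/(2g))`, and `D^(1/(2g))` is below `Y`; so
      -- `D ≤ Y * e`, and `δ` is the least number with this property.
      large : ∀ v → v ∈ A → D + δ ≤ degree G v
      large v v∈A = ≤-trans (+-monoʳ-≤ D (δ-least e (≮⇒≥ λ Ye<D → <⇒≱ D<Y²ᵍ (<⇒≤ (*-cancelˡ-< (e ^ (2 * g)) _ _ (begin-strict
          e ^ (2 * g) * Y ^ (2 * g) ≡⟨ trans (*-comm (e ^ (2 * g)) _) (sym (^-distrib-* Y e (2 * g))) ⟩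
          (Y * e) ^ (2 * g) <⟨ ^-monoˡ-< (2 * g) ⦃ 2g≢0 ⦄ Ye<D ⟩
          D ^ (2 * g) ≤⟨ proj₂ (degA v v∈A) ⟩
          e ^ (2 * g) * D ^ 1 ≡⟨ cong (e ^ (2 * g) *_) (*-identityʳ D) ⟩
          e ^ (2 * g) * D ∎)))))) (≤-reflexive (m+[n∸m]≡n (proj₁ (degA v v∈A))))
        where
        e = degree G v ∸ D

      open Auxiliary G A r D c bounded bip 1≤c cod

      matchings : Σ (Fin D → Subset m) λ M → (∀ k → IsAPerfectMatching G A (M k)) × (∀ k l → k ≢ l → Empty (M k ∩ M l))
      matchings = reduction δ 1≤D large degB λ E st → iterate Y Y₀≤Y incidence D 1≤c D≤Y²ᵍ c-small D D δ ≤-refl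
        (1≤D , ≤-refl , D≤Yδ , *-mono-≤ (m≤m+n D δ) (^-monoˡ-≤ (8 * r) (≤-trans D≤Yδ (≤-reflexive (*-comm Y δ))))) E (Aᴺ ∘ dec) st

  Solvable : ℕ → Set
  Solvable D = {n m : ℕ} (G : Hypergraph n m) (A : Subset n) → RBounded r G → Bipartite G A →
    (∀ v → v ∈ A → DegLower D 1 (2 * g) (degree G v)) → (∀ v → v ∉ A → degree G v ≤ D) → (∀ u v → u ≢ v → CodegUpper D a b (codegree G u v)) →
    Σ (Fin D → Subset m) λ M → (∀ k → IsAPerfectMatching G A (M k)) × (∀ k l → k ≢ l → Empty (M k ∩ M l))

  solvable : ∀ D → Y₀ ^ g ≤ D → 1 ≤ D → Solvable D
  solvable D D₀≤D 1≤D = with-root (integer-root g D Y₀ 1≤g D₀≤D)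
    where
    with-root : (Σ ℕ λ Y → Y₀ ≤ Y × Y ^ g ≤ D × D < suc Y ^ g) → Solvable D
    with-root (Y , Y₀≤Y , Yᵍ≤D , D<) = with-ceiling (ceiling D Y 1≤D (≤-trans (≤-trans (m≤m+n 1 17) 18≤Y₀) Y₀≤Y))
      where
      with-ceiling : (Σ ℕ λ δ → D ≤ Y * δ × (∀ e → D ≤ Y * e → δ ≤ e)) → Solvable D
      with-ceiling (δ , D≤Yδ , δ-least) = At.matchings D 1≤D Y Y₀≤Y Yᵍ≤D D< δ D≤Yδ δ-least

theorem2p6 : (r : ℕ) → r ≥ 2 → (a b : ℕ) → 1 ≤ a → 1 ≤ b →
    Σ ℕ λ D₀ → Σ ℕ λ p → Σ ℕ λ q → 1 ≤ p × 1 ≤ q ×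
    ((D : ℕ) → D₀ ≤ D → 1 ≤ D →
    {n m : ℕ} (G : Hypergraph n m) (A : Subset n) →
    RBounded r G → Bipartite G A →
    (∀ v → v ∈ A → DegLower D p q (degree G v)) →
    (∀ v → v ∉ A → degree G v ≤ D) →
    (∀ u v → u ≢ v → CodegUpper D a b (codegree G u v)) →
    Σ (Fin D → Subset m) λ M →
    (∀ k → IsAPerfectMatching G A (M k)) ×
    (∀ k l → k ≢ l → Empty (M k ∩ M l)))
theorem2p6 r r≥2 a b 1≤a 1≤b = Y₀ ^ g , 1 , 2 * g , ≤-refl , *-mono-≤ {1} {2} (s≤s z≤n) 1≤g , solvable
  where
  powers : ∀ Y p → Y * Y * Y * Y * Y * Y * (Y * Y * Y * Y * Y * Y) * Y * Y * (Y * p) ≡ Y * (Y * (Y * (Y * (Y * (Y * (Y * (Y * (Y * (Y * (Y * (Y * (Y * (Y * (Y * p))))))))))))))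
  powers = solve-∀
  -- The exponent is `14` for the margin `Z * Z * Y * Y`, plus `1 + 16 * r` for the factor
  -- `Y * (Y * Y) ^ (8 * r)` by which `b` may fall below `D` while the potential inequality holds.
  collect : ∀ Y → Y * Y * Y * Y * Y * Y * (Y * Y * Y * Y * Y * Y) * Y * Y * (Y * (Y * Y) ^ (8 * r)) ≡ Y ^ (15 + 2 * (8 * r))
  collect Y = trans (cong (λ z → Y * Y * Y * Y * Y * Y * (Y * Y * Y * Y * Y * Y) * Y * Y * (Y * z))
    (trans (cong (λ z → (Y * z) ^ (8 * r)) (sym (*-identityʳ Y))) (^-*-assoc Y 2 (8 * r)))) (powers Y (Y ^ (2 * (8 * r))))
  open Parameters r a b (15 + 2 * (8 * r)) (≤-trans (s≤s z≤n) r≥2) 1≤a 1≤b (s≤s z≤n) collect
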